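{- Every two-dimensional topological similarity class in $\mathrm{Aut}(\mathbb{QU}_{\prec})$ is meager in $\mathrm{Aut}(\mathbb{QU}_{\prec})\times\mathrm{Aut}(\mathbb{QU}_{\prec})$.
   Context: $\mathbb{QU}_{\prec}$ (the randomly ordered rational Urysohn space) is the Fraïssé limit of the class of all finite ordered metric spaces with rational distances, where an ordered metric space is a triple $(A,d,<)$ with $d$ a metric and $<$ an arbitrary linear order on $A$; equivalently, it is the unique countable ordered metric space with rational distances into which every finite ordered metric space with rational distances embeds (isometrically and order-preservingly) and in which every isometric order-preserving bijection between finite subsets extends to an automorphism. $\mathrm{Aut}(\mathbb{QU}_{\prec})$ is the group of order-preserving isometric bijections of $\mathbb{QU}_{\prec}$, with the topology of pointwise convergence ($\mathbb{QU}_{\prec}$ taken discrete). For a topological group $K$, a pair $(g_1,g_2)\in K^2$ is topologically similar to $(f_1,f_2)\in K^2$ if the map $g_i\mapsto f_i$ ($i=1,2$) extends to a group isomorphism $\langle g_1,g_2\rangle\to\langle f_1,f_2\rangle$ that is a homeomorphism with respect to the subspace topologies; its equivalence classes are the two-dimensional topological similarity classes. -}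

module Defs where

open import Algebra.Bundles using (Group)
open import Algebra.Morphism.Structures using (module GroupMorphisms)
open import Data.Fin.Base using (Fin)
open import Data.List.Base using (List; []; _++_; map)
open import Data.List.Membership.Propositional using () renaming (_∈_ to _∈ₗ_)
open import Data.List.Membership.Propositional.Properties using (∈-++⁺ˡ; ∈-++⁺ʳ; ∈-map⁺)
open import Data.Nat.Base using (ℕ)
open import Data.Product.Base using (Σ-syntax; ∃; ∃-syntax; _×_; _,_; proj₁; proj₂; uncurry)
open import Data.Product.Relation.Binary.Pointwise.NonDependent using (×-setoid)
open import Data.Rational.Base using (ℚ)
open import Data.Unit.Base using (tt)
open import Function.Bundles using (_↔_; _↣_; Inverse)
open import Function.Construct.Composition using (_↔-∘_)
open import Function.Construct.Identity using (↔-id)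
open import Function.Construct.Symmetry using (↔-sym)
open import Function.Definitions using (Inverseᵇ)
open import Function.Metric.Rational.Structures using (IsMetric)
open import Level using (Level; 0ℓ; _⊔_) renaming (suc to lsuc)
open import Relation.Binary.Bundles using (Setoid)
open import Relation.Binary.Core using (Rel)
open import Relation.Binary.Definitions using (_Respects_; tri<; tri≈; tri>)
open import Relation.Binary.PropositionalEquality
  using (_≡_; refl; sym; trans; cong; cong₂; subst₂)
open import Relation.Binary.Structures using (IsStrictTotalOrder)
open import Relation.Nullary.Negation using (contradiction)
open import Relation.Unary using (Pred; _∈_; _⊆_; _≐_; _∩_; _≬_; _⊢_; ⋃; U; Empty)

private variable
  o o₁ o₂ ℓ : Level

-- Open sets are predicates at level 0ℓ and unions are indexed by types at level
-- 0ℓ. Under excluded middle at all levels every predicate on a type in Set is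
-- equivalent to one at level 0ℓ, so this is no restriction.

record Topology (o : Level) (X : Setoid 0ℓ 0ℓ) : Set (lsuc (0ℓ ⊔ o)) where
  open Setoid X using (Carrier; _≈_)
  field
    Open            : Pred Carrier 0ℓ → Set o
    Open⇒respects-≈ : ∀ {V} → Open V → V Respects _≈_
    Open-resp-≐     : ∀ {V W} → V ≐ W → Open V → Open W
    Open-U          : Open U
    Open-∩          : ∀ {V W} → Open V → Open W → Open (V ∩ W)
    Open-⋃          : (I : Set) (V : I → Pred Carrier 0ℓ) →
                      (∀ i → Open (V i)) → Open (⋃ I V)

module _ {X : Setoid 0ℓ 0ℓ} (τ : Topology o X) where
  open Setoid X using (Carrier)
  open Topology τ

  closure : Pred Carrier ℓ → Pred Carrier (lsuc 0ℓ ⊔ o ⊔ ℓ)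
  closure A x = ∀ V → Open V → x ∈ V → V ≬ A

  -- The interior of the closure (the union of the open sets it contains) is
  -- empty.
  NowhereDense : Pred Carrier ℓ → Set (lsuc 0ℓ ⊔ o ⊔ ℓ)
  NowhereDense A = ∀ V → Open V → V ⊆ closure A → Empty V

  Meager : Pred Carrier ℓ → Set (lsuc 0ℓ ⊔ o ⊔ lsuc ℓ)
  Meager {ℓ} A = Σ[ N ∈ (ℕ → Pred Carrier ℓ) ]
    (∀ n → NowhereDense (N n)) × (A ≐ ⋃ ℕ N)

module _ {X Y : Setoid 0ℓ 0ℓ} (σ : Topology o₁ X) (τ : Topology o₂ Y) where
  private
    module X = Setoid X
    module Y = Setoid Y
    module σ = Topology σ
    module τ = Topology τ

  Continuous : (X.Carrier → Y.Carrier) → Set (lsuc 0ℓ ⊔ o₁ ⊔ o₂)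
  Continuous f = ∀ V → τ.Open V → σ.Open (f ⊢ V)

  ×-topology : Topology (lsuc 0ℓ ⊔ o₁ ⊔ o₂) (×-setoid X Y)
  ×-topology = record
    { Open            = ×-Open
    ; Open⇒respects-≈ = λ oV (x≈x′ , y≈y′) xy∈V →
        let _ , _ , oA , oB , x∈A , y∈B , A×B⊆V = oV xy∈V in
        A×B⊆V (σ.Open⇒respects-≈ oA x≈x′ x∈A) (τ.Open⇒respects-≈ oB y≈y′ y∈B)
    ; Open-resp-≐     = λ (V⊆W , W⊆V) oV xy∈W →
        let A , B , oA , oB , x∈A , y∈B , A×B⊆V = oV (W⊆V xy∈W) in
        A , B , oA , oB , x∈A , y∈B , λ a b → V⊆W (A×B⊆V a b)
    ; Open-U          = λ _ → U , U , σ.Open-U , τ.Open-U , tt , tt , λ _ _ → tt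
    ; Open-∩          = λ oV oW (xy∈V , xy∈W) →
        let A , B , oA , oB , x∈A , y∈B , A×B⊆V = oV xy∈V
            C , D , oC , oD , x∈C , y∈D , C×D⊆W = oW xy∈W
        in A ∩ C , B ∩ D , σ.Open-∩ oA oC , τ.Open-∩ oB oD
         , (x∈A , x∈C) , (y∈B , y∈D)
         , λ (a , c) (b , d) → A×B⊆V a b , C×D⊆W c d
    ; Open-⋃          = λ I V oV (i , xy∈Vᵢ) →
        let A , B , oA , oB , x∈A , y∈B , A×B⊆V = oV i xy∈Vᵢ in
        A , B , oA , oB , x∈A , y∈B , λ a b → i , A×B⊆V a b
    }
    where
    ×-Open : Pred (X.Carrier × Y.Carrier) 0ℓ → Set (lsuc 0ℓ ⊔ o₁ ⊔ o₂)
    ×-Open V = ∀ {x y} → (x , y) ∈ V →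
      Σ[ A ∈ Pred X.Carrier 0ℓ ] Σ[ B ∈ Pred Y.Carrier 0ℓ ]
        σ.Open A × τ.Open B × x ∈ A × y ∈ B ×
        (∀ {x′ y′} → x′ ∈ A → y′ ∈ B → (x′ , y′) ∈ V)

-- Points of the subspace carry a membership proof, which the equality ignores.

subsetoid : (X : Setoid 0ℓ 0ℓ) → Pred (Setoid.Carrier X) 0ℓ → Setoid 0ℓ 0ℓ
subsetoid X S = record
  { Carrier       = ∃ S
  ; _≈_           = λ x y → proj₁ x ≈ proj₁ y
  ; isEquivalence = record { refl = X.refl ; sym = X.sym ; trans = X.trans }
  }
  where
  module X = Setoid X
  open X using (_≈_)

subspace : {X : Setoid 0ℓ 0ℓ} → Topology o X → (S : Pred (Setoid.Carrier X) 0ℓ) →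
           Topology (lsuc 0ℓ ⊔ o) (subsetoid X S)
subspace {X = X} τ S = record
  { Open            = λ V → Σ[ W ∈ Pred Carrier 0ℓ ] Open W × (V ≐ proj₁ ⊢ W)
  ; Open⇒respects-≈ = λ (_ , oW , V⊆W , W⊆V) x≈y x∈V →
      W⊆V (Open⇒respects-≈ oW x≈y (V⊆W x∈V))
  ; Open-resp-≐     = λ (V⊆V′ , V′⊆V) (W , oW , V⊆W , W⊆V) →
      W , oW , (λ x∈V′ → V⊆W (V′⊆V x∈V′)) , (λ x∈W → V⊆V′ (W⊆V x∈W))
  ; Open-U          = U , Open-U , (λ _ → tt) , (λ _ → tt)
  ; Open-∩          = λ (W , oW , V⊆W , W⊆V) (W′ , oW′ , V′⊆W′ , W′⊆V′) →
      W ∩ W′ , Open-∩ oW oW′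
      , (λ (x∈V , x∈V′) → V⊆W x∈V , V′⊆W′ x∈V′)
      , (λ (x∈W , x∈W′) → W⊆V x∈W , W′⊆V′ x∈W′)
  ; Open-⋃          = λ I V h →
      ⋃ I (λ i → proj₁ (h i)) , Open-⋃ I _ (λ i → proj₁ (proj₂ (h i)))
      , (λ (i , x∈V) → i , proj₁ (proj₂ (proj₂ (h i))) x∈V)
      , (λ (i , x∈W) → i , proj₂ (proj₂ (proj₂ (h i))) x∈W)
  }
  where
  open Setoid X using (Carrier)
  open Topology τ

record TopologicalGroup (o : Level) : Set (lsuc (lsuc 0ℓ ⊔ o)) where
  field
    group    : Group 0ℓ 0ℓ
    topology : Topology o (Group.setoid group)
  open Group group public
  field
    ∙-continuous  : Continuous (×-topology topology topology) topology (uncurry _∙_)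
    ⁻¹-continuous : Continuous topology topology _⁻¹

  topology² : Topology (lsuc 0ℓ ⊔ o) (×-setoid setoid setoid)
  topology² = ×-topology topology topology

module _ (K : TopologicalGroup o) where
  open TopologicalGroup K using (Carrier; _≈_; _∙_; ε; _⁻¹)

  data ⟨_,_⟩ (g₁ g₂ : Carrier) : Pred Carrier 0ℓ where
    gen₁   : g₁ ∈ ⟨ g₁ , g₂ ⟩
    gen₂   : g₂ ∈ ⟨ g₁ , g₂ ⟩
    ε-mem  : ε ∈ ⟨ g₁ , g₂ ⟩
    ∙-mem  : ∀ {x y} → x ∈ ⟨ g₁ , g₂ ⟩ → y ∈ ⟨ g₁ , g₂ ⟩ → x ∙ y ∈ ⟨ g₁ , g₂ ⟩
    ⁻¹-mem : ∀ {x} → x ∈ ⟨ g₁ , g₂ ⟩ → x ⁻¹ ∈ ⟨ g₁ , g₂ ⟩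
    ≈-mem  : ∀ {x y} → x ≈ y → x ∈ ⟨ g₁ , g₂ ⟩ → y ∈ ⟨ g₁ , g₂ ⟩

module _ (K : TopologicalGroup o) where
  private
    module K = TopologicalGroup K

  generated : K.Carrier × K.Carrier → Group 0ℓ 0ℓ
  generated (g₁ , g₂) = record
    { Carrier = ∃ (⟨_,_⟩ K g₁ g₂)
    ; _≈_     = λ x y → proj₁ x K.≈ proj₁ y
    ; _∙_     = λ (x , x∈) (y , y∈) → x K.∙ y , ∙-mem x∈ y∈
    ; ε       = K.ε , ε-mem
    ; _⁻¹     = λ (x , x∈) → x K.⁻¹ , ⁻¹-mem x∈
    ; isGroup = record
      { isMonoid = record
        { isSemigroup = record
          { isMagma = record
            { isEquivalence = record { refl = K.refl ; sym = K.sym ; trans = K.trans }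
            ; ∙-cong        = K.∙-cong
            }
          ; assoc = λ (x , _) (y , _) (z , _) → K.assoc x y z
          }
        ; identity = (λ (x , _) → K.identityˡ x) , (λ (x , _) → K.identityʳ x)
        }
      ; inverse = (λ (x , _) → K.inverseˡ x) , (λ (x , _) → K.inverseʳ x)
      ; ⁻¹-cong = K.⁻¹-cong
      }
    }

  generated-topology : (g : K.Carrier × K.Carrier) →
                       Topology (lsuc 0ℓ ⊔ o) (Group.setoid (generated g))
  generated-topology (g₁ , g₂) = subspace K.topology (⟨_,_⟩ K g₁ g₂)

  -- Read: g is topologically similar to f; φ sends gᵢ to fᵢ.
  record TopologicallySimilar (g f : K.Carrier × K.Carrier) : Set (lsuc 0ℓ ⊔ o) where
    private
      module ⟨g⟩ = Group (generated g)
      module ⟨f⟩ = Group (generated f)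
    open GroupMorphisms ⟨g⟩.rawGroup ⟨f⟩.rawGroup using (IsGroupIsomorphism)
    field
      φ                  : ⟨g⟩.Carrier → ⟨f⟩.Carrier
      isGroupIsomorphism : IsGroupIsomorphism φ
      φ-gen₁             : φ (proj₁ g , gen₁) ⟨f⟩.≈ (proj₁ f , gen₁)
      φ-gen₂             : φ (proj₂ g , gen₂) ⟨f⟩.≈ (proj₂ f , gen₂)
      φ-continuous       : Continuous (generated-topology g) (generated-topology f) φ
      φ⁻¹                : ⟨f⟩.Carrier → ⟨g⟩.Carrier
      inverse            : Inverseᵇ ⟨g⟩._≈_ ⟨f⟩._≈_ φ φ⁻¹
      φ⁻¹-continuous     : Continuous (generated-topology f) (generated-topology g) φ⁻¹

  SimilarityClass : K.Carrier × K.Carrier → Pred (K.Carrier × K.Carrier) (lsuc 0ℓ ⊔ o)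
  SimilarityClass f g = TopologicallySimilar g f

record OrderedMetricSpace : Set₁ where
  infix 4 _<_
  field
    Carrier            : Set
    d                  : Carrier → Carrier → ℚ
    _<_                : Rel Carrier 0ℓ
    isMetric           : IsMetric _≡_ d
    isStrictTotalOrder : IsStrictTotalOrder _≡_ _<_

record Embedding (A M : OrderedMetricSpace) : Set where
  private
    module A = OrderedMetricSpace A
    module M = OrderedMetricSpace M
  field
    to        : A.Carrier → M.Carrier
    isometric : ∀ x y → M.d (to x) (to y) ≡ A.d x y
    monotone  : ∀ {x y} → x A.< y → to x M.< to y

record Automorphism (M : OrderedMetricSpace) : Set where
  open OrderedMetricSpace M
  field
    bijection : Carrier ↔ Carrier
  open Inverse bijection public using (to; from)
  field
    isometric : ∀ x y → d (to x) (to y) ≡ d x y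
    monotone  : ∀ {x y} → x < y → to x < to y

Countable : OrderedMetricSpace → Set
Countable M = OrderedMetricSpace.Carrier M ↣ ℕ

Finite : OrderedMetricSpace → Set
Finite A = ∃[ n ] OrderedMetricSpace.Carrier A ↔ Fin n

record IsRandomlyOrderedRationalUrysohn (M : OrderedMetricSpace) : Set₁ where
  open OrderedMetricSpace M
  field
    countable   : Countable M
    universal   : (A : OrderedMetricSpace) → Finite A → Embedding A M
    -- A map between finite subsets is given as aᵢ ↦ bᵢ. Repetitions in the
    -- enumeration are harmless: isometry makes the map well defined and
    -- injective.
    homogeneous : ∀ n (a b : Fin n → Carrier) →
                  (∀ i j → d (b i) (b j) ≡ d (a i) (a j)) →
                  (∀ i j → a i < a j → b i < b j) →
                  Σ[ g ∈ Automorphism M ] (∀ i → Automorphism.to g (a i) ≡ b i)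

module _ (M : OrderedMetricSpace) where
  open OrderedMetricSpace M
  open Automorphism

  private
    module O = IsStrictTotalOrder isStrictTotalOrder

    to-from : ∀ (g : Automorphism M) x → to g (from g x) ≡ x
    to-from g x = Inverse.strictlyInverseˡ (bijection g) x

    from-to : ∀ (g : Automorphism M) x → from g (to g x) ≡ x
    from-to g x = Inverse.strictlyInverseʳ (bijection g) x

    infixl 7 _∙_
    infix  8 _⁻¹
    infix  4 _≈_

    _∙_ : Automorphism M → Automorphism M → Automorphism M
    g ∙ h = record
      { bijection = bijection g ↔-∘ bijection h
      ; isometric = λ x y → trans (isometric g (to h x) (to h y)) (isometric h x y)
      ; monotone  = λ x<y → monotone g (monotone h x<y)
      }

    ε : Automorphism M
    ε = record
      { bijection = ↔-id Carrier
      ; isometric = λ _ _ → refl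
      ; monotone  = λ x<y → x<y
      }

    from-monotone : ∀ (g : Automorphism M) {x y} → x < y → from g x < from g y
    from-monotone g {x} {y} x<y with O.compare (from g x) (from g y)
    ... | tri< p _ _ = p
    ... | tri≈ _ p _ = contradiction x<y
          (O.irrefl (trans (sym (to-from g x)) (trans (cong (to g) p) (to-from g y))))
    ... | tri> _ _ p = contradiction
          (subst₂ _<_ (to-from g y) (to-from g x) (monotone g p)) (O.asym x<y)

    _⁻¹ : Automorphism M → Automorphism M
    g ⁻¹ = record
      { bijection = ↔-sym (bijection g)
      ; isometric = λ x y → trans (sym (isometric g (from g x) (from g y)))
                                  (cong₂ d (to-from g x) (to-from g y))
      ; monotone  = from-monotone g
      }

    _≈_ : Rel (Automorphism M) 0ℓ
    g ≈ h = ∀ x → to g x ≡ to h x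

    from-unique : ∀ (g : Automorphism M) {x y} → to g x ≡ y → from g y ≡ x
    from-unique g {x} gx≡y = trans (cong (from g) (sym gx≡y)) (from-to g x)

  Aut-group : Group 0ℓ 0ℓ
  Aut-group = record
    { Carrier = Automorphism M
    ; _≈_     = _≈_
    ; _∙_     = _∙_
    ; ε       = ε
    ; _⁻¹     = _⁻¹
    ; isGroup = record
      { isMonoid = record
        { isSemigroup = record
          { isMagma = record
            { isEquivalence = record
              { refl  = λ _ → refl
              ; sym   = λ g≈h x → sym (g≈h x)
              ; trans = λ g≈h h≈k x → trans (g≈h x) (h≈k x)
              }
            ; ∙-cong = λ {g} {g′} {h} {h′} g≈g′ h≈h′ x →
                trans (cong (to g) (h≈h′ x)) (g≈g′ (to h′ x))
            }
          ; assoc = λ _ _ _ _ → refl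
          }
        ; identity = (λ _ _ → refl) , (λ _ _ → refl)
        }
      ; inverse = from-to , to-from
      ; ⁻¹-cong = λ {g} {h} g≈h x →
          from-unique g (trans (g≈h (from h x)) (to-from h x))
      }
    }

  AgreeOn : List Carrier → Rel (Automorphism M) 0ℓ
  AgreeOn F g h = ∀ x → x ∈ₗ F → to h x ≡ to g x

  private
    cylinder-open : ∀ F g {h} → AgreeOn F g h →
                    ∃[ F′ ] (∀ k → AgreeOn F′ h k → AgreeOn F g k)
    cylinder-open F g g~h = F , λ k h~k x x∈F → trans (h~k x x∈F) (g~h x x∈F)

  pointwise-topology : Topology 0ℓ (Group.setoid Aut-group)
  pointwise-topology = record
    { Open            = λ V → ∀ {g} → g ∈ V → ∃[ F ] (∀ h → AgreeOn F g h → h ∈ V)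
    ; Open⇒respects-≈ = λ oV {g} {h} g≈h g∈V →
        proj₂ (oV g∈V) h (λ x _ → sym (g≈h x))
    ; Open-resp-≐     = λ (V⊆W , W⊆V) oV g∈W →
        let F , F⊆V = oV (W⊆V g∈W) in F , λ h g~h → V⊆W (F⊆V h g~h)
    ; Open-U          = λ _ → [] , λ _ _ → tt
    ; Open-∩          = λ oV oW (g∈V , g∈W) →
        let F , F⊆V = oV g∈V
            G , G⊆W = oW g∈W
        in F ++ G , λ h g~h → F⊆V h (λ x x∈F → g~h x (∈-++⁺ˡ x∈F))
                            , G⊆W h (λ x x∈G → g~h x (∈-++⁺ʳ F x∈G))
    ; Open-⋃          = λ I V oV (i , g∈Vᵢ) →
        let F , F⊆V = oV i g∈Vᵢ in F , λ h g~h → i , F⊆V h g~h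
    }

  Aut : TopologicalGroup 0ℓ
  Aut = record
    { group         = Aut-group
    ; topology      = pointwise-topology
    ; ∙-continuous  = λ V oV {g} {h} gh∈V →
        let F , F⊆V = oV gh∈V in
        AgreeOn (map (to h) F) g , AgreeOn F h
        , (λ {k} → cylinder-open (map (to h) F) g {k})
        , (λ {k} → cylinder-open F h {k})
        , (λ _ _ → refl) , (λ _ _ → refl)
        , λ {g′} {h′} g~g′ h~h′ → F⊆V (g′ ∙ h′) λ x x∈F →
            trans (cong (to g′) (h~h′ x x∈F)) (g~g′ (to h x) (∈-map⁺ (to h) x∈F))
    ; ⁻¹-continuous = λ V oV {g} g⁻¹∈V →
        let F , F⊆V = oV g⁻¹∈V in
        map (from g) F , λ h g~h → F⊆V (h ⁻¹) λ x x∈F →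
          from-unique h (trans (g~h (from g x) (∈-map⁺ (from g) x∈F)) (to-from g x))
    }

-- Write p and q for the two members of a pair. The proof uses words r⁻¹ q r
-- in which r = r₀ v q^m₁ p^m₂ (letters applied from left to right), where v is
-- positive and m₁, m₂ ≥ |r₀| + k.
--
-- (a) For a generic pair, any finite set F and any k, some such word fixes F
-- pointwise. (b) For any sequence of such words with k → ∞, the pairs along
-- which it converges to the identity form a meager set. Convergence is
-- invariant under topological similarity, so a class either avoids the generic
-- pairs of (a) or is contained in one of the meager sets of (b).
--
-- For (b), suppose x is moved by p or q. An order automorphism has no finite
-- orbit other than fixed points, so the long blocks drive the path of x along r
-- out of any prescribed finite set; from there the remaining positive letters
-- can be extended freely, and q can be made to move the endpoint.
--
-- For (a), partial automorphisms are extended freely: distances as large and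
-- images as high as possible. Let C be the set of common fixed points (made
-- nonempty first). A reduced word lifts the lowest point of every gap of C above
-- everything prescribed in the gap; a power of p followed by q then carries all
-- of F above everything used so far. These words make up r₀. Long alternating
-- blocks of q and p, which form v q^m₁ p^m₂, raise the distance from each image
-- y of a point of F to each prescribed point u to the minimum of d(y,c) + d(c,u)
-- over c in C, since a shorter path would change between fixed points of p and
-- of q in every block. Now neither the distances nor the order between y and the
-- prescribed points change when q is applied to the latter, so q may fix y.
module Submission where

open import Algebra.Bundles using (Group)
open import Algebra.Morphism.Structures using (module GroupMorphisms)
open import Axiom.ExcludedMiddle using (ExcludedMiddle)
open import Data.Bool.Base using (Bool; true; false; not)
import Data.Bool.Properties as Boolₚ
open import Data.Empty using (⊥; ⊥-elim)
open import Data.Fin.Base using (Fin; zero; suc; toℕ)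
import Data.Fin.Properties as Finₚ
import Data.Integer.Base as ℤ
import Data.Integer.Properties as ℤₚ
open import Data.List.Base
  using (List; []; _∷_; [_]; _++_; map; length; lookup; filter; deduplicate; replicate; concatMap)
open import Data.List.Membership.Propositional using (_∈_; _∉_; find; lose)
open import Data.List.Membership.Propositional.Properties
  using (∈-++⁺ˡ; ∈-++⁺ʳ; ∈-++⁻; ∈-map⁺; ∈-map⁻; ∈-filter⁺; ∈-filter⁻; ∈-concatMap⁺; ∈-concatMap⁻;
         ∈-length; ∈-lookup; ∈-deduplicate⁺; ∈-deduplicate⁻)
import Data.List.Properties as Listₚ
open import Data.List.Relation.Binary.Subset.Propositional using (_⊆_)
import Data.List.Relation.Unary.All as All
open import Data.List.Relation.Unary.AllPairs using (_∷_)
open import Data.List.Relation.Unary.Any using (here; there; index)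
open import Data.List.Relation.Unary.Any.Properties using (lookup-index)
open import Data.List.Relation.Unary.Unique.DecPropositional.Properties using (deduplicate-!)
open import Data.List.Relation.Unary.Unique.Propositional using (Unique)
open import Data.Nat.Base as ℕ using (ℕ; zero; suc; _+_; _*_; _∸_; _≤_; z≤n; s≤s)
import Data.Nat.Properties as ℕₚ
open import Data.Product.Base using (Σ-syntax; ∃; ∃-syntax; _×_; _,_; proj₁; proj₂)
open import Data.Rational.Base as ℚ
  using (ℚ; 0ℚ; 1ℚ; toℚᵘ) renaming (_+_ to _⊕_; _≤_ to _≤ℚ_; _<_ to _<ℚ_)
import Data.Rational.Properties as ℚₚ
import Data.Rational.Unnormalised.Base as ℚᵘ
import Data.Rational.Unnormalised.Properties as ℚᵘₚ
open import Data.Sum.Base using (_⊎_; inj₁; inj₂)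
open import Function.Base using (id)
open import Function.Bundles using (Inverse; Injection)
open import Function.Construct.Identity using (↔-id)
open import Function.Metric.Rational.Structures using (IsMetric)
open import Level using (0ℓ)
open import Relation.Binary.Definitions using (Tri; tri<; tri≈; tri>)
open import Relation.Binary.PropositionalEquality hiding ([_])
open import Relation.Binary.Structures using (IsStrictTotalOrder)
open import Relation.Nullary using (¬_; yes; no; contradiction)
open import Defs

-- A conjugate of q fixes F once q fixes each image y in r(F), and an extension of q may do so if y
-- is equally far from x and q x, and on the same side of both, for every prescribed x. The obstacle
-- is C: every word fixes it, so y keeps its distances to C and its gap. But q fixes C as well and
-- respects this data, and the aim is to make it the only restriction on y. The order comes first,
-- because a point is lifted past M only by a letter that no prescribed value pulls back below M;
-- finding one may require inverse letters, and this is why r₀ is not positive. In (b) inverse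
-- letters do harm: that a point is new to the domains does not leave its preimages free. So the
-- whole path along r₀, |r₀| + 1 points, is conceded there, and the long blocks must outlast it
-- together with the given finite set; hence the bound |r₀| + k.

lookup-injective : ∀ {A : Set} {xs : List A} → Unique xs → ∀ i j → lookup xs i ≡ lookup xs j → i ≡ j
lookup-injective (x∉ ∷ u) zero    zero    eq = refl
lookup-injective (x∉ ∷ u) zero    (suc j) eq = contradiction eq (All.lookup x∉ (∈-lookup j))
lookup-injective (x∉ ∷ u) (suc i) zero    eq = contradiction (sym eq) (All.lookup x∉ (∈-lookup i))
lookup-injective (x∉ ∷ u) (suc i) (suc j) eq = cong suc (lookup-injective u i j eq)

argmin : ∀ {A : Set} (φ : A → ℚ) {z₀ : A} (zs : List A) → z₀ ∈ zs →
         ∃[ z ] z ∈ zs × (∀ {z′} → z′ ∈ zs → φ z ≤ℚ φ z′)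
argmin φ (z ∷ [])      _ = z , here refl , λ { (here refl) → ℚₚ.≤-refl }
argmin φ (z ∷ z′ ∷ zs) _ with argmin φ (z′ ∷ zs) (here refl)
... | m , m∈ , min with ℚₚ.≤-total (φ z) (φ m)
...   | inj₁ z≤m = z , here refl , λ { (here refl) → ℚₚ.≤-refl ; (there p) → ℚₚ.≤-trans z≤m (min p) }
...   | inj₂ m≤z = m , there m∈ , λ { (here refl) → m≤z ; (there p) → min p }

-- Multiples of rationals and the Archimedean property

p≤p⊕q : ∀ {p q} → 0ℚ ≤ℚ q → p ≤ℚ p ⊕ q
p≤p⊕q {p} {q} 0≤q = subst (_≤ℚ p ⊕ q) (ℚₚ.+-identityʳ p) (ℚₚ.+-monoʳ-≤ p 0≤q)

p≤q⊕p : ∀ {p q} → 0ℚ ≤ℚ q → p ≤ℚ q ⊕ p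
p≤q⊕p {p} {q} 0≤q = subst (_≤ℚ q ⊕ p) (ℚₚ.+-identityˡ p) (ℚₚ.+-monoˡ-≤ p 0≤q)

infixr 7 _⊛_
_⊛_ : ℕ → ℚ → ℚ
zero  ⊛ δ = 0ℚ
suc n ⊛ δ = δ ⊕ n ⊛ δ

⊛-mono : ∀ {m n δ} → 0ℚ ≤ℚ δ → m ≤ n → m ⊛ δ ≤ℚ n ⊛ δ
⊛-mono {n = zero}  0≤δ z≤n       = ℚₚ.≤-refl
⊛-mono {n = suc n} 0≤δ z≤n       = ℚₚ.≤-trans 0≤δ (p≤p⊕q (⊛-mono {n = n} 0≤δ z≤n))
⊛-mono {δ = δ}     0≤δ (s≤s m≤n) = ℚₚ.+-monoʳ-≤ δ (⊛-mono 0≤δ m≤n)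

-- Unnormalised fractions give the multiple a closed form in which no gcd is taken, so `archimedean`
-- becomes an inequality of integers.
toℚᵘ-⊛ : ∀ n δ → toℚᵘ (n ⊛ δ) ℚᵘ.≃ ℚᵘ.mkℚᵘ (ℤ.+ n ℤ.* ℚ.↥ δ) (ℚ.ℚ.denominator-1 δ)
toℚᵘ-⊛ zero    δ@record{} = ℚᵘ.*≡* (cong (ℤ._* ℚ.↧ δ) (sym (ℤₚ.*-zeroˡ (ℚ.↥ δ))))
toℚᵘ-⊛ (suc n) δ@record{} = ℚᵘₚ.≃-trans (ℚₚ.toℚᵘ-homo-+ δ (n ⊛ δ))
  (ℚᵘₚ.≃-trans (ℚᵘₚ.+-congʳ (toℚᵘ δ) (toℚᵘ-⊛ n δ)) (ℚᵘ.*≡* eq))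
  where
  open ≡-Reasoning
  a b : ℤ.ℤ
  a = ℚ.↥ δ
  b = ℚ.↧ δ
  eq : (a ℤ.* b ℤ.+ (ℤ.+ n ℤ.* a) ℤ.* b) ℤ.* b ≡ (ℤ.+ suc n ℤ.* a) ℤ.* (b ℤ.* b)
  eq = begin
    (a ℤ.* b ℤ.+ (ℤ.+ n ℤ.* a) ℤ.* b) ℤ.* b ≡⟨ cong (ℤ._* b) (ℤₚ.*-distribʳ-+ b a (ℤ.+ n ℤ.* a)) ⟨
    (a ℤ.+ ℤ.+ n ℤ.* a) ℤ.* b ℤ.* b         ≡⟨ cong (λ x → x ℤ.* b ℤ.* b) (ℤₚ.suc-* (ℤ.+ n) a) ⟨
    (ℤ.+ suc n ℤ.* a) ℤ.* b ℤ.* b           ≡⟨ ℤₚ.*-assoc (ℤ.+ suc n ℤ.* a) b b ⟩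
    (ℤ.+ suc n ℤ.* a) ℤ.* (b ℤ.* b)         ∎

positive-numerator : ∀ p → ℚ.Positive p → ∃[ a ] ℚ.↥ p ≡ ℤ.+[1+ a ]
positive-numerator (ℚ.mkℚ ℤ.+[1+ a ] _ _) _ = a , refl
positive-numerator (ℚ.mkℚ ℤ.+0 _ _) ()
positive-numerator (ℚ.mkℚ ℤ.-[1+ _ ] _ _) ()

opaque
  archimedean : ∀ K δ → 0ℚ <ℚ δ → ∃[ n ] K ≤ℚ n ⊛ δ
  archimedean K@record{} δ@record{} 0<δ = n , ℚₚ.toℚᵘ-cancel-≤
    (ℚᵘₚ.≤-trans (ℚᵘ.*≤* bound) (ℚᵘₚ.≤-reflexive (ℚᵘₚ.≃-sym (toℚᵘ-⊛ n δ))))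
    where
    open ℤₚ.≤-Reasoning
    n : ℕ
    -- The denominator of `δ` cancels: `n ⊛ δ` is the integer |↥ K| · ↥ δ, and ↥ δ is at least 1.
    n = ℤ.∣ ℚ.↥ K ∣ * ℚ.↧ₙ δ
    num : ∃[ a ] ℚ.↥ δ ≡ ℤ.+[1+ a ]
    num = positive-numerator δ (ℚ.positive 0<δ)
    1≤∣δ∣ : 1 ≤ ℤ.∣ ℚ.↥ δ ∣
    1≤∣δ∣ = subst (λ i → 1 ≤ ℤ.∣ i ∣) (sym (proj₂ num)) (s≤s z≤n)
    ∣δ∣ : ℤ.+ ℤ.∣ ℚ.↥ δ ∣ ≡ ℚ.↥ δ
    ∣δ∣ = subst (λ i → ℤ.+ ℤ.∣ i ∣ ≡ i) (sym (proj₂ num)) refl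
    i≤∣i∣ : ∀ i → i ℤ.≤ ℤ.+ ℤ.∣ i ∣
    i≤∣i∣ (ℤ.+ _)      = ℤₚ.≤-refl
    i≤∣i∣ (ℤ.-[1+ _ ]) = ℤ.-≤+
    nat : n ≤ n * ℤ.∣ ℚ.↥ δ ∣ * ℚ.↧ₙ K
    nat = ℕₚ.≤-trans (ℕₚ.≤-reflexive (sym (trans (ℕₚ.*-identityʳ _) (ℕₚ.*-identityʳ n))))
            (ℕₚ.*-mono-≤ (ℕₚ.*-monoʳ-≤ n 1≤∣δ∣) (s≤s z≤n))
    bound : ℚ.↥ K ℤ.* ℚ.↧ δ ℤ.≤ (ℤ.+ n ℤ.* ℚ.↥ δ) ℤ.* ℚ.↧ K
    bound = begin
      ℚ.↥ K ℤ.* ℚ.↧ δ                             ≤⟨ ℤₚ.*-monoʳ-≤-nonNeg (ℚ.↧ δ) (i≤∣i∣ (ℚ.↥ K)) ⟩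
      ℤ.+ ℤ.∣ ℚ.↥ K ∣ ℤ.* ℚ.↧ δ                   ≡⟨ ℤₚ.pos-* ℤ.∣ ℚ.↥ K ∣ (ℚ.↧ₙ δ) ⟨
      ℤ.+ n                                       ≤⟨ ℤ.+≤+ nat ⟩
      ℤ.+ (n * ℤ.∣ ℚ.↥ δ ∣ * ℚ.↧ₙ K)              ≡⟨ ℤₚ.pos-* (n * ℤ.∣ ℚ.↥ δ ∣) (ℚ.↧ₙ K) ⟩
      ℤ.+ (n * ℤ.∣ ℚ.↥ δ ∣) ℤ.* ℚ.↧ K             ≡⟨ cong (ℤ._* ℚ.↧ K) (ℤₚ.pos-* n ℤ.∣ ℚ.↥ δ ∣) ⟩
      (ℤ.+ n ℤ.* ℤ.+ ℤ.∣ ℚ.↥ δ ∣) ℤ.* ℚ.↧ K       ≡⟨ cong (λ x → (ℤ.+ n ℤ.* x) ℤ.* ℚ.↧ K) ∣δ∣ ⟩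
      (ℤ.+ n ℤ.* ℚ.↥ δ) ℤ.* ℚ.↧ K                 ∎

opaque
  upperBound : ∀ {A B : Set} (φ : A → B → ℚ) xs ys →
               ∃[ K ] 0ℚ <ℚ K × (∀ {x y} → x ∈ xs → y ∈ ys → φ x y ≤ℚ K)
  upperBound φ []       ys = 1ℚ , ℚₚ.positive⁻¹ 1ℚ , λ ()
  upperBound {B = B} φ (x ∷ xs) ys =
    let K , 0<K , bd = upperBound φ xs ys ; K′ , bd′ = row ys in
    K ℚ.⊔ K′ , ℚₚ.<-≤-trans 0<K (ℚₚ.p≤p⊔q K K′) ,
    λ { (here refl) y∈ → ℚₚ.≤-trans (bd′ y∈) (ℚₚ.p≤q⊔p K K′)
      ; (there x∈)  y∈ → ℚₚ.≤-trans (bd x∈ y∈) (ℚₚ.p≤p⊔q K K′) }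
    where
    row : ∀ ys → ∃[ K ] (∀ {y} → y ∈ ys → φ x y ≤ℚ K)
    row []       = 0ℚ , λ ()
    row (y ∷ ys) = let K , bd = row ys in φ x y ℚ.⊔ K ,
      λ { (here refl) → ℚₚ.p≤p⊔q (φ x y) K ; (there y∈) → ℚₚ.≤-trans (bd y∈) (ℚₚ.p≤q⊔p (φ x y) K) }

-- The generators are p = true and q = false; the second component is false
-- for the inverse.
Letter : Set
Letter = Bool × Bool

Word : Set
Word = List Letter

pos : List Bool → Word
pos = map (_, true)

inv : Letter → Letter
inv (b , s) = b , not s

module Urysohn (em : ∀ {ℓ} → ExcludedMiddle ℓ) (QU : OrderedMetricSpace)
               (isU : IsRandomlyOrderedRationalUrysohn QU) where

  -- The order, the metric and automorphisms

  open IsRandomlyOrderedRationalUrysohn isU using (countable; universal; homogeneous)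

  open OrderedMetricSpace QU
  open Group (Aut-group QU) using (_∙_; ε; _⁻¹)
  module O = IsStrictTotalOrder isStrictTotalOrder
  module M = IsMetric isMetric

  to from : Automorphism QU → Carrier → Carrier
  to   g = Automorphism.to g
  from g = Automorphism.from g

  infix 4 _≼_
  _≼_ : Carrier → Carrier → Set
  x ≼ y = x < y ⊎ x ≡ y

  ≼-refl : ∀ {x} → x ≼ x
  ≼-refl = inj₂ refl

  <-≼-trans : ∀ {x y z} → x < y → y ≼ z → x < z
  <-≼-trans x<y (inj₁ y<z)  = O.trans x<y y<z
  <-≼-trans x<y (inj₂ refl) = x<y

  ≼-<-trans : ∀ {x y z} → x ≼ y → y < z → x < z
  ≼-<-trans (inj₁ x<y)  y<z = O.trans x<y y<z
  ≼-<-trans (inj₂ refl) y<z = y<z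

  ≼-trans : ∀ {x y z} → x ≼ y → y ≼ z → x ≼ z
  ≼-trans (inj₁ x<y)  y≼z = inj₁ (<-≼-trans x<y y≼z)
  ≼-trans (inj₂ refl) y≼z = y≼z

  <⇒⋡ : ∀ {x y} → x < y → ¬ y ≼ x
  <⇒⋡ x<y y≼x = O.irrefl refl (<-≼-trans x<y y≼x)

  ≼-antisym : ∀ {x y} → x ≼ y → y ≼ x → x ≡ y
  ≼-antisym (inj₁ x<y)  y≼x = contradiction y≼x (<⇒⋡ x<y)
  ≼-antisym (inj₂ x≡y) _   = x≡y

  _≼⊎≻_ : ∀ x y → x ≼ y ⊎ y < x
  x ≼⊎≻ y with O.compare x y
  ... | tri< x<y _ _ = inj₁ (inj₁ x<y)
  ... | tri≈ _ x≡y _ = inj₁ (inj₂ x≡y)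
  ... | tri> _ _ y<x = inj₂ y<x

  ⋠⇒> : ∀ {x y} → ¬ x ≼ y → y < x
  ⋠⇒> {x} {y} x⋠y with x ≼⊎≻ y
  ... | inj₁ x≼y = contradiction x≼y x⋠y
  ... | inj₂ y<x = y<x

  dxx≡0 : ∀ {x} → d x x ≡ 0ℚ
  dxx≡0 = M.≈⇒0 refl

  d≤0⇒≡ : ∀ {x y} → d x y ≤ℚ 0ℚ → x ≡ y
  d≤0⇒≡ d≤0 = M.0⇒≈ (ℚₚ.≤-antisym d≤0 M.nonNegative)

  d>0 : ∀ {x y} → x ≢ y → 0ℚ <ℚ d x y
  d>0 {x} {y} x≢y with 0ℚ ℚₚ.<? d x y
  ... | yes p = p
  ... | no ¬p = contradiction (d≤0⇒≡ (ℚₚ.≮⇒≥ ¬p)) x≢y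

  to-from : ∀ g x → to g (from g x) ≡ x
  to-from g x = Inverse.strictlyInverseˡ (Automorphism.bijection g) x

  from-to : ∀ g x → from g (to g x) ≡ x
  from-to g x = Inverse.strictlyInverseʳ (Automorphism.bijection g) x

  to-injective : ∀ g {x y} → to g x ≡ to g y → x ≡ y
  to-injective g {x} {y} eq = trans (sym (from-to g x)) (trans (cong (from g) eq) (from-to g y))

  to-isometric : ∀ g x y → d (to g x) (to g y) ≡ d x y
  to-isometric = Automorphism.isometric

  to-≼ : ∀ g {x y} → x ≼ y → to g x ≼ to g y
  to-≼ g (inj₁ x<y)  = inj₁ (Automorphism.monotone g x<y)
  to-≼ g (inj₂ refl) = inj₂ refl

  to-< : ∀ g {x y} → x < y → to g x < to g y
  to-< = Automorphism.monotone

  to-≼⁻ : ∀ g {x y} → to g x ≼ to g y → x ≼ y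
  to-≼⁻ g {x} {y} p with x ≼⊎≻ y
  ... | inj₁ q = q
  ... | inj₂ q = contradiction p (<⇒⋡ (to-< g q))

  to-<⁻ : ∀ g {x y} → to g x < to g y → x < y
  to-<⁻ g {x} {y} p with y ≼⊎≻ x
  ... | inj₂ q = q
  ... | inj₁ q = contradiction (to-≼ g q) (<⇒⋡ p)

  Agree : List Carrier → Automorphism QU → Automorphism QU → Set
  Agree = AgreeOn QU

  agree-extend : ∀ {F G} g h k → F ⊆ G → Agree F g h → Agree G h k → Agree F g k
  agree-extend g h k F⊆G g~h h~k x x∈F = trans (h~k x (F⊆G x∈F)) (g~h x x∈F)

  -- Extensions of finite partial automorphisms

  -- Free amalgamation over `Z`, stated by its two extremal bounds. If `y′` has the distances and
  -- the position of `y` relative to `Z`, the triangle inequality and transitivity give the reverse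
  -- bounds, so `y′` is as far from `u` and as high as `Z` permits.
  Far : List Carrier → Carrier → Carrier → Carrier → Set
  Far Z y y′ u = (∃[ z ] z ∈ Z × d y z ⊕ d z u ≤ℚ d y′ u)
               × (y′ ≼ u → ∃[ z ] z ∈ Z × y ≼ z × z ≼ u)

  -- A positive Katetov function `f` and an upper set `B` describe a one-point extension of `W`: the
  -- distances to the new point and the cut in which it lies.
  OnePoint : Set₁
  OnePoint = (W : List Carrier) (f : Carrier → ℚ) (B : Carrier → Set) →
    (∀ {w} → w ∈ W → 0ℚ <ℚ f w) →
    (∀ {w w′} → w ∈ W → w′ ∈ W → f w ≤ℚ f w′ ⊕ d w′ w) →
    (∀ {w w′} → w ∈ W → w′ ∈ W → d w w′ ≤ℚ f w ⊕ f w′) →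
    (∀ {w w′} → B w → w < w′ → B w′) →
    ∃[ y ] (∀ {w} → w ∈ W → d y w ≡ f w × (B w → y < w) × (¬ B w → w < y))

  -- Universality realises the abstract extension somewhere, and homogeneity carries the copy of `W`
  -- in it back onto `W`. Repetitions in `W` are removed first, since distinct indices must be at
  -- positive distance.
  onePoint′ : OnePoint
  onePoint′ W f B f>0 f-lip f-tri B-up =
    to g (E.to zero) , λ {w} w∈W →
      subst (λ w → d (to g (E.to zero)) w ≡ f w × (B w → to g (E.to zero) < w) × (¬ B w → w < to g (E.to zero)))
        (sym (lookup-index (∈-deduplicate⁺ O._≟_ w∈W)))
        (at (index (∈-deduplicate⁺ O._≟_ w∈W)))
    where
    W′ = deduplicate O._≟_ W
    n  = length W′
    L : Fin n → Carrier
    L = lookup W′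
    L∈ : ∀ i → L i ∈ W
    L∈ i = ∈-deduplicate⁻ O._≟_ W (∈-lookup i)
    L-inj : ∀ {i j} → L i ≡ L j → i ≡ j
    L-inj = lookup-injective (deduplicate-! O._≟_ W) _ _

    δ : Fin (suc n) → Fin (suc n) → ℚ
    δ zero    zero    = 0ℚ
    δ zero    (suc j) = f (L j)
    δ (suc i) zero    = f (L i)
    δ (suc i) (suc j) = d (L i) (L j)

    δ-sym : ∀ i j → δ i j ≡ δ j i
    δ-sym zero    zero    = refl
    δ-sym zero    (suc j) = refl
    δ-sym (suc i) zero    = refl
    δ-sym (suc i) (suc j) = M.sym _ _

    δ-nonneg : ∀ {i j} → 0ℚ ≤ℚ δ i j
    δ-nonneg {zero}  {zero}  = ℚₚ.≤-refl
    δ-nonneg {zero}  {suc j} = ℚₚ.<⇒≤ (f>0 (L∈ j))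
    δ-nonneg {suc i} {zero}  = ℚₚ.<⇒≤ (f>0 (L∈ i))
    δ-nonneg {suc i} {suc j} = M.nonNegative

    δ-refl : ∀ {i j} → i ≡ j → δ i j ≡ 0ℚ
    δ-refl {zero}  refl = refl
    δ-refl {suc i} refl = dxx≡0

    δ-0 : ∀ {i j} → δ i j ≡ 0ℚ → i ≡ j
    δ-0 {zero}  {zero}  _  = refl
    δ-0 {zero}  {suc j} eq = contradiction (f>0 (L∈ j)) (ℚₚ.<-irrefl (sym eq))
    δ-0 {suc i} {zero}  eq = contradiction (f>0 (L∈ i)) (ℚₚ.<-irrefl (sym eq))
    δ-0 {suc i} {suc j} eq = cong suc (L-inj (M.0⇒≈ eq))

    δ-tri : ∀ i j k → δ i k ≤ℚ δ i j ⊕ δ j k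
    δ-tri zero    j       zero    = ℚₚ.+-mono-≤ (δ-nonneg {zero} {j}) (δ-nonneg {j} {zero})
    δ-tri zero    zero    (suc k) = p≤q⊕p ℚₚ.≤-refl
    δ-tri zero    (suc j) (suc k) = f-lip (L∈ k) (L∈ j)
    δ-tri (suc i) zero    zero    = p≤p⊕q ℚₚ.≤-refl
    δ-tri (suc i) (suc j) zero    =
      ℚₚ.≤-trans (f-lip (L∈ i) (L∈ j))
        (ℚₚ.≤-reflexive (trans (ℚₚ.+-comm (f (L j)) _) (cong (_⊕ f (L j)) (M.sym _ _))))
    δ-tri (suc i) zero    (suc k) = f-tri (L∈ i) (L∈ k)
    δ-tri (suc i) (suc j) (suc k) = M.triangle _ _ _

    infix 4 _⊏_
    _⊏_ : Fin (suc n) → Fin (suc n) → Set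
    zero  ⊏ zero  = ⊥
    zero  ⊏ suc j = B (L j)
    suc i ⊏ zero  = ¬ B (L i)
    suc i ⊏ suc j = L i < L j

    ⊏-trans : ∀ {i j k} → i ⊏ j → j ⊏ k → i ⊏ k
    ⊏-trans {zero}  {suc j} {zero}  p q = q p
    ⊏-trans {zero}  {suc j} {suc k} p q = B-up p q
    ⊏-trans {suc i} {zero}  {suc k} p q with L k ≼⊎≻ L i
    ... | inj₂ r         = r
    ... | inj₁ (inj₁ r)  = ⊥-elim (p (B-up q r))
    ... | inj₁ (inj₂ r)  = ⊥-elim (p (subst B r q))
    ⊏-trans {suc i} {suc j} {zero}  p q = λ b → q (B-up b p)
    ⊏-trans {suc i} {suc j} {suc k} p q = O.trans p q

    ⊏-irrefl : ∀ {i j} → i ≡ j → ¬ i ⊏ j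
    ⊏-irrefl {suc i} refl = O.irrefl refl

    ⊏-compare : ∀ i j → Tri (i ⊏ j) (i ≡ j) (j ⊏ i)
    ⊏-compare zero    zero    = tri≈ id refl id
    ⊏-compare zero    (suc j) with em {0ℓ} {B (L j)}
    ... | yes b = tri< b (λ ()) (λ ¬b → ¬b b)
    ... | no ¬b = tri> ¬b (λ ()) ¬b
    ⊏-compare (suc i) zero    with em {0ℓ} {B (L i)}
    ... | yes b = tri> (λ ¬b → ¬b b) (λ ()) b
    ... | no ¬b = tri< ¬b (λ ()) ¬b
    ⊏-compare (suc i) (suc j) with O.compare (L i) (L j)
    ... | tri< a ¬b ¬c = tri< a (λ { refl → ¬b refl }) ¬c
    ... | tri≈ ¬a b ¬c = tri≈ ¬a (cong suc (L-inj b)) ¬c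
    ... | tri> ¬a ¬b c = tri> ¬a (λ { refl → ¬b refl }) c

    X : OrderedMetricSpace
    X = record
      { Carrier = Fin (suc n)
      ; d = δ
      ; _<_ = _⊏_
      ; isMetric = record
        { isSemiMetric = record
          { isQuasiSemiMetric = record
            { isPreMetric = record
              { isProtoMetric = record
                { isPartialOrder = ℚₚ.≤-isPartialOrder
                ; ≈-isEquivalence = isEquivalence
                ; cong = cong₂ δ
                ; nonNegative = λ {i} {j} → δ-nonneg {i} {j}
                }
              ; ≈⇒0 = δ-refl
              }
            ; 0⇒≈ = δ-0
            }
          ; sym = δ-sym
          }
        ; triangle = δ-tri
        }
      ; isStrictTotalOrder = record
        { isStrictPartialOrder = record
          { isEquivalence = isEquivalence
          ; irrefl = λ {i} {j} → ⊏-irrefl {i} {j}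
          ; trans = λ {i} {j} {k} → ⊏-trans {i} {j} {k}
          ; <-resp-≈ = (λ { refl p → p }) , (λ { refl p → p })
          }
        ; compare = ⊏-compare
        }
      }

    emb : Embedding X QU
    emb = universal X (suc n , ↔-id _)
    module E = Embedding emb

    E-cancel : ∀ i j → E.to (suc i) < E.to (suc j) → L i < L j
    E-cancel i j p with L j ≼⊎≻ L i
    ... | inj₂ q = q
    ... | inj₁ (inj₁ q) = contradiction p (O.asym (E.monotone {_} {_} q))
    ... | inj₁ (inj₂ q) = contradiction p (O.irrefl (cong (λ i → E.to (suc i)) (sym (L-inj q))))

    hom : Σ[ g ∈ Automorphism QU ] (∀ i → to g (E.to (suc i)) ≡ L i)
    hom = homogeneous n (λ i → E.to (suc i)) L (λ i j → sym (E.isometric (suc i) (suc j))) E-cancel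

    g : Automorphism QU
    g = proj₁ hom

    at : ∀ i → d (to g (E.to zero)) (L i) ≡ f (L i)
             × (B (L i) → to g (E.to zero) < L i) × (¬ B (L i) → L i < to g (E.to zero))
    at i = subst (λ w → d (to g (E.to zero)) w ≡ f (L i)
             × (B (L i) → to g (E.to zero) < w) × (¬ B (L i) → w < to g (E.to zero)))
             (proj₂ hom i)
             ( trans (to-isometric g _ _) (E.isometric zero (suc i))
             , (λ b → to-< g (E.monotone b)) , (λ ¬b → to-< g (E.monotone ¬b)))

  opaque
    onePoint : OnePoint
    onePoint = onePoint′

  opaque
    extend : (ps : List (Carrier × Carrier)) →
      (∀ {p q} → p ∈ ps → q ∈ ps → d (proj₂ p) (proj₂ q) ≡ d (proj₁ p) (proj₁ q)) →
      (∀ {p q} → p ∈ ps → q ∈ ps → proj₁ p < proj₁ q → proj₂ p < proj₂ q) →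
      Σ[ g ∈ Automorphism QU ] (∀ {p} → p ∈ ps → to g (proj₁ p) ≡ proj₂ p)
    extend ps iso mono =
      let g , eq = homogeneous (length ps) (λ i → proj₁ (lookup ps i)) (λ i → proj₂ (lookup ps i))
                     (λ i j → iso (∈-lookup i) (∈-lookup j)) (λ i j → mono (∈-lookup i) (∈-lookup j))
      in g , λ p∈ → subst (λ p → to g (proj₁ p) ≡ proj₂ p) (sym (lookup-index p∈)) (eq (index p∈))

  moveAway₁ : (Z U : List Carrier) {z₀ : Carrier} → z₀ ∈ Z → (y : Carrier) →
    Σ[ k ∈ Automorphism QU ] (∀ {z} → z ∈ Z → to k z ≡ z) × (∀ {u} → u ∈ U → Far Z y (to k y) u)
  moveAway₁ Z U z₀∈Z y with em {0ℓ} {y ∈ Z}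
  ... | yes y∈Z = ε , (λ _ → refl) , λ {u} _ →
        (y , y∈Z , ℚₚ.≤-reflexive (trans (cong (_⊕ d y u) dxx≡0) (ℚₚ.+-identityˡ _)))
      , (λ y≼u → y , y∈Z , ≼-refl , y≼u)
  ... | no y∉Z = k , (λ z∈Z → k-eq (∈-++⁺ʳ [ y , y′ ] (∈-map⁺ (λ z → z , z) z∈Z))) , λ {u} u∈U →
        (m u , m∈ u , ℚₚ.≤-reflexive (trans (sym (proj₁ (y′-prop (∈-++⁺ʳ Z u∈U)))) (cong (λ x → d x u) (sym ky))))
      , λ ky≼u → order u∈U (subst (_≼ u) ky ky≼u)
    where
    φ : Carrier → Carrier → ℚ
    φ w z = d y z ⊕ d z w
    m : Carrier → Carrier
    m w = proj₁ (argmin (φ w) Z z₀∈Z)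
    m∈ : ∀ w → m w ∈ Z
    m∈ w = proj₁ (proj₂ (argmin (φ w) Z z₀∈Z))
    m-min : ∀ w {z} → z ∈ Z → φ w (m w) ≤ℚ φ w z
    m-min w = proj₂ (proj₂ (argmin (φ w) Z z₀∈Z))
    -- The largest distance that the triangle inequality allows through `Z`; on `Z` itself it agrees
    -- with the distance to `y`.
    f : Carrier → ℚ
    f w = φ w (m w)
    -- These points are forced to lie above the image, which is put above all others.
    B : Carrier → Set
    B w = ∃[ z ] z ∈ Z × y < z × z ≼ w
    y≢ : ∀ {z} → z ∈ Z → y ≢ z
    y≢ z∈Z refl = y∉Z z∈Z

    f>0 : ∀ w → 0ℚ <ℚ f w
    f>0 w = ℚₚ.<-≤-trans (d>0 (y≢ (m∈ w))) (p≤p⊕q M.nonNegative)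

    f-lip : ∀ w w′ → f w ≤ℚ f w′ ⊕ d w′ w
    f-lip w w′ = begin
      f w                                    ≤⟨ m-min w (m∈ w′) ⟩
      d y (m w′) ⊕ d (m w′) w                ≤⟨ ℚₚ.+-monoʳ-≤ (d y (m w′)) (M.triangle _ w′ _) ⟩
      d y (m w′) ⊕ (d (m w′) w′ ⊕ d w′ w)    ≡⟨ ℚₚ.+-assoc (d y (m w′)) _ _ ⟨
      f w′ ⊕ d w′ w                          ∎
      where open ℚₚ.≤-Reasoning

    d≤φ : ∀ w z → d y w ≤ℚ φ w z
    d≤φ w z = M.triangle _ _ _

    f-tri : ∀ w w′ → d w w′ ≤ℚ f w ⊕ f w′
    f-tri w w′ = begin
      d w w′         ≤⟨ M.triangle _ y _ ⟩
      d w y ⊕ d y w′ ≡⟨ cong (_⊕ d y w′) (M.sym w y) ⟩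
      d y w ⊕ d y w′ ≤⟨ ℚₚ.+-mono-≤ (d≤φ w (m w)) (d≤φ w′ (m w′)) ⟩
      f w ⊕ f w′     ∎
      where open ℚₚ.≤-Reasoning

    new : ∃[ y′ ] (∀ {w} → w ∈ Z ++ U → d y′ w ≡ f w × (B w → y′ < w) × (¬ B w → w < y′))
    new = onePoint (Z ++ U) f B (λ _ → f>0 _) (λ _ _ → f-lip _ _) (λ _ _ → f-tri _ _)
            (λ { (z , z∈ , y<z , z≼w) w<w′ → z , z∈ , y<z , inj₁ (≼-<-trans z≼w w<w′) })
    y′ = proj₁ new
    y′-prop : ∀ {w} → w ∈ Z ++ U → d y′ w ≡ f w × (B w → y′ < w) × (¬ B w → w < y′)
    y′-prop = proj₂ new

    fz : ∀ {z} → z ∈ Z → f z ≡ d y z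
    fz {z} z∈Z = ℚₚ.≤-antisym
      (ℚₚ.≤-trans (m-min z z∈Z) (ℚₚ.≤-reflexive (trans (cong (d y z ⊕_) dxx≡0) (ℚₚ.+-identityʳ _))))
      (d≤φ z (m z))

    dy′ : ∀ {z} → z ∈ Z → d y′ z ≡ d y z
    dy′ z∈Z = trans (proj₁ (y′-prop (∈-++⁺ˡ z∈Z))) (fz z∈Z)

    y′< : ∀ {z} → z ∈ Z → y < z → y′ < z
    y′< z∈Z y<z = proj₁ (proj₂ (y′-prop (∈-++⁺ˡ z∈Z))) (_ , z∈Z , y<z , ≼-refl)

    <y′ : ∀ {z} → z ∈ Z → z < y → z < y′
    <y′ z∈Z z<y = proj₂ (proj₂ (y′-prop (∈-++⁺ˡ z∈Z)))
      λ { (_ , _ , y<z′ , z′≼z) → O.asym (O.trans y<z′ (≼-<-trans z′≼z z<y)) (O.trans y<z′ (≼-<-trans z′≼z z<y)) }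

    ps : List (Carrier × Carrier)
    ps = [ y , y′ ] ++ map (λ z → z , z) Z

    iso : ∀ {p q} → p ∈ ps → q ∈ ps → d (proj₂ p) (proj₂ q) ≡ d (proj₁ p) (proj₁ q)
    iso (here refl) (here refl) = trans dxx≡0 (sym dxx≡0)
    iso (here refl) (there q∈)  with _ , z∈ , refl ← ∈-map⁻ _ q∈ = dy′ z∈
    iso (there p∈)  (here refl) with _ , z∈ , refl ← ∈-map⁻ _ p∈ = trans (M.sym _ _) (trans (dy′ z∈) (M.sym _ _))
    iso (there p∈)  (there q∈)  with _ , _ , refl ← ∈-map⁻ _ p∈ | _ , _ , refl ← ∈-map⁻ _ q∈ = refl

    mono : ∀ {p q} → p ∈ ps → q ∈ ps → proj₁ p < proj₁ q → proj₂ p < proj₂ q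
    mono (here refl) (here refl) lt = contradiction lt (O.irrefl refl)
    mono (here refl) (there q∈) lt with _ , z∈ , refl ← ∈-map⁻ _ q∈ = y′< z∈ lt
    mono (there p∈) (here refl) lt with _ , z∈ , refl ← ∈-map⁻ _ p∈ = <y′ z∈ lt
    mono (there p∈) (there q∈) lt with _ , _ , refl ← ∈-map⁻ _ p∈ | _ , _ , refl ← ∈-map⁻ _ q∈ = lt

    ext = extend ps iso mono
    k = proj₁ ext
    k-eq : ∀ {p} → p ∈ ps → to k (proj₁ p) ≡ proj₂ p
    k-eq = proj₂ ext
    ky : to k y ≡ y′
    ky = k-eq (here refl)

    order : ∀ {u} → u ∈ U → y′ ≼ u → ∃[ z ] z ∈ Z × y ≼ z × z ≼ u
    order {u} u∈U y′≼u with em {0ℓ} {B u}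
    ... | yes (z , z∈ , y<z , z≼u) = z , z∈ , inj₁ y<z , z≼u
    ... | no ¬b = contradiction y′≼u (<⇒⋡ (proj₂ (proj₂ (y′-prop (∈-++⁺ʳ Z u∈U))) ¬b))

  opaque
    -- The points are moved one at a time, each over `Z` together with the images already placed, so
    -- that mutual distances survive. A bound through an earlier image is continued by that image's
    -- own bound through `Z`; this is `lift`.
    moveAway : (Z Y U : List Carrier) {z₀ : Carrier} → z₀ ∈ Z →
      Σ[ k ∈ Automorphism QU ] (∀ {z} → z ∈ Z → to k z ≡ z)
        × (∀ {y u} → y ∈ Y → u ∈ U → Far Z y (to k y) u)
    moveAway Z []      U z₀∈Z = ε , (λ _ → refl) , λ ()
    moveAway Z (y ∷ Y) U z₀∈Z =
      let k₀ , fix₀ , far₀ = moveAway Z Y U z₀∈Z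
          k₁ , fix₁ , far₁ = moveAway₁ (Z ++ map (to k₀) Y) U (∈-++⁺ˡ z₀∈Z) (to k₀ y)
      in k₁ ∙ k₀
       , (λ z∈ → trans (cong (to k₁) (fix₀ z∈)) (fix₁ (∈-++⁺ˡ z∈)))
       , λ { {u = u} (here refl) u∈ → lift k₀ fix₀ far₀ u∈ (far₁ u∈)
           ; {y = y′} {u = u} (there y∈) u∈ →
               subst (λ x → Far Z y′ x u) (sym (fix₁ (∈-++⁺ʳ Z (∈-map⁺ (to k₀) y∈)))) (far₀ y∈ u∈) }
      where
      lift : ∀ k₀ → (∀ {z} → z ∈ Z → to k₀ z ≡ z) → (∀ {y u} → y ∈ Y → u ∈ U → Far Z y (to k₀ y) u) →
             ∀ {u} → u ∈ U → ∀ {y′} → Far (Z ++ map (to k₀) Y) (to k₀ y) y′ u → Far Z y y′ u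
      lift k₀ fix₀ far₀ {u} u∈ {y′} ((v , v∈ , m) , o) = metric (∈-++⁻ Z v∈) , λ y′≼u → order (o y′≼u)
        where
        metric : v ∈ Z ⊎ v ∈ map (to k₀) Y → ∃[ z ] z ∈ Z × d y z ⊕ d z u ≤ℚ d y′ u
        metric (inj₁ v∈Z) = v , v∈Z ,
          subst (λ q → q ⊕ d v u ≤ℚ d y′ u)
            (trans (cong (d (to k₀ y)) (sym (fix₀ v∈Z))) (to-isometric k₀ y v)) m
        metric (inj₂ v∈Y) with y₁ , y₁∈ , refl ← ∈-map⁻ (to k₀) v∈Y
          with (z , z∈ , far) , _ ← far₀ y₁∈ u∈ = z , z∈ , (begin
            d y z ⊕ d z u                        ≤⟨ ℚₚ.+-monoˡ-≤ (d z u) (M.triangle y y₁ z) ⟩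
            (d y y₁ ⊕ d y₁ z) ⊕ d z u            ≡⟨ ℚₚ.+-assoc (d y y₁) _ _ ⟩
            d y y₁ ⊕ (d y₁ z ⊕ d z u)            ≤⟨ ℚₚ.+-monoʳ-≤ (d y y₁) far ⟩
            d y y₁ ⊕ d (to k₀ y₁) u              ≡⟨ cong (_⊕ d (to k₀ y₁) u) (to-isometric k₀ y y₁) ⟨
            d (to k₀ y) (to k₀ y₁) ⊕ d (to k₀ y₁) u ≤⟨ m ⟩
            d y′ u                               ∎)
          where open ℚₚ.≤-Reasoning
        order : ∃[ v ] v ∈ Z ++ map (to k₀) Y × to k₀ y ≼ v × v ≼ u → ∃[ z ] z ∈ Z × y ≼ z × z ≼ u
        order (v , v∈ , k₀y≼v , v≼u) with ∈-++⁻ Z v∈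
        ... | inj₁ v∈Z = v , v∈Z , to-≼⁻ k₀ (subst (to k₀ y ≼_) (sym (fix₀ v∈Z)) k₀y≼v) , v≼u
        ... | inj₂ v∈Y with y₁ , y₁∈ , refl ← ∈-map⁻ (to k₀) v∈Y
                       with z , z∈ , y₁≼z , z≼u ← proj₂ (far₀ y₁∈ u∈) v≼u =
              z , z∈ , ≼-trans (to-≼⁻ k₀ k₀y≼v) y₁≼z , z≼u

  -- `Far` over the values of `g` on `D`, with the first distance and the first comparison pulled
  -- back along `g`.
  Free : Automorphism QU → List Carrier → Carrier → Carrier → Carrier → Set
  Free g D y y′ u = (∃[ v ] v ∈ D × d y v ⊕ d (to g v) u ≤ℚ d y′ u)
                  × (y′ ≼ u → ∃[ v ] v ∈ D × y ≼ v × to g v ≼ u)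

  opaque
    freeStep : (g : Automorphism QU) (D Y U : List Carrier) {c : Carrier} → c ∈ D →
      Σ[ g′ ∈ Automorphism QU ] Agree D g g′ × (∀ {y u} → y ∈ Y → u ∈ U → Free g D y (to g′ y) u)
    freeStep g D Y U c∈D =
      let k , fix , far = moveAway (map (to g) D) (map (to g) Y) U (∈-map⁺ (to g) c∈D)
      in k ∙ g , (λ x x∈D → fix (∈-map⁺ (to g) x∈D)) , λ y∈ u∈ →
           let (z , z∈ , m) , o = far (∈-map⁺ (to g) y∈) u∈ in
           metric z∈ m , λ p → order (o p)
      where
      metric : ∀ {y y′ u z} → z ∈ map (to g) D → d (to g y) z ⊕ d z u ≤ℚ d y′ u →
               ∃[ v ] v ∈ D × d y v ⊕ d (to g v) u ≤ℚ d y′ u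
      metric {y} {y′} {u} z∈ m with v , v∈ , refl ← ∈-map⁻ (to g) z∈ =
        v , v∈ , subst (λ q → q ⊕ d (to g v) u ≤ℚ d y′ u) (to-isometric g y v) m
      order : ∀ {y u} → ∃[ z ] z ∈ map (to g) D × to g y ≼ z × z ≼ u → ∃[ v ] v ∈ D × y ≼ v × to g v ≼ u
      order (z , z∈ , y≼z , z≼u) with v , v∈ , refl ← ∈-map⁻ (to g) z∈ = v , v∈ , to-≼⁻ g y≼z , z≼u

  -- Free extensions create no fixed points: the witness `v` in `D` would be at distance 0 from `y`.
  free-fixed : ∀ {g D y y′} → Free g D y y′ y → y′ ≡ y → y ∈ D
  free-fixed {g} {D} {y} ((v , v∈ , m) , _) refl = subst (_∈ D) (sym y≡v) v∈
    where
    y≡v : y ≡ v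
    y≡v = d≤0⇒≡ (ℚₚ.≤-trans (p≤p⊕q M.nonNegative) (subst (d y v ⊕ d (to g v) y ≤ℚ_) dxx≡0 m))

  opaque
    separation : ∀ xs ys → ∃[ δ ] 0ℚ <ℚ δ × (∀ {x y} → x ∈ xs → y ∈ ys → x ≢ y → δ ≤ℚ d x y)
    separation []       ys = 1ℚ , ℚₚ.positive⁻¹ 1ℚ , λ ()
    separation (x ∷ xs) ys =
      let δ , 0<δ , sep = separation xs ys ; δ′ , 0<δ′ , sep′ = row ys in
      δ ℚ.⊓ δ′ , ⊓-pos 0<δ 0<δ′ ,
      λ { (here refl) y∈ x≢y → ℚₚ.≤-trans (ℚₚ.p⊓q≤q δ δ′) (sep′ y∈ x≢y)
        ; (there x∈)  y∈ x≢y → ℚₚ.≤-trans (ℚₚ.p⊓q≤p δ δ′) (sep x∈ y∈ x≢y) }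
      where
      ⊓-pos : ∀ {p q} → 0ℚ <ℚ p → 0ℚ <ℚ q → 0ℚ <ℚ p ℚ.⊓ q
      ⊓-pos {p} {q} 0<p 0<q with ℚₚ.⊓-sel p q
      ... | inj₁ eq = subst (0ℚ <ℚ_) (sym eq) 0<p
      ... | inj₂ eq = subst (0ℚ <ℚ_) (sym eq) 0<q
      row : ∀ ys → ∃[ δ ] 0ℚ <ℚ δ × (∀ {y} → y ∈ ys → x ≢ y → δ ≤ℚ d x y)
      row []       = 1ℚ , ℚₚ.positive⁻¹ 1ℚ , λ ()
      row (y ∷ ys) with row ys | x O.≟ y
      ... | δ , 0<δ , sep | yes x≡y = δ , 0<δ , λ { (here refl) x≢y → contradiction x≡y x≢y ; (there y∈) → sep y∈ }
      ... | δ , 0<δ , sep | no x≢y = δ ℚ.⊓ d x y , ⊓-pos 0<δ (d>0 x≢y) ,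
        λ { (here refl) _ → ℚₚ.p⊓q≤q δ (d x y) ; (there y∈) x≢y → ℚₚ.≤-trans (ℚₚ.p⊓q≤p δ (d x y)) (sep y∈ x≢y) }

  -- Powers of a single automorphism

  pow : Automorphism QU → ℕ → Automorphism QU
  pow h zero    = ε
  pow h (suc k) = h ∙ pow h k

  infixr 8 _^_·_
  _^_·_ : Automorphism QU → ℕ → Carrier → Carrier
  h ^ k · x = to (pow h k) x

  pow-+ : ∀ h i j x → h ^ (i + j) · x ≡ h ^ i · h ^ j · x
  pow-+ h zero    j x = refl
  pow-+ h (suc i) j x = cong (to h) (pow-+ h i j x)

  pow-suc : ∀ h k x → h ^ k · to h x ≡ h ^ suc k · x
  pow-suc h zero    x = refl
  pow-suc h (suc k) x = cong (to h) (pow-suc h k x)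

  pow-fix : ∀ h k {x} → to h x ≡ x → h ^ k · x ≡ x
  pow-fix h zero    eq = refl
  pow-fix h (suc k) eq = trans (cong (to h) (pow-fix h k eq)) eq

  pow-fix⁻ : ∀ h k {x} → to h (h ^ k · x) ≡ h ^ k · x → to h x ≡ x
  pow-fix⁻ h k {x} eq = to-injective (pow h k) (trans (pow-suc h k x) eq)

  pow-agree : ∀ {g h D} → Agree D g h → ∀ k {x} → (∀ {i} → i ℕ.< k → g ^ i · x ∈ D) → h ^ k · x ≡ g ^ k · x
  pow-agree g~h zero    _    = refl
  pow-agree {g} {h} g~h (suc k) stay =
    trans (cong (to h) (pow-agree g~h k (λ i<k → stay (ℕₚ.m<n⇒m<1+n i<k)))) (g~h _ (stay (ℕₚ.n<1+n k)))

  pow-increasing : ∀ h k {x} → x < to h x → x < h ^ suc k · x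
  pow-increasing h zero    lt = lt
  pow-increasing h (suc k) lt = O.trans lt (to-< h (pow-increasing h k lt))

  pow-decreasing : ∀ h k {x} → to h x < x → h ^ suc k · x < x
  pow-decreasing h zero    lt = lt
  pow-decreasing h (suc k) lt = O.trans (to-< h (pow-decreasing h k lt)) lt

  pow-cycle : ∀ h k {x} → h ^ suc k · x ≡ x → to h x ≡ x
  pow-cycle h k {x} eq with O.compare (to h x) x
  ... | tri≈ _ p _ = p
  ... | tri< p _ _ = contradiction (pow-decreasing h k p) (O.irrefl eq)
  ... | tri> _ _ p = contradiction (pow-increasing h k p) (O.irrefl (sym eq))

  -- An order automorphism has no finite orbits except fixed points.
  confined⇒fixed : ∀ h D m {x} → length D ≤ m → (∀ {i} → i ≤ m → h ^ i · x ∈ D) → to h x ≡ x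
  confined⇒fixed h D m {x} len stay with Finₚ.pigeonhole (s≤s len) (λ i → index (stay (Finₚ.toℕ≤pred[n] {suc m} i)))
  ... | i , j , i<j , eq = pow-cycle h e (sym (to-injective (pow h (toℕ i)) (begin
      h ^ toℕ i · x                 ≡⟨ lookup-index (stay (Finₚ.toℕ≤pred[n] i)) ⟩
      lookup D (index (stay (Finₚ.toℕ≤pred[n] i))) ≡⟨ cong (lookup D) eq ⟩
      lookup D (index (stay (Finₚ.toℕ≤pred[n] j))) ≡⟨ lookup-index (stay (Finₚ.toℕ≤pred[n] j)) ⟨
      h ^ toℕ j · x                 ≡⟨ cong (λ k → h ^ k · x) (trans (ℕₚ.+-suc (toℕ i) e) (ℕₚ.m+[n∸m]≡n i<j)) ⟨
      h ^ (toℕ i + suc e) · x       ≡⟨ pow-+ h (toℕ i) (suc e) x ⟩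
      h ^ toℕ i · h ^ suc e · x     ∎)))
    where
    open ≡-Reasoning
    e = toℕ j ∸ suc (toℕ i)

  orbits : Automorphism QU → List Carrier → ℕ → List Carrier
  orbits h X zero    = X
  orbits h X (suc k) = orbits h X k ++ map (to (pow h (suc k))) X

  ∈-orbits⁺ : ∀ h X k {i x} → i ≤ k → x ∈ X → h ^ i · x ∈ orbits h X k
  ∈-orbits⁺ h X zero    z≤n x∈ = x∈
  ∈-orbits⁺ h X (suc k) i≤ x∈ with ℕₚ.m≤n⇒m<n∨m≡n i≤
  ... | inj₁ (s≤s i≤k) = ∈-++⁺ˡ (∈-orbits⁺ h X k i≤k x∈)
  ... | inj₂ refl      = ∈-++⁺ʳ (orbits h X k) (∈-map⁺ _ x∈)

  ∈-orbits⁻ : ∀ h X k {v} → v ∈ orbits h X k → ∃[ i ] ∃[ x ] i ≤ k × x ∈ X × v ≡ h ^ i · x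
  ∈-orbits⁻ h X zero    v∈ = 0 , _ , z≤n , v∈ , refl
  ∈-orbits⁻ h X (suc k) v∈ with ∈-++⁻ (orbits h X k) v∈
  ... | inj₁ p = let i , x , i≤k , rest = ∈-orbits⁻ h X k p in i , x , ℕₚ.m≤n⇒m≤1+n i≤k , rest
  ... | inj₂ p with x , x∈ , refl ← ∈-map⁻ _ p = suc k , x , ℕₚ.≤-refl , x∈ , refl

  -- As `pow h j` is isometric, the first summand is the distance from `h ^ k · y` to `h ^ j · x`.
  -- So, wherever the exponent is cut, a shortest path from `h ^ k · y` to `u` meets the image of
  -- `X` under that power.
  Split : Automorphism QU → List Carrier → ℕ → Set
  Split h X k = ∀ i j → i + j ≡ k → ∀ {y u} → y ∈ X → u ∈ X →
    ∃[ x ] x ∈ X × d (h ^ i · y) x ⊕ d (h ^ j · x) u ≤ℚ d (h ^ k · y) u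

  -- An implication takes the place of a fixed point between `y` and `u`, because none is known yet:
  -- `phase` finds one below `x` and uses this to bring it below `u`.
  Chained : Automorphism QU → List Carrier → ℕ → Set
  Chained h X k = ∀ {y u} → y ∈ X → u ∈ X → h ^ k · y ≼ u →
    ∃[ x ] x ∈ X × to h y ≼ x × (∀ {c} → c ∈ X → to h c ≡ c → c ≼ x → c ≼ u)

  -- A single cut into two shorter exponents suffices. The desired cut falls into one of the two
  -- parts, which is split at lower order; the triangle inequality rejoins the remainder with the
  -- other part.
  splitAll : ∀ {h X k} → (∀ {j} → j ≤ suc k → Split h X j) →
    (∀ {y u} → y ∈ X → u ∈ X → ∃[ a ] ∃[ b ] ∃[ x ] a + b ≡ suc (suc k) × a ≤ suc k × b ≤ suc k × x ∈ X ×
        d (h ^ a · y) x ⊕ d (h ^ b · x) u ≤ℚ d (h ^ suc (suc k) · y) u) →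
    Split h X (suc (suc k))
  splitAll {h} {X} {k} small some i j i+j {y} {u} y∈ u∈ with some y∈ u∈
  ... | a , b , x , a+b , a≤ , b≤ , x∈ , le with ℕₚ.≤-total i a
  ...   | inj₁ i≤a with small a≤ i (a ∸ i) (ℕₚ.m+[n∸m]≡n i≤a) y∈ x∈
  ...     | x₁ , x₁∈ , le₁ = x₁ , x₁∈ , (begin
      d (h ^ i · y) x₁ ⊕ d (h ^ j · x₁) u ≤⟨ ℚₚ.+-monoʳ-≤ (d (h ^ i · y) x₁) le₂ ⟩
      d (h ^ i · y) x₁ ⊕ (d (h ^ e · x₁) x ⊕ d (h ^ b · x) u) ≡⟨ ℚₚ.+-assoc (d (h ^ i · y) x₁) _ _ ⟨
      (d (h ^ i · y) x₁ ⊕ d (h ^ e · x₁) x) ⊕ d (h ^ b · x) u ≤⟨ ℚₚ.+-monoˡ-≤ (d (h ^ b · x) u) le₁ ⟩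
      d (h ^ a · y) x ⊕ d (h ^ b · x) u   ≤⟨ le ⟩
      d (h ^ suc (suc k) · y) u           ∎)
    where
    open ℚₚ.≤-Reasoning
    e = a ∸ i
    j≡b+e : j ≡ b + e
    j≡b+e = ℕₚ.+-cancelˡ-≡ i j (b + e) (trans i+j (trans (sym a+b) (trans (cong (_+ b) (sym (ℕₚ.m+[n∸m]≡n i≤a)))
              (trans (ℕₚ.+-assoc i e b) (cong (i +_) (ℕₚ.+-comm e b))))))
    le₂ : d (h ^ j · x₁) u ≤ℚ d (h ^ e · x₁) x ⊕ d (h ^ b · x) u
    le₂ = begin
      d (h ^ j · x₁) u ≡⟨ cong (λ z → d z u) (trans (cong (λ k → h ^ k · x₁) j≡b+e) (pow-+ h b e x₁)) ⟩
      d (h ^ b · h ^ e · x₁) u ≤⟨ M.triangle _ (h ^ b · x) _ ⟩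
      d (h ^ b · h ^ e · x₁) (h ^ b · x) ⊕ d (h ^ b · x) u ≡⟨ cong (_⊕ d (h ^ b · x) u) (to-isometric (pow h b) _ _) ⟩
      d (h ^ e · x₁) x ⊕ d (h ^ b · x) u ∎
  splitAll {h} {X} {k} small some i j i+j {y} {u} y∈ u∈ | a , b , x , a+b , a≤ , b≤ , x∈ , le | inj₂ a≤i
    with small b≤ (i ∸ a) j (ℕₚ.+-cancelˡ-≡ a (i ∸ a + j) b (trans (sym (ℕₚ.+-assoc a (i ∸ a) j))
            (trans (cong (_+ j) (ℕₚ.m+[n∸m]≡n a≤i)) (trans i+j (sym a+b))))) x∈ u∈
  ... | x₁ , x₁∈ , le₁ = x₁ , x₁∈ , (begin
      d (h ^ i · y) x₁ ⊕ d (h ^ j · x₁) u ≤⟨ ℚₚ.+-monoˡ-≤ (d (h ^ j · x₁) u) le₂ ⟩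
      (d (h ^ a · y) x ⊕ d (h ^ e · x) x₁) ⊕ d (h ^ j · x₁) u ≡⟨ ℚₚ.+-assoc (d (h ^ a · y) x) _ _ ⟩
      d (h ^ a · y) x ⊕ (d (h ^ e · x) x₁ ⊕ d (h ^ j · x₁) u) ≤⟨ ℚₚ.+-monoʳ-≤ (d (h ^ a · y) x) le₁ ⟩
      d (h ^ a · y) x ⊕ d (h ^ b · x) u   ≤⟨ le ⟩
      d (h ^ suc (suc k) · y) u           ∎)
    where
    open ℚₚ.≤-Reasoning
    e = i ∸ a
    le₂ : d (h ^ i · y) x₁ ≤ℚ d (h ^ a · y) x ⊕ d (h ^ e · x) x₁
    le₂ = begin
      d (h ^ i · y) x₁ ≡⟨ cong (λ z → d z x₁) (trans (cong (λ k → h ^ k · y) (sym (ℕₚ.m∸n+n≡m a≤i))) (pow-+ h e a y)) ⟩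
      d (h ^ e · h ^ a · y) x₁ ≤⟨ M.triangle _ (h ^ e · x) _ ⟩
      d (h ^ e · h ^ a · y) (h ^ e · x) ⊕ d (h ^ e · x) x₁ ≡⟨ cong (_⊕ d (h ^ e · x) x₁) (to-isometric (pow h e) _ _) ⟩
      d (h ^ a · y) x ⊕ d (h ^ e · x) x₁ ∎

  -- The powers of h beyond the prescribed values on X are made as free as
  -- possible, one at a time.
  opaque
    tower : ∀ h X {c} → c ∈ X → ∀ k → Σ[ h′ ∈ Automorphism QU ] Agree X h h′ ×
            (∀ {j} → j ≤ suc k → Split h′ X j) × (∀ {j} → j ≤ k → Chained h′ X (suc j))
    tower h X c∈ zero = h , (λ _ _ → refl) , (λ { z≤n → split₀ ; (s≤s z≤n) → split₁ }) , λ { z≤n → chain₁ }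
      where
      split₀ : Split h X 0
      split₀ zero zero _ {y} {u} y∈ u∈ = y , y∈ , ℚₚ.≤-reflexive (trans (cong (_⊕ d y u) dxx≡0) (ℚₚ.+-identityˡ _))
      split₁ : Split h X 1
      split₁ zero (suc zero) _ {y} {u} y∈ u∈ = y , y∈ , ℚₚ.≤-reflexive (trans (cong (_⊕ d (to h y) u) dxx≡0) (ℚₚ.+-identityˡ _))
      split₁ (suc zero) zero _ {y} {u} y∈ u∈ = u , u∈ , ℚₚ.≤-reflexive (trans (cong (d (to h y) u ⊕_) dxx≡0) (ℚₚ.+-identityʳ _))
      chain₁ : Chained h X 1
      chain₁ y∈ u∈ hy≼u = _ , u∈ , hy≼u , λ _ _ p → p
    tower h X c∈ (suc k) =
      let g , h~g , splits , chains = tower h X c∈ k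
          -- `g` is kept only on the orbits up to height k, so the images of the points at height k
          -- + 1, which determine the power k + 2 on `X`, can be chosen freely.
          s , g~s , free = freeStep g (orbits g X k) (map (to (pow g (suc k))) X) X (∈-orbits⁺ g X k z≤n c∈)
      in s , agree-extend h g s (∈-orbits⁺ g X k z≤n) h~g g~s
       , (λ j≤ → splits′ g s g~s splits free (ℕₚ.m≤n⇒m<n∨m≡n j≤))
       , (λ j≤ → chains′ g s g~s chains free (ℕₚ.m≤n⇒m<n∨m≡n j≤))
      where
      module _ (g s : Automorphism QU) (g~s : Agree (orbits g X k) g s) where
        pows : ∀ {i x} → i ≤ suc k → x ∈ X → s ^ i · x ≡ g ^ i · x
        pows i≤ x∈ = pow-agree {g} {s} g~s _ (λ j<i → ∈-orbits⁺ g X k (ℕₚ.≤-pred (ℕₚ.≤-trans j<i i≤)) x∈)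

        splitOld : (∀ {j} → j ≤ suc k → Split g X j) → ∀ {j} → j ≤ suc k → Split s X j
        splitOld splits j≤ i j i+j {y} {u} y∈ u∈ with splits j≤ i j i+j y∈ u∈
        ... | x , x∈ , le = x , x∈ ,
          subst₂ _≤ℚ_
            (cong₂ _⊕_ (cong (λ z → d z x) (sym (pows (ℕₚ.≤-trans (ℕₚ.m≤m+n i j) i+j≤) y∈)))
                       (cong (λ z → d z u) (sym (pows (ℕₚ.≤-trans (ℕₚ.m≤n+m j i) i+j≤) x∈))))
            (cong (λ z → d z u) (sym (pows j≤ y∈))) le
          where
          i+j≤ : i + j ≤ suc k
          i+j≤ = subst (_≤ suc k) (sym i+j) j≤

        chainOld : (∀ {j} → j ≤ k → Chained g X (suc j)) → ∀ {j} → j ≤ k → Chained s X (suc j)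
        chainOld chains j≤ {y} {u} y∈ u∈ p with chains j≤ y∈ u∈ (subst (_≼ u) (pows (s≤s j≤) y∈) p)
        ... | x , x∈ , q , f = x , x∈ , subst (_≼ x) (sym (pows (s≤s z≤n) y∈)) q ,
          λ c∈ sc c≼x → f c∈ (trans (sym (g~s _ (∈-orbits⁺ g X k z≤n c∈))) sc) c≼x

        Frees : Set
        Frees = ∀ {y u} → y ∈ map (to (pow g (suc k))) X → u ∈ X → Free g (orbits g X k) y (to s y) u

        splits′ : (∀ {j} → j ≤ suc k → Split g X j) → Frees → ∀ {j} → j ℕ.< suc (suc k) ⊎ j ≡ suc (suc k) → Split s X j
        splits′ splits free (inj₁ (s≤s j≤)) = splitOld splits j≤
        splits′ splits free (inj₂ refl) = splitAll (splitOld splits) some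
          where
          some : ∀ {y u} → y ∈ X → u ∈ X → ∃[ a ] ∃[ b ] ∃[ x ] a + b ≡ suc (suc k) × a ≤ suc k × b ≤ suc k × x ∈ X ×
                 d (s ^ a · y) x ⊕ d (s ^ b · x) u ≤ℚ d (s ^ suc (suc k) · y) u
          some {y} {u} y∈ u∈ with proj₁ (free (∈-map⁺ _ y∈) u∈)
          ... | v , v∈ , le with ∈-orbits⁻ g X k v∈
          -- Cancelling the power i turns the witness of freeness into a cut of the exponent; both
          -- parts are shorter because i ≤ k.
          ...   | i , x , i≤k , x∈ , refl = a , suc i , x , a+b , ℕₚ.m∸n≤m (suc k) i , s≤s i≤k , x∈ ,
                subst₂ _≤ℚ_ (cong₂ _⊕_ eq₁ (cong (λ z → d z u) (sym (pows (s≤s i≤k) x∈))))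
                  (cong (λ z → d (to s z) u) (sym (pows ℕₚ.≤-refl y∈))) le
            where
            a = suc k ∸ i
            i≤sk = ℕₚ.m≤n⇒m≤1+n i≤k
            a+b : a + suc i ≡ suc (suc k)
            a+b = trans (ℕₚ.+-suc a i) (cong suc (ℕₚ.m∸n+n≡m i≤sk))
            eq₁ : d (g ^ suc k · y) (g ^ i · x) ≡ d (s ^ a · y) x
            eq₁ = trans (cong (λ z → d z (g ^ i · x)) (trans (cong (λ j → g ^ j · y) (sym (ℕₚ.m+[n∸m]≡n i≤sk))) (pow-+ g i a y)))
                   (trans (to-isometric (pow g i) _ _) (cong (λ z → d z x) (sym (pows (ℕₚ.m∸n≤m (suc k) i) y∈))))

        chains′ : (∀ {j} → j ≤ k → Chained g X (suc j)) → Frees → ∀ {j} → j ℕ.< suc k ⊎ j ≡ suc k → Chained s X (suc j)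
        chains′ chains free (inj₁ (s≤s j≤)) = chainOld chains j≤
        chains′ chains free (inj₂ refl) {y} {u} y∈ u∈ p
          with proj₂ (free (∈-map⁺ _ y∈) u∈) (subst (λ z → to s z ≼ u) (pows ℕₚ.≤-refl y∈) p)
        ... | v , v∈ , q , r with ∈-orbits⁻ g X k v∈
        ...   | i , x , i≤k , x∈ , refl
          -- Cancel the power i to apply a shorter chain. A fixed point below `x` is afterwards
          -- brought below `u` by the power i + 1, which fixes it.
          with chains (ℕₚ.m∸n≤m k i) y∈ x∈ (to-≼⁻ (pow g i) (subst (_≼ g ^ i · x)
                 (trans (cong (λ j → g ^ j · y) (sym (trans (ℕₚ.+-suc i (k ∸ i)) (cong suc (ℕₚ.m+[n∸m]≡n i≤k))))) (pow-+ g i (suc (k ∸ i)) y)) q))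
        ...     | x′ , x′∈ , hy≼x′ , f = x′ , x′∈ , subst (_≼ x′) (sym (pows (s≤s z≤n) y∈)) hy≼x′ , λ {c} c∈ sc c≼x′ →
                  let gc = trans (sym (g~s c (∈-orbits⁺ g X k z≤n c∈))) sc in
                  ≼-trans (subst (_≼ g ^ suc i · x) (pow-fix g (suc i) gc) (to-≼ (pow g (suc i)) (f c∈ gc c≼x′))) r

  module _ {h s : Automorphism QU} {X : List Carrier} {c : Carrier} {δ : ℚ} {n : ℕ}
           (c∈ : c ∈ X) (hc : to h c ≡ c)
           (δ-gap : ∀ {x x′} → x ∈ X → x′ ∈ X → to h x ≢ x′ → δ ≤ℚ d (to h x) x′)
           (c-bound : ∀ {y u} → y ∈ X → u ∈ X → d y c ⊕ d c u ≤ℚ suc n ⊛ δ)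
           (h~s : Agree X h s)
           (splits : ∀ {j} → j ≤ suc (suc n * length X) → Split s X j)
           (chains : ∀ {j} → j ≤ suc n * length X → Chained s X (suc j)) where
    private
      L m : ℕ
      L = length X
      m = suc n * L

      1≤L : 1 ≤ L
      1≤L = ∈-length c∈

    open ℚₚ.≤-Reasoning

    -- Cut off one letter at a time: a distance below `δ` from `to s y` to a point of `X` must
    -- vanish, so the path is again in `X`, and its remainder still ends close to `u`.
    confined : ∀ k → k ≤ suc m → ∀ {y u} → y ∈ X → u ∈ X → d (s ^ k · y) u <ℚ δ → ∀ {i} → i ≤ k → s ^ i · y ∈ X
    confined k       k≤ y∈ u∈ lt {zero}  _ = y∈
    confined (suc k) k≤ {y} {u} y∈ u∈ lt {suc i} (s≤s i≤k) with splits k≤ 1 k refl y∈ u∈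
    ... | x , x∈ , le with em {P = to h y ≡ x}
    ...   | no hy≢x = contradiction
              (ℚₚ.≤-<-trans (subst (λ z → δ ≤ℚ d z x) (sym (h~s y y∈)) (δ-gap y∈ x∈ hy≢x))
                (ℚₚ.≤-<-trans (p≤p⊕q M.nonNegative) (ℚₚ.≤-<-trans le lt)))
              (ℚₚ.<-irrefl refl)
    ...   | yes hy≡x = subst (_∈ X) (trans (cong (s ^ i ·_) (sym sy≡x)) (pow-suc s i y))
              (confined k (ℕₚ.≤-trans (ℕₚ.n≤1+n k) k≤) x∈ u∈ (ℚₚ.≤-<-trans (p≤q⊕p M.nonNegative) (ℚₚ.≤-<-trans le lt)) i≤k)
      where
      sy≡x : to s y ≡ x
      sy≡x = trans (h~s y y∈) hy≡x

    fixed⊎far : ∀ {y u} → y ∈ X → u ∈ X → to s y ≡ y ⊎ δ ≤ℚ d (s ^ L · y) u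
    fixed⊎far {y} {u} y∈ u∈ with δ ℚₚ.≤? d (s ^ L · y) u
    ... | yes le = inj₂ le
    ... | no ¬le = inj₁ (confined⇒fixed s X L ℕₚ.≤-refl
            (confined L (ℕₚ.m≤n⇒m≤1+n (ℕₚ.m≤m+n L _)) y∈ u∈ (ℚₚ.≰⇒> ¬le)))

    Via : ℕ → Carrier → Carrier → Set
    Via k y u = ∃[ v ] v ∈ X × to s v ≡ v × d y v ⊕ d v u ≤ℚ d (s ^ k · y) u

    -- Each block of L steps gains `δ` unless, by the pigeonhole principle, it starts at a point of
    -- `X` fixed by `s`. In that case the distance runs through this fixed point, and later blocks
    -- preserve this.
    escape : ∀ j → j ≤ suc n → ∀ {y u} → y ∈ X → u ∈ X → Via (j * L) y u ⊎ (j ⊛ δ ≤ℚ d (s ^ (j * L) · y) u)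
    escape zero    _  y∈ u∈ = inj₂ M.nonNegative
    escape (suc j) j≤ {y} {u} y∈ u∈
      with splits (ℕₚ.m≤n⇒m≤1+n (ℕₚ.*-monoˡ-≤ L j≤)) (j * L) L (ℕₚ.+-comm (j * L) L) y∈ u∈
    ... | x , x∈ , le with escape j (ℕₚ.≤-trans (ℕₚ.n≤1+n j) j≤) y∈ x∈
    ...   | inj₁ (v , v∈ , sv , le′) = inj₁ (v , v∈ , sv , (begin
            d y v ⊕ d v u ≤⟨ ℚₚ.+-monoʳ-≤ (d y v) vu ⟩
            d y v ⊕ (d v x ⊕ d (s ^ L · x) u) ≡⟨ ℚₚ.+-assoc (d y v) _ _ ⟨
            (d y v ⊕ d v x) ⊕ d (s ^ L · x) u ≤⟨ ℚₚ.+-monoˡ-≤ (d (s ^ L · x) u) le′ ⟩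
            d (s ^ (j * L) · y) x ⊕ d (s ^ L · x) u ≤⟨ le ⟩
            d (s ^ (L + j * L) · y) u ∎))
      where
      vu : d v u ≤ℚ d v x ⊕ d (s ^ L · x) u
      vu = subst (λ q → d v u ≤ℚ q ⊕ d (s ^ L · x) u)
             (trans (cong (λ z → d z (s ^ L · x)) (sym (pow-fix s L sv))) (to-isometric (pow s L) v x)) (M.triangle v (s ^ L · x) u)
    ...   | inj₂ far with fixed⊎far x∈ u∈
    ...     | inj₂ far′ = inj₂ (begin
            δ ⊕ j ⊛ δ ≡⟨ ℚₚ.+-comm δ (j ⊛ δ) ⟩
            j ⊛ δ ⊕ δ ≤⟨ ℚₚ.+-mono-≤ far far′ ⟩
            d (s ^ (j * L) · y) x ⊕ d (s ^ L · x) u ≤⟨ le ⟩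
            d (s ^ (L + j * L) · y) u ∎)
    ...     | inj₁ sx = inj₁ (x , x∈ , sx ,
            subst (_≤ℚ d (s ^ (L + j * L) · y) u)
              (cong₂ _⊕_ (trans (cong (d (s ^ (j * L) · y)) (sym (pow-fix s (j * L) sx))) (to-isometric (pow s (j * L)) y x))
                         (cong (λ z → d z u) (pow-fix s L sx))) le)

    flow-through : ∀ {y u} → y ∈ X → u ∈ X → ∃[ v ] v ∈ X × to h v ≡ v × d y v ⊕ d v u ≤ℚ d (s ^ m · y) u
    flow-through {y} {u} y∈ u∈ with escape (suc n) ℕₚ.≤-refl y∈ u∈
    ... | inj₁ (v , v∈ , sv , le) = v , v∈ , trans (sym (h~s v v∈)) sv , le
    -- The number of blocks was chosen so that this distance is at least any detour through `c`,
    -- which therefore serves as `v`.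
    ... | inj₂ far = c , c∈ , hc , ℚₚ.≤-trans (c-bound y∈ u∈) far

    chained : ∀ k → k ≡ m → Chained s X k
    chained zero    eq = contradiction eq (ℕₚ.<⇒≢ (ℕₚ.≤-trans 1≤L (ℕₚ.m≤m+n L _)))
    chained (suc k) eq = chains (subst (k ≤_) eq (ℕₚ.n≤1+n k))

    flow-ordered : ∀ {y u} → y ∈ X → u ∈ X → s ^ m · y ≼ u →
              ∃[ x ] x ∈ X × to h y ≼ x × (∀ {c} → c ∈ X → to h c ≡ c → c ≼ x → c ≼ u)
    flow-ordered {y} {u} y∈ u∈ p with chained m refl y∈ u∈ p
    ... | x , x∈ , q , f = x , x∈ , subst (_≼ x) (h~s y y∈) q , λ {c} c∈ hc → f c∈ (trans (h~s c c∈) hc)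

  opaque
    flow : ∀ h X {c} → c ∈ X → to h c ≡ c → ∀ k₀ → Σ[ h′ ∈ Automorphism QU ] ∃[ m ] Agree X h h′ × k₀ ≤ m ×
           (∀ {y u} → y ∈ X → u ∈ X → ∃[ v ] v ∈ X × to h v ≡ v × d y v ⊕ d v u ≤ℚ d (h′ ^ m · y) u) ×
           (∀ {y u} → y ∈ X → u ∈ X → h′ ^ m · y ≼ u →
              ∃[ x ] x ∈ X × to h y ≼ x × (∀ {c} → c ∈ X → to h c ≡ c → c ≼ x → c ≼ u))
    flow h X {c} c∈ hc k₀ =
      let δ , 0<δ , gap = separation (map (to h) X) X
          K , _ , bound = upperBound (λ y u → d y c ⊕ d c u) X X
          n , K≤ = archimedean K δ 0<δ
          -- `n` lets the gained distance exceed the detours through `c`; `k₀` makes the exponent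
          -- long enough.
          N = k₀ + n
          s , h~s , splits , chains = tower h X c∈ (suc N * length X)
          gap′ = λ {x} {x′} (x∈ : x ∈ X) (x′∈ : x′ ∈ X) → gap (∈-map⁺ (to h) x∈) x′∈
          c-bound = λ {y} {u} (y∈ : y ∈ X) (u∈ : u ∈ X) → ℚₚ.≤-trans (bound y∈ u∈)
                      (ℚₚ.≤-trans K≤ (⊛-mono (ℚₚ.<⇒≤ 0<δ) (ℕₚ.m≤n⇒m≤1+n (ℕₚ.m≤n+m n k₀))))
      in s , suc N * length X , h~s
       , ℕₚ.≤-trans (ℕₚ.m≤n⇒m≤1+n (ℕₚ.m≤m+n k₀ n))
           (ℕₚ.≤-trans (ℕₚ.≤-reflexive (sym (ℕₚ.*-identityʳ (suc N)))) (ℕₚ.*-monoʳ-≤ (suc N) (∈-length c∈)))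
       , flow-through {h} {s} {X} {c} {δ} {N} c∈ hc gap′ c-bound h~s splits chains
       , flow-ordered {h} {s} {X} {c} {δ} {N} c∈ hc gap′ c-bound h~s splits chains

  -- For C the set of common fixed points, this is what keeps every image of y
  -- below u.
  Sep : (Carrier → Set) → Carrier → Carrier → Set
  Sep C y u = ∃[ c ] C c × y ≼ c × c ≼ u

  opaque
    -- One block of a single generator. Making `s` free on `X` before `flow` leaves no fixed points
    -- in `X` outside `P`, so the distance runs through an old fixed point. For the order, freeness
    -- turns the point `x` of `flow` into some `v` in `P` above `y`; the separation hypothesis puts
    -- a point of `C` between `y` and `v`, and `s` carries `v`, but not this point, on to `x` or
    -- below.
    phase : ∀ (s : Automorphism QU) (P X Y : List Carrier) (C : Carrier → Set) {c} →
      c ∈ P → to s c ≡ c → P ⊆ X → Y ⊆ X → (∀ {c} → C c → c ∈ P × to s c ≡ c) →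
      (∀ {y v} → y ∈ Y → v ∈ P → y ≼ v → Sep C y v) → ∀ k₀ →
      Σ[ s′ ∈ Automorphism QU ] ∃[ m ] ∃[ P′ ] Agree P s s′ × P ⊆ P′ × k₀ ≤ m ×
      (∀ {s″} → Agree P′ s′ s″ → ∀ {y} → y ∈ Y → s″ ^ m · y ≡ s′ ^ m · y) ×
      (∀ {v} → v ∈ P′ → to s′ v ≡ v → v ∈ P) ×
      (∀ {y u} → y ∈ Y → u ∈ X → ∃[ v ] v ∈ P × to s v ≡ v × d y v ⊕ d v u ≤ℚ d (s′ ^ m · y) u) ×
      (∀ {y u} → y ∈ Y → u ∈ X → s′ ^ m · y ≼ u → Sep C y u)
    phase s P X Y C c∈P sc P⊆X Y⊆X C-fix high k₀ with freeStep s P X X c∈P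
    ... | s₁ , s~s₁ , free with flow s₁ X (P⊆X c∈P) (trans (s~s₁ _ c∈P) sc) k₀
    ...   | s′ , m , s₁~s′ , k₀≤m , through , ordered =
      s′ , m , orbits s′ X m , agree-extend s s₁ s′ P⊆X s~s₁ s₁~s′
      , (λ v∈ → ∈-orbits⁺ s′ X m z≤n (P⊆X v∈)) , k₀≤m
      , (λ {s″} s′~s″ y∈ → pow-agree {s′} {s″} s′~s″ m (λ i<m → ∈-orbits⁺ s′ X m (ℕₚ.<⇒≤ i<m) (Y⊆X y∈)))
      , fixed , metric , order
      where
      fixed₁ : ∀ {v} → v ∈ X → to s₁ v ≡ v → v ∈ P
      fixed₁ v∈ eq = free-fixed {s} (free v∈ v∈) eq
      fixed : ∀ {v} → v ∈ orbits s′ X m → to s′ v ≡ v → v ∈ P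
      fixed v∈ s′v with ∈-orbits⁻ s′ X m v∈
      ... | i , x , _ , x∈ , refl =
        let s′x = pow-fix⁻ s′ i s′v
        in subst (_∈ P) (sym (pow-fix s′ i s′x)) (fixed₁ x∈ (trans (sym (s₁~s′ x x∈)) s′x))
      metric : ∀ {y u} → y ∈ Y → u ∈ X → ∃[ v ] v ∈ P × to s v ≡ v × d y v ⊕ d v u ≤ℚ d (s′ ^ m · y) u
      metric y∈ u∈ with through (Y⊆X y∈) u∈
      ... | v , v∈ , s₁v , le = let v∈P = fixed₁ v∈ s₁v in v , v∈P , trans (sym (s~s₁ v v∈P)) s₁v , le
      order : ∀ {y u} → y ∈ Y → u ∈ X → s′ ^ m · y ≼ u → Sep C y u
      order y∈ u∈ p with ordered (Y⊆X y∈) u∈ p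
      ... | x , x∈ , s₁y≼x , f with proj₂ (free (Y⊆X y∈) x∈) s₁y≼x
      ...   | v , v∈ , y≼v , sv≼x with high y∈ v∈ y≼v
      ...     | c , Cc , y≼c , c≼v =
        let c∈P , sc = C-fix Cc
        in c , Cc , y≼c , f (P⊆X c∈P) (trans (s~s₁ c c∈P) sc) (≼-trans (subst (_≼ to s _) sc (to-≼ s c≼v)) sv≼x)

  -- Alternating the two generators

  Pair : Set
  Pair = Bool → Automorphism QU

  act : Pair → Letter → Automorphism QU
  act h (b , true)  = h b
  act h (b , false) = h b ⁻¹

  -- The head of a word acts first.
  word : Pair → Word → Automorphism QU
  word h []      = ε
  word h (t ∷ r) = word h r ∙ act h t

  run : Pair → Word → Carrier → Carrier
  run h r = to (word h r)

  run-++ : ∀ h r r′ x → run h (r ++ r′) x ≡ run h r′ (run h r x)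
  run-++ h []      r′ x = refl
  run-++ h (t ∷ r) r′ x = run-++ h r r′ (to (act h t) x)

  run-power : ∀ h b m x → run h (pos (replicate m b)) x ≡ h b ^ m · x
  run-power h b zero    x = refl
  run-power h b (suc m) x = trans (run-power h b m (to (h b) x)) (pow-suc (h b) m x)

  act-fix : ∀ h {x} → (∀ b → to (h b) x ≡ x) → ∀ t → to (act h t) x ≡ x
  act-fix h fix (b , true)  = fix b
  act-fix h fix (b , false) = trans (cong (from (h b)) (sym (fix b))) (from-to (h b) _)

  run-fix : ∀ h {x} → (∀ b → to (h b) x ≡ x) → ∀ r → run h r x ≡ x
  run-fix h fix []      = refl
  run-fix h fix (t ∷ r) = trans (cong (run h r) (act-fix h fix t)) (run-fix h fix r)

  pair : Automorphism QU → Automorphism QU → Pair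
  pair p q true  = p
  pair p q false = q

  Sep-to : ∀ {C : Carrier → Set} g → (∀ {c} → C c → to g c ≡ c) → ∀ {y u} → Sep C y u → Sep C (to g y) u
  Sep-to g fix (c , Cc , y≼c , c≼u) = c , Cc , subst (to g _ ≼_) (fix Cc) (to-≼ g y≼c) , c≼u

  module Units (h : Pair) (E ys : List Carrier) {c₀ : Carrier} (c₀∈ : c₀ ∈ E) (hc₀ : ∀ b → to (h b) c₀ ≡ c₀) where

    Common : Carrier → Set
    Common c = c ∈ E × (∀ b → to (h b) c ≡ c)

    -- For y′ an image of y this is the largest distance to u that the common
    -- fixed points allow.
    Remote : Carrier → Carrier → Carrier → Set
    Remote y y′ u = ∃[ c ] Common c × d y c ⊕ d c u ≤ℚ d y′ u

    record State (T : Carrier → Carrier → Carrier → Set) : Set where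
      field
        p q     : Automorphism QU
        P Q     : List Carrier
        v       : List Bool
        p-agree : Agree E (h true) p
        q-agree : Agree E (h false) q
        E⊆P     : E ⊆ P
        E⊆Q     : E ⊆ Q
        p-fixed : ∀ {x} → x ∈ P → to p x ≡ x → x ∈ E
        q-fixed : ∀ {x} → x ∈ Q → to q x ≡ x → x ∈ E

      cur : Carrier → Carrier
      cur = run (pair p q) (pos v)

      field
        det  : ∀ {p′ q′} → Agree P p p′ → Agree Q q q′ → ∀ {y} → y ∈ ys → run (pair p′ q′) (pos v) y ≡ cur y
        -- Only `Q` has to be cleared, since the next block is a power of q. That block clears `P`
        -- for the power of p that follows.
        high : ∀ {y x} → y ∈ ys → x ∈ Q → cur y ≼ x → Sep Common (cur y) x
        far  : ∀ {y u} → y ∈ ys → u ∈ E → T y (cur y) u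

      p-Common : ∀ {c} → Common c → to p c ≡ c
      p-Common (c∈ , fix) = trans (p-agree _ c∈) (fix true)

      q-Common : ∀ {c} → Common c → to q c ≡ c
      q-Common (c∈ , fix) = trans (q-agree _ c∈) (fix false)

      cur-Common : ∀ {c} → Common c → cur c ≡ c
      cur-Common Cc = run-fix (pair p q) (λ { true → p-Common Cc ; false → q-Common Cc }) (pos v)

    module _ {T : Carrier → Carrier → Carrier → Set} (S : State T) (k : ℕ) where
      private module S = State S

      record Next : Set where
        field
          p q     : Automorphism QU
          P Q X   : List Carrier
          m₁ m₂   : ℕ
          p-agree : Agree S.P S.p p
          q-agree : Agree S.Q S.q q
          P⊆      : S.P ⊆ P
          Q⊆      : S.Q ⊆ Q
          p-fixed : ∀ {x} → x ∈ P → to p x ≡ x → x ∈ E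
          q-fixed : ∀ {x} → x ∈ Q → to q x ≡ x → x ∈ E
          k≤m₁    : k ≤ m₁
          k≤m₂    : k ≤ m₂
          E⊆X     : E ⊆ X
          Q⊆X     : Q ⊆ X
          -- Needed for the last extension of q, which compares the distances from the image of `y`
          -- to `x` and to `to q x`.
          qQ⊆X    : ∀ {x} → x ∈ Q → to q x ∈ X

        v : List Bool
        v = S.v ++ replicate m₁ false ++ replicate m₂ true

        new : Carrier → Carrier
        new y = p ^ m₂ · q ^ m₁ · S.cur y

        field
          det   : ∀ {p′ q′} → Agree P p p′ → Agree Q q q′ → ∀ {y} → y ∈ ys → run (pair p′ q′) (pos v) y ≡ new y
          order : ∀ {y u} → y ∈ ys → u ∈ X → new y ≼ u → Sep Common (new y) u
          via   : ∀ {y u} → y ∈ ys → u ∈ X → ∃[ x ] ∃[ x′ ] x ∈ E × x′ ∈ E × to S.q x ≡ x × to S.p x′ ≡ x′ ×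
                    d (S.cur y) x ⊕ (d x x′ ⊕ d x′ u) ≤ℚ d (new y) u

    module _ {T : Carrier → Carrier → Carrier → Set} (S : State T) where
      open State S

      Y X₁ : List Carrier
      Y  = map cur ys
      X₁ = Q ++ P ++ Y

      highQ : ∀ {y x} → y ∈ Y → x ∈ Q → y ≼ x → Sep Common y x
      highQ y∈ x∈ y≼x with _ , y∈′ , refl ← ∈-map⁻ cur y∈ = high y∈′ x∈ y≼x

      highP : ∀ {q′ m₁} → (∀ {c} → Common c → to q′ c ≡ c) →
        (∀ {y u} → y ∈ Y → u ∈ X₁ → q′ ^ m₁ · y ≼ u → Sep Common y u) →
        ∀ {y x} → y ∈ map (to (pow q′ m₁)) Y → x ∈ P → y ≼ x → Sep Common y x
      highP {q′} {m₁} fix ord y∈ x∈ y≼x with z , z∈ , refl ← ∈-map⁻ _ y∈ =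
        Sep-to (pow q′ m₁) (λ Cc → pow-fix q′ m₁ (fix Cc)) (ord z∈ (∈-++⁺ʳ Q (∈-++⁺ˡ x∈)) y≼x)

      agree-Common : ∀ {g g′ D} → E ⊆ D → Agree D g g′ → (∀ {c} → Common c → to g c ≡ c) → ∀ {c} → Common c → to g′ c ≡ c
      agree-Common E⊆D g~g′ fix Cc = trans (g~g′ _ (E⊆D (proj₁ Cc))) (fix Cc)

      opaque
        next : ∀ k → Next S k
        next k with phase q Q X₁ Y Common (E⊆Q c₀∈) (q-Common (c₀∈ , hc₀)) ∈-++⁺ˡ (λ y∈ → ∈-++⁺ʳ Q (∈-++⁺ʳ P y∈))
                      (λ Cc → E⊆Q (proj₁ Cc) , q-Common Cc) highQ k
        ... | q′ , m₁ , Q′ , q~q′ , Q⊆Q′ , k≤m₁ , det₁ , fix₁ , via₁ , ord₁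
          with phase p P (P ++ map (to (pow q′ m₁)) Y ++ Q′ ++ map (to q′) Q′) (map (to (pow q′ m₁)) Y) Common
                 (E⊆P c₀∈) (p-Common (c₀∈ , hc₀)) ∈-++⁺ˡ (λ y∈ → ∈-++⁺ʳ P (∈-++⁺ˡ y∈))
                 (λ Cc → E⊆P (proj₁ Cc) , p-Common Cc)
                 (highP {q′} {m₁} (agree-Common {q} {q′} E⊆Q q~q′ q-Common) ord₁) k
        ... | p′ , m₂ , P′ , p~p′ , P⊆P′ , k≤m₂ , det₂ , fix₂ , via₂ , ord₂ = record
          { p = p′ ; q = q′ ; P = P′ ; Q = Q′ ; X = X₂ ; m₁ = m₁ ; m₂ = m₂
          ; p-agree = p~p′ ; q-agree = q~q′ ; P⊆ = P⊆P′ ; Q⊆ = Q⊆Q′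
          ; p-fixed = λ x∈ eq → let x∈P = fix₂ x∈ eq in p-fixed x∈P (trans (sym (p~p′ _ x∈P)) eq)
          ; q-fixed = λ x∈ eq → let x∈Q = fix₁ x∈ eq in q-fixed x∈Q (trans (sym (q~q′ _ x∈Q)) eq)
          ; k≤m₁ = k≤m₁ ; k≤m₂ = k≤m₂
          ; E⊆X = λ e → ∈-++⁺ˡ (E⊆P e)
          ; Q⊆X = λ x∈ → ∈-++⁺ʳ P (∈-++⁺ʳ Y′ (∈-++⁺ˡ x∈))
          ; qQ⊆X = λ x∈ → ∈-++⁺ʳ P (∈-++⁺ʳ Y′ (∈-++⁺ʳ Q′ (∈-map⁺ (to q′) x∈)))
          ; det = det′
          ; order = λ y∈ u∈ le → Sep-to (pow p′ m₂) (λ Cc → pow-fix p′ m₂ (agree-Common {p} {p′} E⊆P p~p′ p-Common Cc))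
              (ord₂ (y′∈ y∈) u∈ le)
          ; via = via′
          }
          where
          Y′ X₂ : List Carrier
          Y′ = map (to (pow q′ m₁)) Y
          X₂ = P ++ Y′ ++ Q′ ++ map (to q′) Q′
          y′∈ : ∀ {y} → y ∈ ys → q′ ^ m₁ · cur y ∈ Y′
          y′∈ y∈ = ∈-map⁺ _ (∈-map⁺ cur y∈)
          tl : List Bool
          tl = replicate m₁ false ++ replicate m₂ true
          det′ : ∀ {p″ q″} → Agree P′ p′ p″ → Agree Q′ q′ q″ → ∀ {y} → y ∈ ys →
                 run (pair p″ q″) (pos (v ++ tl)) y ≡ p′ ^ m₂ · q′ ^ m₁ · cur y
          det′ {p″} {q″} p′~p″ q′~q″ {y} y∈ = begin
            run h″ (pos (v ++ tl)) y               ≡⟨ cong (λ r → run h″ r y) (Listₚ.map-++ _ v tl) ⟩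
            run h″ (pos v ++ pos tl) y             ≡⟨ run-++ h″ (pos v) (pos tl) y ⟩
            run h″ (pos tl) (run h″ (pos v) y)     ≡⟨ cong (run h″ (pos tl))
                (det (agree-extend p p′ p″ P⊆P′ p~p′ p′~p″) (agree-extend q q′ q″ Q⊆Q′ q~q′ q′~q″) y∈) ⟩
            run h″ (pos tl) z                      ≡⟨ cong (λ r → run h″ r z) (Listₚ.map-++ _ (replicate m₁ false) (replicate m₂ true)) ⟩
            run h″ (pos (replicate m₁ false) ++ pos (replicate m₂ true)) z ≡⟨ run-++ h″ (pos (replicate m₁ false)) _ z ⟩
            run h″ (pos (replicate m₂ true)) (run h″ (pos (replicate m₁ false)) z) ≡⟨ cong (run h″ (pos (replicate m₂ true)))
                (run-power h″ false m₁ z) ⟩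
            run h″ (pos (replicate m₂ true)) (q″ ^ m₁ · z) ≡⟨ run-power h″ true m₂ _ ⟩
            p″ ^ m₂ · q″ ^ m₁ · z                  ≡⟨ cong (p″ ^ m₂ ·_) (det₁ q′~q″ (∈-map⁺ cur y∈)) ⟩
            p″ ^ m₂ · q′ ^ m₁ · z                  ≡⟨ det₂ p′~p″ (y′∈ y∈) ⟩
            p′ ^ m₂ · q′ ^ m₁ · z                  ∎
            where
            open ≡-Reasoning
            h″ : Pair
            h″ = pair p″ q″
            z : Carrier
            z = cur y
          via′ : ∀ {y u} → y ∈ ys → u ∈ X₂ → ∃[ x ] ∃[ x′ ] x ∈ E × x′ ∈ E × to q x ≡ x × to p x′ ≡ x′ ×
                  d (cur y) x ⊕ (d x x′ ⊕ d x′ u) ≤ℚ d (p′ ^ m₂ · q′ ^ m₁ · cur y) u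
          via′ {y} {u} y∈ u∈ with via₂ (y′∈ y∈) u∈
          ... | x′ , x′∈ , px′ , le₂ with via₁ (∈-map⁺ cur y∈) (∈-++⁺ʳ Q (∈-++⁺ˡ x′∈))
          ...   | x , x∈ , qx , le₁ = x , x′ , q-fixed x∈ qx , p-fixed x′∈ px′ , qx , px′ , (begin
              d (cur y) x ⊕ (d x x′ ⊕ d x′ u) ≡⟨ ℚₚ.+-assoc (d (cur y) x) _ _ ⟨
              (d (cur y) x ⊕ d x x′) ⊕ d x′ u ≤⟨ ℚₚ.+-monoˡ-≤ (d x′ u) le₁ ⟩
              d (q′ ^ m₁ · cur y) x′ ⊕ d x′ u ≤⟨ le₂ ⟩
              d (p′ ^ m₂ · q′ ^ m₁ · cur y) u ∎)
            where open ℚₚ.≤-Reasoning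

      step : ∀ {k T′} → (N : Next S k) → (∀ {y u} → y ∈ ys → u ∈ E → T′ y (Next.new N y) u) → State T′
      step {T′ = T′} N far′ = record
        { p = N.p ; q = N.q ; P = N.P ; Q = N.Q ; v = N.v
        ; p-agree = agree-extend (h true) p N.p E⊆P p-agree N.p-agree
        ; q-agree = agree-extend (h false) q N.q E⊆Q q-agree N.q-agree
        ; E⊆P = λ e → N.P⊆ (E⊆P e) ; E⊆Q = λ e → N.Q⊆ (E⊆Q e)
        ; p-fixed = N.p-fixed ; q-fixed = N.q-fixed
        ; det = λ p~ q~ y∈ → trans (N.det p~ q~ y∈) (sym (new-cur y∈))
        ; high = λ {y} {x} y∈ x∈ le → subst (λ z → Sep Common z x) (sym (new-cur y∈))
                   (N.order y∈ (N.Q⊆X x∈) (subst (_≼ x) (new-cur y∈) le))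
        ; far = λ {y} {u} y∈ u∈ → subst (λ z → T′ y z u) (sym (new-cur y∈)) (far′ y∈ u∈)
        }
        where
        module N = Next N
        new-cur : ∀ {y} → y ∈ ys → run (pair N.p N.q) (pos N.v) y ≡ N.new y
        new-cur = N.det (λ _ _ → refl) (λ _ _ → refl)

      -- The detour through x, fixed by q, and x′, fixed by p, either passes
      -- through a common fixed point x = x′ or costs the distance from x to x′.
      improve : ∀ {k} (N : Next S k) {y u} → y ∈ ys → u ∈ Next.X N →
        ∃[ x ] x ∈ E × (Remote y (cur y) x → Remote y (Next.new N y) u) ×
        (Remote y (Next.new N y) u ⊎ ∃[ x′ ] x′ ∈ E × x ≢ x′ × d (cur y) x ⊕ d x x′ ≤ℚ d (Next.new N y) u)
      improve N {y} {u} y∈ u∈ with Next.via N y∈ u∈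
      ... | x , x′ , x∈ , x′∈ , qx , px′ , le = x , x∈ , remote , cases
        where
        open ℚₚ.≤-Reasoning
        z = cur y
        z′ = Next.new N y
        xu : d z x ⊕ d x u ≤ℚ d z′ u
        xu = ℚₚ.≤-trans (ℚₚ.+-monoʳ-≤ (d z x) (M.triangle x x′ u)) le
        remote : Remote y z x → Remote y z′ u
        remote (c , Cc , le′) = c , Cc , (begin
          d y c ⊕ d c u             ≤⟨ ℚₚ.+-monoʳ-≤ (d y c) (M.triangle c x u) ⟩
          d y c ⊕ (d c x ⊕ d x u)   ≡⟨ ℚₚ.+-assoc (d y c) _ _ ⟨
          (d y c ⊕ d c x) ⊕ d x u   ≤⟨ ℚₚ.+-monoˡ-≤ (d x u) le′ ⟩
          d z x ⊕ d x u             ≤⟨ xu ⟩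
          d z′ u                    ∎)
        cases : Remote y z′ u ⊎ ∃[ x′ ] x′ ∈ E × x ≢ x′ × d z x ⊕ d x x′ ≤ℚ d z′ u
        cases with x O.≟ x′
        ... | no x≢x′ = inj₂ (x′ , x′∈ , x≢x′ , ℚₚ.≤-trans (ℚₚ.+-monoʳ-≤ (d z x) (p≤p⊕q M.nonNegative)) le)
        ... | yes refl = inj₁ (x , Cx , subst (λ a → a ⊕ d x u ≤ℚ d z′ u)
                (trans (cong (d z) (sym (cur-Common Cx))) (to-isometric (word (pair p q) (pos v)) y x)) xu)
          where
          Cx : Common x
          Cx = x∈ , λ { true → trans (sym (p-agree x x∈)) px′ ; false → trans (sym (q-agree x x∈)) qx }

    module _ {δ : ℚ} (0<δ : 0ℚ <ℚ δ) (gap : ∀ {x x′} → x ∈ E → x′ ∈ E → x ≢ x′ → δ ≤ℚ d x x′)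
             (high₀ : ∀ {y x} → y ∈ ys → x ∈ E → y ≼ x → Sep Common y x) where

      Spread : ℕ → Carrier → Carrier → Carrier → Set
      Spread n y y′ u = Remote y y′ u ⊎ n ⊛ δ ≤ℚ d y′ u

      -- The argument of `escape` one level up: a unit q^m₁ p^m₂ gains `δ` by changing between two
      -- different fixed points, unless it passes through a common one, and a path through a common
      -- fixed point remains one.
      iterate : ∀ n → State (Spread n)
      iterate zero = record
        { p = h true ; q = h false ; P = E ; Q = E ; v = []
        ; p-agree = λ _ _ → refl ; q-agree = λ _ _ → refl
        ; E⊆P = λ e → e ; E⊆Q = λ e → e ; p-fixed = λ e _ → e ; q-fixed = λ e _ → e
        ; det = λ _ _ _ → refl ; high = high₀ ; far = λ _ _ → inj₂ M.nonNegative }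
      iterate (suc n) = step S (next S 0) far′
        where
        S : State (Spread n)
        S = iterate n
        far′ : ∀ {y u} → y ∈ ys → u ∈ E → Spread (suc n) y (Next.new (next S 0) y) u
        far′ {y} {u} y∈ u∈ with improve S (next S 0) y∈ (Next.E⊆X (next S 0) u∈)
        ... | x , x∈ , keep , inj₁ rem = inj₁ rem
        ... | x , x∈ , keep , inj₂ (x′ , x′∈ , x≢x′ , le) with State.far S y∈ x∈
        ...   | inj₁ rem = inj₁ (keep rem)
        ...   | inj₂ far = inj₂ (ℚₚ.≤-trans (ℚₚ.≤-reflexive (ℚₚ.+-comm δ (n ⊛ δ)))
                  (ℚₚ.≤-trans (ℚₚ.+-mono-≤ far (gap x∈ x′∈ x≢x′)) le))

    opaque
      -- The units of `iterate` make the images remote from `E`. The last unit, the only one of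
      -- prescribed length, spreads this to the larger set `X`, because its path to any point of `X`
      -- runs through `E`.
      escapeAll : (∀ {y x} → y ∈ ys → x ∈ E → y ≼ x → Sep Common y x) → ∀ k →
        Σ[ S ∈ State Remote ] Σ[ N ∈ Next S k ] (∀ {y u} → y ∈ ys → u ∈ Next.X N → Remote y (Next.new N y) u)
      escapeAll high₀ k =
        let δ , 0<δ , gap = separation E E
            K , _ , bound = upperBound (λ y x → d y c₀ ⊕ d c₀ x) ys E
            n , K≤ = archimedean K δ 0<δ
            S′ = iterate 0<δ gap high₀ n
            S = record { State S′ ; far = λ {y} {u} y∈ u∈ → case-far (bound y∈ u∈) K≤ (State.far S′ y∈ u∈) }
            N = next S k
        in S , N , λ y∈ u∈ → let x , x∈ , keep , _ = improve S N y∈ u∈ in keep (State.far S y∈ x∈)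
        where
        case-far : ∀ {y y′ u K a} → d y c₀ ⊕ d c₀ u ≤ℚ K → K ≤ℚ a → Remote y y′ u ⊎ a ≤ℚ d y′ u → Remote y y′ u
        case-far le₁ le₂ (inj₁ r) = r
        case-far le₁ le₂ (inj₂ le₃) = c₀ , (c₀∈ , hc₀) , ℚₚ.≤-trans le₁ (ℚₚ.≤-trans le₂ le₃)

    module Settle (S : State Remote) {k : ℕ} (N : Next S k)
                  (rem : ∀ {y u} → y ∈ ys → u ∈ Next.X N → Remote y (Next.new N y) u) where
      private
        module S = State S
        module N = Next N
      ps : List (Carrier × Carrier)
      ps = map (λ x → x , to N.q x) N.Q ++ map (λ y → N.new y , N.new y) ys

      N-Common : ∀ {c} → Common c → to N.q c ≡ c
      N-Common Cc = trans (N.q-agree _ (S.E⊆Q (proj₁ Cc))) (S.q-Common Cc)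

      new-Common : ∀ {y c} → Common c → d (N.new y) c ≡ d y c
      new-Common {y} {c} Cc = trans (cong (d (N.new y)) (sym fix))
        (trans (to-isometric (pow N.p N.m₂) _ _) (trans (to-isometric (pow N.q N.m₁) _ _)
          (to-isometric (word (pair S.p S.q) (pos S.v)) y c)))
        where
        fix : N.p ^ N.m₂ · N.q ^ N.m₁ · S.cur c ≡ c
        fix = trans (cong (λ x → N.p ^ N.m₂ · N.q ^ N.m₁ · x) (S.cur-Common Cc))
              (trans (cong (N.p ^ N.m₂ ·_) (pow-fix N.q N.m₁ (N-Common Cc)))
                (pow-fix N.p N.m₂ (trans (N.p-agree _ (S.E⊆P (proj₁ Cc))) (S.p-Common Cc))))

      -- Both distances equal the minimum of d y c + d c x over the common
      -- fixed points c.
      dist : ∀ {y x x′} → y ∈ ys → x ∈ N.X → x′ ∈ N.X → (∀ {c} → Common c → d c x ≡ d c x′) → d (N.new y) x ≤ℚ d (N.new y) x′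
      dist {y} {x} {x′} y∈ x∈ x′∈ same with rem y∈ x′∈
      ... | c , Cc , le = begin
        d (N.new y) x             ≤⟨ M.triangle _ c _ ⟩
        d (N.new y) c ⊕ d c x     ≡⟨ cong₂ _⊕_ (new-Common Cc) (same Cc) ⟩
        d y c ⊕ d c x′            ≤⟨ le ⟩
        d (N.new y) x′            ∎
        where open ℚₚ.≤-Reasoning

      q-same : ∀ {x c} → Common c → d c (to N.q x) ≡ d c x
      q-same {x} {c} Cc = trans (cong (λ z → d z (to N.q x)) (sym (N-Common Cc))) (to-isometric N.q c x)

      dist-q : ∀ {y x} → y ∈ ys → x ∈ N.Q → d (N.new y) (to N.q x) ≡ d (N.new y) x
      dist-q y∈ x∈ = ℚₚ.≤-antisym (dist y∈ (N.qQ⊆X x∈) (N.Q⊆X x∈) q-same)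
                                   (dist y∈ (N.Q⊆X x∈) (N.qQ⊆X x∈) (λ Cc → sym (q-same Cc)))

      new≼q : ∀ {y x} → y ∈ ys → x ∈ N.Q → N.new y ≼ x → N.new y ≼ to N.q x
      new≼q y∈ x∈ le with c , Cc , y≼c , c≼x ← N.order y∈ (N.Q⊆X x∈) le =
        ≼-trans y≼c (subst (_≼ to N.q _) (N-Common Cc) (to-≼ N.q c≼x))

      new≼q⁻ : ∀ {y x} → y ∈ ys → x ∈ N.Q → N.new y ≼ to N.q x → N.new y ≼ x
      new≼q⁻ y∈ x∈ le with c , Cc , y≼c , c≼x ← N.order y∈ (N.qQ⊆X x∈) le =
        ≼-trans y≼c (to-≼⁻ N.q (subst (_≼ to N.q _) (sym (N-Common Cc)) c≼x))

      -- The order argument gives only a weak inequality. Equality would put the image at distance 0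
      -- from `to N.q x`, hence from `x`.
      strict : ∀ {y x} → y ∈ ys → x ∈ N.Q → N.new y < x → N.new y < to N.q x
      strict y∈ x∈ lt with new≼q y∈ x∈ (inj₁ lt)
      ... | inj₁ lt′ = lt′
      ... | inj₂ eq = contradiction lt (O.irrefl
            (d≤0⇒≡ (ℚₚ.≤-reflexive (trans (sym (dist-q y∈ x∈)) (trans (cong (d _) (sym eq)) dxx≡0)))))

      iso : ∀ {a b} → a ∈ ps → b ∈ ps → d (proj₂ a) (proj₂ b) ≡ d (proj₁ a) (proj₁ b)
      iso a∈ b∈ with ∈-++⁻ (map _ N.Q) a∈ | ∈-++⁻ (map _ N.Q) b∈
      ... | inj₁ a | inj₁ b with _ , _ , refl ← ∈-map⁻ _ a | _ , _ , refl ← ∈-map⁻ _ b = to-isometric N.q _ _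
      ... | inj₁ a | inj₂ b with _ , x∈ , refl ← ∈-map⁻ _ a | _ , y∈ , refl ← ∈-map⁻ _ b =
            trans (M.sym _ _) (trans (dist-q y∈ x∈) (M.sym _ _))
      ... | inj₂ a | inj₁ b with _ , y∈ , refl ← ∈-map⁻ _ a | _ , x∈ , refl ← ∈-map⁻ _ b = dist-q y∈ x∈
      ... | inj₂ a | inj₂ b with _ , _ , refl ← ∈-map⁻ _ a | _ , _ , refl ← ∈-map⁻ _ b = refl

      mono : ∀ {a b} → a ∈ ps → b ∈ ps → proj₁ a < proj₁ b → proj₂ a < proj₂ b
      mono a∈ b∈ lt with ∈-++⁻ (map _ N.Q) a∈ | ∈-++⁻ (map _ N.Q) b∈
      ... | inj₁ a | inj₁ b with _ , _ , refl ← ∈-map⁻ _ a | _ , _ , refl ← ∈-map⁻ _ b = to-< N.q lt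
      ... | inj₁ a | inj₂ b with _ , x∈ , refl ← ∈-map⁻ _ a | _ , y∈ , refl ← ∈-map⁻ _ b =
            ⋠⇒> (λ le → <⇒⋡ lt (new≼q⁻ y∈ x∈ le))
      ... | inj₂ a | inj₁ b with _ , y∈ , refl ← ∈-map⁻ _ a | _ , x∈ , refl ← ∈-map⁻ _ b = strict y∈ x∈ lt
      ... | inj₂ a | inj₂ b with _ , _ , refl ← ∈-map⁻ _ a | _ , _ , refl ← ∈-map⁻ _ b = lt

      ext : Σ[ g ∈ Automorphism QU ] (∀ {a} → a ∈ ps → to g (proj₁ a) ≡ proj₂ a)
      ext = extend ps iso mono
      q′ : Automorphism QU
      q′ = proj₁ ext
      q′-eq : ∀ {a} → a ∈ ps → to q′ (proj₁ a) ≡ proj₂ a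
      q′-eq = proj₂ ext
      q~q′ : Agree N.Q N.q q′
      q~q′ x x∈ = q′-eq (∈-++⁺ˡ (∈-map⁺ _ x∈))

      settled : Σ[ h′ ∈ Pair ] ∃[ v ] ∃[ m₁ ] ∃[ m₂ ] (∀ b → Agree E (h b) (h′ b)) × k ≤ m₁ × k ≤ m₂ ×
        (∀ {y} → y ∈ ys → let y′ = run h′ (pos (v ++ replicate m₁ false ++ replicate m₂ true)) y in to (h′ false) y′ ≡ y′)
      settled = pair N.p q′ , S.v , N.m₁ , N.m₂
        , (λ { true → agree-extend (h true) S.p N.p S.E⊆P S.p-agree N.p-agree
               ; false → agree-extend (h false) N.q q′ (λ e → N.Q⊆ (S.E⊆Q e)) (agree-extend (h false) S.q N.q S.E⊆Q S.q-agree N.q-agree) q~q′ })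
        , N.k≤m₁ , N.k≤m₂
        , λ y∈ → subst (λ z → to q′ z ≡ z) (sym (N.det (λ _ _ → refl) q~q′ y∈)) (q′-eq (∈-++⁺ʳ (map _ N.Q) (∈-map⁺ _ y∈)))

    opaque
      settle : (∀ {y x} → y ∈ ys → x ∈ E → y ≼ x → Sep Common y x) → ∀ k →
        Σ[ h′ ∈ Pair ] ∃[ v ] ∃[ m₁ ] ∃[ m₂ ] (∀ b → Agree E (h b) (h′ b)) × k ≤ m₁ × k ≤ m₂ ×
        (∀ {y} → y ∈ ys → let y′ = run h′ (pos (v ++ replicate m₁ false ++ replicate m₂ true)) y in to (h′ false) y′ ≡ y′)
      settle high₀ k = let S , N , rem = escapeAll high₀ k in Settle.settled S N rem

  byContra : ∀ {P : Set} → ¬ ¬ P → P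
  byContra {P} ¬¬p with em {P = P}
  ... | yes p = p
  ... | no ¬p = contradiction ¬p ¬¬p

  least : (P : Carrier → Set) (xs : List Carrier) →
          (∃[ m ] m ∈ xs × P m × (∀ {w} → w ∈ xs → P w → m ≼ w)) ⊎ (∀ {w} → w ∈ xs → ¬ P w)
  least P [] = inj₂ λ ()
  least P (x ∷ xs) with least P xs | em {P = P x}
  ... | inj₂ none | no ¬p = inj₂ λ { (here refl) → ¬p ; (there w∈) → none w∈ }
  ... | inj₂ none | yes p = inj₁ (x , here refl , p , λ { (here refl) _ → ≼-refl ; (there w∈) q → contradiction q (none w∈) })
  ... | inj₁ (m , m∈ , pm , min) | no ¬p =
        inj₁ (m , there m∈ , pm , λ { (here refl) q → contradiction q ¬p ; (there w∈) q → min w∈ q })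
  ... | inj₁ (m , m∈ , pm , min) | yes p with m ≼⊎≻ x
  ...   | inj₁ m≼x = inj₁ (m , there m∈ , pm , λ { (here refl) _ → m≼x ; (there w∈) q → min w∈ q })
  ...   | inj₂ x<m = inj₁ (x , here refl , p , λ { (here refl) _ → ≼-refl ; (there w∈) q → inj₁ (<-≼-trans x<m (min w∈ q)) })

  AgreeP : List Carrier → Pair → Pair → Set
  AgreeP F h h′ = ∀ b → Agree F (h b) (h′ b)

  -- Lifting the lowest points of the gaps

  module Pushing (g : Pair) (A : List Carrier) {c₀ : Carrier} (c₀∈ : c₀ ∈ A) where

    C : Carrier → Set
    C c = c ∈ A × (∀ b → to (g b) c ≡ c)

    record Config : Set where
      field
        h     : Pair
        D     : Bool → List Carrier
        A⊆D   : ∀ b → A ⊆ D b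
        agree : AgreeP A g h
        -- Since extensions create no fixed points outside `A`, a point at which both generators
        -- turn out to be stuck belongs to `C`.
        fixed : ∀ b {v} → v ∈ D b → to (h b) v ≡ v → v ∈ A

      h-C : ∀ {c} → C c → ∀ b → to (h b) c ≡ c
      h-C (c∈ , fix) b = trans (agree b _ c∈) (fix b)

      Dom : Letter → Carrier → Set
      Dom (b , true)  v = v ∈ D b
      Dom (b , false) v = from (h b) v ∈ D b

      points : List Carrier
      points = (D true ++ D false) ++ (map (to (h true)) (D true) ++ map (to (h false)) (D false))

      Dom⊆points : ∀ t {v} → Dom t v → v ∈ points
      Dom⊆points (true  , true)  v∈ = ∈-++⁺ˡ (∈-++⁺ˡ v∈)
      Dom⊆points (false , true)  v∈ = ∈-++⁺ˡ (∈-++⁺ʳ (D true) v∈)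
      Dom⊆points (true  , false) v∈ = ∈-++⁺ʳ (D true ++ D false)
        (∈-++⁺ˡ (subst (_∈ map (to (h true)) (D true)) (to-from (h true) _) (∈-map⁺ _ v∈)))
      Dom⊆points (false , false) v∈ = ∈-++⁺ʳ (D true ++ D false) (∈-++⁺ʳ (map (to (h true)) (D true))
        (subst (_∈ map (to (h false)) (D false)) (to-from (h false) _) (∈-map⁺ _ v∈)))

    open Config

    Extends : Config → Config → Set
    Extends c c′ = (∀ b → D c b ⊆ D c′ b) × (∀ b → Agree (D c b) (h c b) (h c′ b))

    set : ∀ {X : Set} → Bool → X → (Bool → X) → Bool → X
    set true  x f true  = x
    set true  x f false = f false
    set false x f true  = f true
    set false x f false = x

    replace : ∀ c b s L → Agree (D c b) (h c b) s → D c b ⊆ L → (∀ {v} → v ∈ L → to s v ≡ v → v ∈ A) →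
      Σ[ c′ ∈ Config ] Extends c c′ × h c′ b ≡ s × D c′ b ≡ L ×
        (∀ b′ → b′ ≢ b → h c′ b′ ≡ h c b′ × D c′ b′ ≡ D c b′)
    replace c true s L ag sub fx =
      record { h = set true s (h c) ; D = set true L (D c)
             ; A⊆D = λ { true x∈ → sub (A⊆D c true x∈) ; false → A⊆D c false }
             ; agree = λ { true → agree-extend (g true) (h c true) s (A⊆D c true) (agree c true) ag
                         ; false → agree c false }
             ; fixed = λ { true → fx ; false → fixed c false } }
      , ((λ { true → sub ; false x∈ → x∈ }) , (λ { true → ag ; false _ _ → refl }))
      , refl , refl , λ { true ne → contradiction refl ne ; false _ → refl , refl }
    replace c false s L ag sub fx =
      record { h = set false s (h c) ; D = set false L (D c)
             ; A⊆D = λ { false x∈ → sub (A⊆D c false x∈) ; true → A⊆D c true }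
             ; agree = λ { false → agree-extend (g false) (h c false) s (A⊆D c false) (agree c false) ag
                         ; true → agree c true }
             ; fixed = λ { false → fx ; true → fixed c true } }
      , ((λ { false → sub ; true x∈ → x∈ }) , (λ { false → ag ; true _ _ → refl }))
      , refl , refl , λ { false ne → contradiction refl ne ; true _ → refl , refl }

    record Step (c : Config) (t : Letter) (Y U : List Carrier) : Set where
      field
        c′      : Config
        ext     : Extends c c′
        defined : ∀ {y} → y ∈ Y → Dom c′ t y
        free    : ∀ {y u} → y ∈ Y → u ∈ U → to (act (h c′) t) y ≼ u →
                  ∃[ v ] Dom c t v × y ≼ v × to (act (h c) t) v ≼ u
        domain  : ∀ t′ {v} → Dom c′ t′ v → Dom c t′ v ⊎ (t′ ≡ t × v ∈ Y) ⊎
                  (t′ ≡ inv t × ∃[ y ] y ∈ Y × v ≡ to (act (h c′) t) y)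

    Dom-other : ∀ {c c′ b} → (∀ b′ → b′ ≢ b → h c′ b′ ≡ h c b′ × D c′ b′ ≡ D c b′) →
                ∀ b′ s {v} → b′ ≢ b → Dom c′ (b′ , s) v → Dom c (b′ , s) v
    Dom-other other b′ true  {v} ne = subst (v ∈_) (proj₂ (other b′ ne))
    Dom-other other b′ false {v} ne v∈ =
      subst₂ (λ f L → from f v ∈ L) (proj₁ (other b′ ne)) (proj₂ (other b′ ne)) v∈

    opaque
      backStep : ∀ f D Y U {c} → c ∈ D → Σ[ k ∈ Automorphism QU ] Agree D f k ×
        (∀ {y u} → y ∈ Y → u ∈ U → from k y ≼ u → ∃[ v ] from f v ∈ D × y ≼ v × from f v ≼ u) ×
        (∀ {y} → y ∈ Y → y ∈ U → from k y ≡ y → y ∈ D)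
      backStep f D Y U c∈ with freeStep (f ⁻¹) (map (to f) D) Y U (∈-map⁺ _ c∈)
      ... | s , ag , free = s ⁻¹ , agr , (λ y∈ u∈ le → ord (proj₂ (free y∈ u∈) le)) , fx
        where
        agr : Agree D f (s ⁻¹)
        agr x x∈ = trans (cong (from s) (sym (trans (ag _ (∈-map⁺ _ x∈)) (from-to f x)))) (from-to s _)
        ord : ∀ {y u} → ∃[ v ] v ∈ map (to f) D × y ≼ v × from f v ≼ u → ∃[ v ] from f v ∈ D × y ≼ v × from f v ≼ u
        ord (v , v∈ , p , q) with x , x∈ , refl ← ∈-map⁻ (to f) v∈ = v , subst (_∈ D) (sym (from-to f x)) x∈ , p , q
        fx : ∀ {y} → y ∈ Y → y ∈ U → to s y ≡ y → y ∈ D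
        fx y∈ y∈U eq with ∈-map⁻ (to f) (free-fixed {f ⁻¹} (free y∈ y∈U) eq)
        ... | x , x∈ , refl = subst (_∈ D) (trans (sym (trans (ag _ (∈-map⁺ _ x∈)) (from-to f x))) eq) x∈

      letterStep : ∀ c t Y U → Step c t Y U
      letterStep c (b , true) Y U with freeStep (h c b) (D c b) Y (Y ++ U) (A⊆D c b c₀∈)
      ... | s , ag , free with replace c b s (Y ++ D c b) ag (∈-++⁺ʳ Y) fx
        where
        fx : ∀ {v} → v ∈ Y ++ D c b → to s v ≡ v → v ∈ A
        fx v∈ eq with ∈-++⁻ Y v∈
        ... | inj₂ v∈D = fixed c b v∈D (trans (sym (ag _ v∈D)) eq)
        ... | inj₁ v∈Y = let v∈D = free-fixed {h c b} (free v∈Y (∈-++⁺ˡ v∈Y)) eq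
                         in fixed c b v∈D (trans (sym (ag _ v∈D)) eq)
      ...   | c′ , ext , refl , D≡ , other = record
        { c′ = c′ ; ext = ext
        ; defined = λ y∈ → subst (_ ∈_) (sym D≡) (∈-++⁺ˡ y∈)
        ; free = λ y∈ u∈ → proj₂ (free y∈ (∈-++⁺ʳ Y u∈))
        ; domain = dom }
        where
        dom : ∀ t′ {v} → Dom c′ t′ v → Dom c t′ v ⊎ (t′ ≡ (b , true) × v ∈ Y) ⊎
                  (t′ ≡ (b , false) × ∃[ y ] y ∈ Y × v ≡ to (h c′ b) y)
        dom (b′ , s′) v∈ with b′ Boolₚ.≟ b
        ... | no ne = inj₁ (Dom-other {c} {c′} other b′ s′ ne v∈)
        dom (b , true) {v} v∈ | yes refl with ∈-++⁻ Y (subst (v ∈_) D≡ v∈)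
        ... | inj₁ v∈Y = inj₂ (inj₁ (refl , v∈Y))
        ... | inj₂ v∈D = inj₁ v∈D
        dom (b , false) {v} v∈ | yes refl with ∈-++⁻ Y (subst (from (h c′ b) v ∈_) D≡ v∈)
        ... | inj₁ w∈Y = inj₂ (inj₂ (refl , from (h c′ b) v , w∈Y , sym (to-from (h c′ b) v)))
        ... | inj₂ w∈D = inj₁ (subst (_∈ D c b) (sym (trans (cong (from (h c b)) v≡) (from-to (h c b) _))) w∈D)
          where
          v≡ : v ≡ to (h c b) (from (h c′ b) v)
          v≡ = trans (sym (to-from (h c′ b) v)) (ag _ w∈D)
      letterStep c (b , false) Y U with backStep (h c b) (D c b) Y (Y ++ U) (A⊆D c b c₀∈)
      ... | s , ag , free , fixY with replace c b s (map (from s) Y ++ D c b) ag (∈-++⁺ʳ (map (from s) Y)) fx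
        where
        fx : ∀ {v} → v ∈ map (from s) Y ++ D c b → to s v ≡ v → v ∈ A
        fx v∈ eq with ∈-++⁻ (map (from s) Y) v∈
        ... | inj₂ v∈D = fixed c b v∈D (trans (sym (ag _ v∈D)) eq)
        ... | inj₁ v∈Y with y , y∈ , refl ← ∈-map⁻ (from s) v∈Y =
              fixed c b y′∈D (trans (sym (ag _ y′∈D)) eq)
          where
          y′≡y : from s y ≡ y
          y′≡y = trans (sym eq) (to-from s y)
          y′∈D : from s y ∈ D c b
          y′∈D = subst (_∈ D c b) (sym y′≡y) (fixY y∈ (∈-++⁺ˡ y∈) y′≡y)
      ...   | c′ , ext , refl , D≡ , other = record
        { c′ = c′ ; ext = ext
        ; defined = λ y∈ → subst (_ ∈_) (sym D≡) (∈-++⁺ˡ (∈-map⁺ (from (h c′ b)) y∈))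
        ; free = λ y∈ u∈ → free y∈ (∈-++⁺ʳ Y u∈)
        ; domain = dom }
        where
        s′ : Automorphism QU
        s′ = h c′ b
        dom : ∀ t′ {v} → Dom c′ t′ v → Dom c t′ v ⊎ (t′ ≡ (b , false) × v ∈ Y) ⊎
                  (t′ ≡ (b , true) × ∃[ y ] y ∈ Y × v ≡ from (h c′ b) y)
        dom (b′ , t) v∈ with b′ Boolₚ.≟ b
        ... | no ne = inj₁ (Dom-other {c} {c′} other b′ t ne v∈)
        dom (b , true) {v} v∈ | yes refl with ∈-++⁻ (map (from s′) Y) (subst (v ∈_) D≡ v∈)
        ... | inj₁ v∈Y = inj₂ (inj₂ (refl , ∈-map⁻ (from s′) v∈Y))
        ... | inj₂ v∈D = inj₁ v∈D
        dom (b , false) {v} v∈ | yes refl with ∈-++⁻ (map (from s′) Y) (subst (from s′ v ∈_) D≡ v∈)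
        ... | inj₁ w∈Y with y , y∈ , eq ← ∈-map⁻ (from s′) w∈Y =
              inj₂ (inj₁ (refl , subst (_∈ Y) (to-injective (s′ ⁻¹) (sym eq)) y∈))
        ... | inj₂ w∈D = inj₁ (subst (_∈ D c b) (sym (trans (cong (from (h c b)) v≡) (from-to (h c b) _))) w∈D)
          where
          v≡ : v ≡ to (h c b) (from s′ v)
          v≡ = trans (sym (to-from s′ v)) (ag _ w∈D)

    module Tracked (ys : List Carrier) (ys⊆A : ys ⊆ A)
                   (separated : ∀ {y y′} → y ∈ ys → y′ ∈ ys → y ≡ y′ ⊎ Sep C y y′ ⊎ Sep C y′ y) where

      record State : Set where
        field
          c   : Config
          r   : Word
          ℓ   : Letter
          det : ∀ {h′} → (∀ b → Agree (D c b) (h c b) (h′ b)) → ∀ {y} → y ∈ ys → run h′ r y ≡ run (h c) r y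

        at : Carrier → Carrier
        at = run (h c) r

        -- W lists the prescribed points above y that have yet to be passed. The
        -- last alternative is the inverse of the letter just applied.
        Inv : List Carrier → Carrier → Set
        Inv W y = ∀ t {v} → Dom c t v → at y ≼ v → v ∈ W ⊎ Sep C (at y) v ⊎ (v ≡ at y × t ≡ inv ℓ)

        Good : Carrier → Set
        Good = Inv []

      open State

      -- Distinct tracked points lie in different gaps of `C`, and no word leaves a gap, so what is
      -- prescribed on account of one never obstructs another. In the last case the inequality
      -- collapses both images to `c`.
      cross : ∀ (k k′ : Automorphism QU) → (∀ {c} → C c → to k c ≡ c) → (∀ {c} → C c → to k′ c ≡ c) →
        ∀ {y y′} → y ∈ ys → y′ ∈ ys → to k y ≼ to k′ y′ → y ≡ y′ ⊎ Sep C (to k y) (to k′ y′)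
      cross k k′ fix fix′ y∈ y′∈ le with separated y∈ y′∈
      ... | inj₁ eq = inj₁ eq
      ... | inj₂ (inj₁ (c , Cc , y≼c , c≼y′)) = inj₂ (c , Cc , subst (to k _ ≼_) (fix Cc) (to-≼ k y≼c) ,
          subst (_≼ to k′ _) (fix′ Cc) (to-≼ k′ c≼y′))
      ... | inj₂ (inj₂ (c , Cc , y′≼c , c≼y)) = inj₂ (c , Cc , ≼-trans le (subst (to k′ _ ≼_) (fix′ Cc) (to-≼ k′ y′≼c))
                                                        , ≼-trans (subst (_≼ to k _) (fix Cc) (to-≼ k c≼y)) le)

      at-C : ∀ S r′ {c′} → C c′ → run (h (c S)) r′ c′ ≡ c′
      at-C S r′ Cc = run-fix (h (c S)) (h-C (c S) Cc) r′

      act-C : ∀ S t {c′} → C c′ → to (act (h (c S)) t) c′ ≡ c′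
      act-C S t Cc = act-fix (h (c S)) (h-C (c S) Cc) t

      record Advance (S : State) (t : Letter) (U : List Carrier) : Set where
        field
          S′      : State
          ext     : Extends (c S) (c S′)
          last    : ℓ S′ ≡ t
          moved   : ∀ {y} → y ∈ ys → at S′ y ≡ to (act (h (c S′)) t) (at S y)
          free    : ∀ {y u} → y ∈ ys → u ∈ U ⊎ u ∈ points (c S) ⊎ u ∈ map (at S) ys → at S′ y ≼ u →
                    ∃[ v ] Dom (c S) t v × at S y ≼ v × to (act (h (c S)) t) v ≼ u
          domain  : ∀ {y} → y ∈ ys → ∀ t′ {v} → Dom (c S′) t′ v → at S′ y ≼ v →
                    Dom (c S) t′ v ⊎ (t′ ≡ t × v ≡ at S y) ⊎ (t′ ≡ inv t × v ≡ at S′ y) ⊎ Sep C (at S′ y) v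

      act-ext : ∀ {c c′} → Extends c c′ → ∀ t {v} → Dom c t v → to (act (h c′) t) v ≡ to (act (h c) t) v
      act-ext {c} {c′} (_ , ag) (b , true)  v∈ = ag b _ v∈
      act-ext {c} {c′} (_ , ag) (b , false) {v} v∈ =
        trans (cong (from (h c′ b)) (sym (trans (ag b _ v∈) (to-from (h c b) v)))) (from-to (h c′ b) _)

      opaque
        advance : ∀ S t U → Advance S t U
        advance S t U = record
          { S′ = S′ ; ext = E.ext ; last = refl ; moved = moved
          ; free = λ {y} {u} y∈ u∈ le → E.free (∈-map⁺ _ y∈) (inU u∈) (subst (_≼ u) (moved y∈) le)
          ; domain = dom }
          where
          Y U′ : List Carrier
          Y  = map (at S) ys
          U′ = U ++ points (c S) ++ Y
          module E = Step (letterStep (c S) t Y U′)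
          h′ : Pair
          h′ = h E.c′
          run-step : ∀ h″ x → run h″ (r S ++ [ t ]) x ≡ to (act h″ t) (run h″ (r S) x)
          run-step h″ x = run-++ h″ (r S) [ t ] x
          same : ∀ {y} → y ∈ ys → run h′ (r S) y ≡ at S y
          same = det S (proj₂ E.ext)
          S′ : State
          S′ = record
            { c = E.c′ ; r = r S ++ [ t ] ; ℓ = t
            ; det = λ {h″} ag {y} y∈ → trans (run-step h″ y) (trans
                (trans (cong (to (act h″ t)) (det S (λ b → agree-extend (h (c S) b) (h′ b) (h″ b) (proj₁ E.ext b) (proj₂ E.ext b) (ag b)) y∈))
                  (actAg h″ ag t (E.defined (∈-map⁺ (at S) y∈))))
                (sym (trans (run-step h′ y) (cong (to (act h′ t)) (same y∈))))) }
            where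
            actAg : ∀ h″ → (∀ b → Agree (D E.c′ b) (h′ b) (h″ b)) → ∀ t {v} → Dom E.c′ t v → to (act h″ t) v ≡ to (act h′ t) v
            actAg h″ ag (b , true)  v∈ = ag b _ v∈
            actAg h″ ag (b , false) {v} v∈ =
              trans (cong (from (h″ b)) (sym (trans (ag b _ v∈) (to-from (h′ b) v)))) (from-to (h″ b) _)
          moved : ∀ {y} → y ∈ ys → at S′ y ≡ to (act h′ t) (at S y)
          moved {y} y∈ = trans (run-step h′ y) (cong (to (act h′ t)) (same y∈))
          inU : ∀ {u} → u ∈ U ⊎ u ∈ points (c S) ⊎ u ∈ Y → u ∈ U′
          inU (inj₁ u∈)        = ∈-++⁺ˡ u∈
          inU (inj₂ (inj₁ u∈)) = ∈-++⁺ʳ U (∈-++⁺ˡ u∈)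
          inU (inj₂ (inj₂ u∈)) = ∈-++⁺ʳ U (∈-++⁺ʳ (points (c S)) u∈)
          dom : ∀ {y} → y ∈ ys → ∀ t′ {v} → Dom E.c′ t′ v → at S′ y ≼ v →
                Dom (c S) t′ v ⊎ (t′ ≡ t × v ≡ at S y) ⊎ (t′ ≡ inv t × v ≡ at S′ y) ⊎ Sep C (at S′ y) v
          dom y∈ t′ v∈ le with E.domain t′ v∈
          ... | inj₁ old = inj₁ old
          ... | inj₂ (inj₁ (eq , v∈Y)) with y₂ , y₂∈ , refl ← ∈-map⁻ (at S) v∈Y
                with cross (word h′ (r S ++ [ t ])) (word (h (c S)) (r S)) (at-C S′ (r S′)) (at-C S (r S)) y∈ y₂∈ le
          ...     | inj₁ refl = inj₂ (inj₁ (eq , refl))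
          ...     | inj₂ sep  = inj₂ (inj₂ (inj₂ sep))
          dom y∈ t′ v∈ le | inj₂ (inj₂ (eq , _ , z∈ , refl)) with y₂ , y₂∈ , refl ← ∈-map⁻ (at S) z∈
                with cross (word h′ (r S ++ [ t ])) (word h′ (r S ++ [ t ])) (at-C S′ (r S′)) (at-C S′ (r S′))
                     y∈ y₂∈ (subst (at S′ _ ≼_) (sym (moved y₂∈)) le)
          ...     | inj₁ refl = inj₂ (inj₂ (inj₁ (eq , sym (moved y₂∈))))
          ...     | inj₂ sep  = inj₂ (inj₂ (inj₂ (subst (Sep C _) (moved y₂∈) sep)))

      module AfterAdvance {S : State} {t : Letter} {U : List Carrier} (adv : Advance S t U) where
        open Advance adv public

        at-≡ : ∀ {v} → Dom (c S) t v → to (act (h (c S′)) t) v ≡ to (act (h (c S)) t) v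
        at-≡ = act-ext {c S} {c S′} ext t

        sep-next : ∀ {y u} → y ∈ ys → Sep C (at S y) u → Sep C (at S′ y) u
        sep-next {y} y∈ (c′ , Cc , z≼c , c≼u) = c′ , Cc ,
          subst₂ _≼_ (sym (moved y∈)) (act-C S′ t Cc) (to-≼ (act (h (c S′)) t) z≼c) , c≼u

        sep-prev : ∀ {y u} → y ∈ ys → Sep C (at S′ y) u → Sep C (at S y) u
        sep-prev {y} y∈ (c′ , Cc , z≼c , c≼u) = c′ , Cc ,
          to-≼⁻ (act (h (c S′)) t) (subst₂ _≼_ (moved y∈) (sym (act-C S′ t Cc)) z≼c) , c≼u

        sep-via : ∀ {y u v} → Sep C (at S y) v → to (act (h (c S)) t) v ≼ u → Sep C (at S y) u
        sep-via (c′ , Cc , z≼c , c≼v) le = c′ , Cc , z≼c ,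
          ≼-trans (subst (_≼ to (act (h (c S)) t) _) (act-C S t Cc) (to-≼ (act (h (c S)) t) c≼v)) le

        -- A good point jumps above everything in its gap.
        good-jump : t ≢ inv (ℓ S) → ∀ {y u} → y ∈ ys → Good S y →
                    u ∈ U ⊎ u ∈ points (c S) ⊎ u ∈ map (at S) ys → at S′ y ≼ u → Sep C (at S y) u
        good-jump t≢ {y} {u} y∈ good u∈ le with free y∈ u∈ le
        ... | v , v∈ , z≼v , tv≼u with good t v∈ z≼v
        ...   | inj₂ (inj₁ sep)      = sep-via {y} sep tv≼u
        ...   | inj₂ (inj₂ (_ , eq)) = contradiction eq t≢

        good-next : t ≢ inv (ℓ S) → ∀ {y} → y ∈ ys → Good S y → Good S′ y
        good-next t≢ {y} y∈ good t′ {v} v∈ z′≼v with domain y∈ t′ v∈ z′≼v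
        ... | inj₁ old = inj₂ (inj₁ (sep-next y∈ (good-jump t≢ y∈ good (inj₂ (inj₁ (Dom⊆points (c S) t′ old))) z′≼v)))
        ... | inj₂ (inj₁ (_ , refl)) = inj₂ (inj₁ (sep-next y∈ (good-jump t≢ y∈ good (inj₂ (inj₂ (∈-map⁺ _ y∈))) z′≼v)))
        ... | inj₂ (inj₂ (inj₁ (eq , refl))) = inj₂ (inj₂ (refl , trans eq (cong inv (sym last))))
        ... | inj₂ (inj₂ (inj₂ sep)) = inj₂ (inj₁ sep)

      -- No extension of the letter t can move a point just below M past M.
      Blocked : State → Carrier → Letter → Set
      Blocked S M t = ∃[ v ] Dom (c S) t v × M ≼ v × to (act (h (c S)) t) v ≼ M

      -- Monotonicity gives M ≼ w ≼ f v ≼ M: the witness for the inverse letter satisfies f⁻¹ w ≼ M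
      -- ≼ v. So all these points coincide.
      stuck : ∀ S M b → Blocked S M (b , true) → Blocked S M (b , false) → M ∈ D (c S) b × to (h (c S) b) M ≡ M
      stuck S M b (v , v∈ , M≼v , hv≼M) (w , w∈ , M≼w , w′≼M) =
        subst (_∈ D (c S) b) v≡M v∈ , trans (cong (to f) (sym v≡M)) fv≡M
        where
        f : Automorphism QU
        f = h (c S) b
        w≼fv : w ≼ to f v
        w≼fv = subst (_≼ to f v) (to-from f w) (to-≼ f (≼-trans w′≼M M≼v))
        fv≡M : to f v ≡ M
        fv≡M = ≼-antisym hv≼M (≼-trans M≼w w≼fv)
        w≡M : w ≡ M
        w≡M = ≼-antisym (≼-trans w≼fv hv≼M) M≼w
        v≡M : v ≡ M
        v≡M = ≼-antisym (subst (_≼ M) (trans (cong (from f) (trans w≡M (sym fv≡M))) (from-to f v)) w′≼M) M≼v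

      module _ {y : Carrier} (y∈ : y ∈ ys) where

        NextAbove : State → List Carrier → Carrier → Set
        NextAbove S W M = M ∈ W × at S y ≼ M × (∀ {w} → w ∈ W → at S y ≼ w → M ≼ w) × ¬ Sep C (at S y) M

        Preserving : State → State → Set
        Preserving S S′ = ∀ {y′} → y′ ∈ ys → Good S y′ → Good S′ y′

        Shorter : State → List Carrier → Set
        Shorter S W = Σ[ S′ ∈ State ] ∃[ W′ ] length W′ ℕ.< length W × Inv S′ W′ y × Preserving S S′

        -- No prescribed value of an unblocked letter holds the image below `M`, so it jumps past
        -- `M`, and `W` loses at least this point. The inverse of the last letter is excluded
        -- because its value at the current point is prescribed.
        pass : ∀ S W M → Inv S W y → NextAbove S W M → ∀ t → t ≢ inv (ℓ S) → ¬ Blocked S M t → Shorter S W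
        pass S W M I (M∈ , z≼M , min , ¬sep) t t≢ ¬blocked =
          S′ , W′ , Listₚ.filter-notAll (λ w → em) W (lose M∈ λ z′≼M → <⇒⋡ M<z′ z′≼M) , I′ , good-next t≢
          where
          open AfterAdvance (advance S t W)
          M<z′ : M < at S′ y
          M<z′ = ⋠⇒> λ z′≼M → case-free (free y∈ (inj₁ M∈) z′≼M)
            where
            case-free : ∃[ v ] Dom (c S) t v × at S y ≼ v × to (act (h (c S)) t) v ≼ M → ⊥
            case-free (v , v∈ , z≼v , tv≼M) with I t v∈ z≼v
            ... | inj₁ v∈W              = ¬blocked (v , v∈ , min v∈W z≼v , tv≼M)
            ... | inj₂ (inj₁ sep)       = ¬sep (sep-via {y} sep tv≼M)
            ... | inj₂ (inj₂ (_ , eq))  = t≢ eq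
          W′ : List Carrier
          W′ = filter (λ w → em {P = at S′ y ≼ w}) W
          z<z′ : at S y < at S′ y
          z<z′ = ≼-<-trans z≼M M<z′
          I′ : Inv S′ W′ y
          I′ t′ {v} v∈ z′≼v with domain y∈ t′ v∈ z′≼v
          ... | inj₂ (inj₁ (_ , refl)) = contradiction z′≼v (<⇒⋡ z<z′)
          ... | inj₂ (inj₂ (inj₁ (eq , refl))) = inj₂ (inj₂ (refl , trans eq (cong inv (sym last))))
          ... | inj₂ (inj₂ (inj₂ sep)) = inj₂ (inj₁ sep)
          ... | inj₁ old with I t′ old (≼-trans (inj₁ z<z′) z′≼v)
          ...   | inj₁ v∈W             = inj₁ (∈-filter⁺ (λ w → em) v∈W z′≼v)
          ...   | inj₂ (inj₁ sep)      = inj₂ (inj₁ (sep-next y∈ sep))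
          ...   | inj₂ (inj₂ (refl , _)) = contradiction z′≼v (<⇒⋡ z<z′)

        -- Applying a generator that fixes M keeps the point below M and makes both
        -- letters of the other generator available.
        approach : ∀ S W M → Inv S W y → NextAbove S W M → ∀ b → b ≢ proj₁ (ℓ S) → M ∈ D (c S) b → to (h (c S) b) M ≡ M →
          Σ[ S′ ∈ State ] Extends (c S) (c S′) × ℓ S′ ≡ (b , true) × Inv S′ W y × NextAbove S′ W M × Preserving S S′
        approach S W M I (M∈ , z≼M , min , ¬sep) b b≢ M∈D hM =
          S′ , ext , last , I′ , (M∈ , z′≼M , (λ w∈ z′≼w → min w∈ (≼-trans z≼z′ z′≼w)) , λ sep → ¬sep (sep-prev y∈ sep)) , good-next t≢
          where
          t : Letter
          t = b , true
          t≢ : t ≢ inv (ℓ S)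
          t≢ eq = b≢ (cong proj₁ eq)
          open AfterAdvance (advance S t W)
          z z′ : Carrier
          z  = at S y
          z′ = at S′ y
          z′≼M : z′ ≼ M
          z′≼M = subst₂ _≼_ (sym (moved y∈)) (trans (at-≡ M∈D) hM) (to-≼ (h (c S′) b) z≼M)
          settled : z′ ≼ z → z ∈ W ⊎ Sep C z z
          settled z′≼z with free y∈ (inj₂ (inj₂ (∈-map⁺ _ y∈))) z′≼z
          ... | v , v∈ , z≼v , hv≼z with I t v∈ z≼v
          ...   | inj₂ (inj₁ sep)      = inj₂ (sep-via {y} sep hv≼z)
          ...   | inj₂ (inj₂ (_ , eq)) = contradiction eq t≢
          ...   | inj₁ v∈W             = inj₁ (subst (_∈ W) (sym z≡M) M∈)
            where
            z≡M : z ≡ M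
            z≡M = ≼-antisym z≼M (≼-trans (subst (_≼ to (h (c S) b) v) hM (to-≼ (h (c S) b) (min v∈W z≼v))) hv≼z)
          z≼z′ : z ≼ z′
          z≼z′ with z ≼⊎≻ z′
          ... | inj₁ le = le
          ... | inj₂ lt with settled (inj₁ lt)
          ...   | inj₁ z∈W = contradiction lt (O.irrefl (trans (moved y∈) (trans (cong (to (h (c S′) b)) z≡M)
                             (trans (at-≡ M∈D) (trans hM (sym z≡M))))))
            where
            z≡M : z ≡ M
            z≡M = ≼-antisym z≼M (min z∈W ≼-refl)
          ...   | inj₂ (c′ , Cc , z≼c , c≼z) = contradiction lt (O.irrefl (trans (moved y∈)
                    (trans (cong (to (h (c S′) b)) z≡c) (trans (h-C (c S′) Cc b) (sym z≡c)))))
            where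
            z≡c : z ≡ c′
            z≡c = ≼-antisym z≼c c≼z
          I′ : Inv S′ W y
          I′ t′ {v} v∈ z′≼v with domain y∈ t′ v∈ z′≼v
          ... | inj₂ (inj₂ (inj₁ (eq , refl))) = inj₂ (inj₂ (refl , trans eq (cong inv (sym last))))
          ... | inj₂ (inj₂ (inj₂ sep)) = inj₂ (inj₁ sep)
          ... | inj₂ (inj₁ (_ , refl)) with settled z′≼v
          ...   | inj₁ z∈W = inj₁ z∈W
          ...   | inj₂ sep = inj₂ (inj₁ (sep-next y∈ sep))
          I′ t′ {v} v∈ z′≼v | inj₁ old with I t′ old (≼-trans z≼z′ z′≼v)
          ...   | inj₁ v∈W        = inj₁ v∈W
          ...   | inj₂ (inj₁ sep) = inj₂ (inj₁ (sep-next y∈ sep))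
          ...   | inj₂ (inj₂ (refl , _)) with settled z′≼v
          ...     | inj₁ z∈W = inj₁ z∈W
          ...     | inj₂ sep = inj₂ (inj₁ (sep-next y∈ sep))

        Unblocked : State → Carrier → Set
        Unblocked S M = ∃[ t ] t ≢ inv (ℓ S) × ¬ Blocked S M t

        blocked : ∀ S M → ¬ Unblocked S M → ∀ t → t ≢ inv (ℓ S) → Blocked S M t
        blocked S M none t t≢ = byContra λ ¬b → none (t , t≢ , ¬b)

        not-≢ : ∀ b → not b ≢ b
        not-≢ true ()
        not-≢ false ()

        ≢⇒not : ∀ {b b′ : Bool} → b ≢ b′ → b′ ≡ not b
        ≢⇒not {true}  {true}  ne = contradiction refl ne
        ≢⇒not {true}  {false} ne = refl
        ≢⇒not {false} {true}  ne = refl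
        ≢⇒not {false} {false} ne = contradiction refl ne

        pushPast : ∀ S W M → Inv S W y → NextAbove S W M → Shorter S W
        pushPast S W M I N with em {P = Unblocked S M}
        ... | yes (t , t≢ , ¬b) = pass S W M I N t t≢ ¬b
        ... | no none with stuck S M b (blk (b , true) λ eq → not-≢ _ (cong proj₁ eq)) (blk (b , false) λ eq → not-≢ _ (cong proj₁ eq))
          where
          b : Bool
          b = not (proj₁ (ℓ S))
          blk : ∀ t → t ≢ inv (ℓ S) → Blocked S M t
          blk = blocked S M none
        ...   | M∈D , hM with approach S W M I N (not (proj₁ (ℓ S))) (not-≢ _) M∈D hM
        ...     | S₁ , ext , last , I₁ , N₁@(_ , z≼M , _ , ¬sep) , keep with em {P = Unblocked S₁ M}
        ...       | yes (t , t≢ , ¬b) = let S₂ , W′ , lt , I₂ , keep′ = pass S₁ W M I₁ N₁ t t≢ ¬b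
                                        in S₂ , W′ , lt , I₂ , λ y′∈ g → keep′ y′∈ (keep y′∈ g)
        ...       | no none = contradiction (M , CM , z≼M , ≼-refl) ¬sep
          where
          b b₁ : Bool
          b  = not (proj₁ (ℓ S))
          b₁ = proj₁ (ℓ S)
          blk : ∀ s → Blocked S₁ M (b₁ , s)
          blk s = blocked S₁ M none (b₁ , s) λ eq → not-≢ b₁ (sym (cong proj₁ (trans eq (cong inv last))))
          other : M ∈ D (c S₁) b₁ × to (h (c S₁) b₁) M ≡ M
          other = stuck S₁ M b₁ (blk true) (blk false)
          hM₁ : ∀ b′ → to (h (c S₁) b′) M ≡ M
          hM₁ b′ with b′ Boolₚ.≟ b₁
          ... | yes refl = proj₂ other
          ... | no ne    = subst (λ b′ → to (h (c S₁) b′) M ≡ M) (sym (≢⇒not (λ e → ne (sym e))))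
                             (trans (proj₂ ext b M M∈D) hM)
          M∈A : M ∈ A
          M∈A = fixed (c S₁) b₁ (proj₁ other) (proj₂ other)
          CM : C M
          CM = M∈A , λ b′ → trans (sym (agree (c S₁) b′ M M∈A)) (hM₁ b′)

        push : ∀ n S W → length W ≤ n → Inv S W y → Σ[ S′ ∈ State ] Good S′ y × Preserving S S′
        push n S W len I with least (at S y ≼_) W
        ... | inj₂ none = S , (λ t v∈ z≼v → case (I t v∈ z≼v) z≼v) , λ _ g → g
          where
          case : ∀ {t v} → v ∈ W ⊎ Sep C (at S y) v ⊎ (v ≡ at S y × t ≡ inv (ℓ S)) → at S y ≼ v →
                 v ∈ [] ⊎ Sep C (at S y) v ⊎ (v ≡ at S y × t ≡ inv (ℓ S))
          case (inj₁ v∈W) z≼v = contradiction z≼v (none v∈W)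
          case (inj₂ p)   z≼v = inj₂ p
        ... | inj₁ (M , M∈ , z≼M , min) with em {P = Sep C (at S y) M}
        ...   | yes sep@(c′ , Cc , z≼c , c≼M) = S , (λ t v∈ z≼v → case (I t v∈ z≼v) z≼v) , λ _ g → g
          where
          case : ∀ {t v} → v ∈ W ⊎ Sep C (at S y) v ⊎ (v ≡ at S y × t ≡ inv (ℓ S)) → at S y ≼ v →
                 v ∈ [] ⊎ Sep C (at S y) v ⊎ (v ≡ at S y × t ≡ inv (ℓ S))
          case (inj₁ v∈W) z≼v = inj₂ (inj₁ (c′ , Cc , z≼c , ≼-trans c≼M (min v∈W z≼v)))
          case (inj₂ p)   z≼v = inj₂ p
        ...   | no ¬sep with n | pushPast S W M I (M∈ , z≼M , min , ¬sep)
        ...     | zero   | S′ , W′ , lt , _ = contradiction (ℕₚ.≤-trans lt len) (ℕₚ.n≮0)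
        ...     | suc n′ | S′ , W′ , lt , I′ , keep =
                  let S″ , good , keep′ = push n′ S′ W′ (ℕₚ.≤-pred (ℕₚ.≤-trans lt len)) I′
                  in S″ , good , λ y′∈ g → keep′ y′∈ (keep y′∈ g)

      start : State
      start = record
        { c = record { h = g ; D = λ _ → A ; A⊆D = λ _ x∈ → x∈ ; agree = λ _ _ _ → refl ; fixed = λ _ v∈ _ → v∈ }
        -- The empty word has no last letter. Any value will do here, because each push begins with
        -- all prescribed points in `W`.
        ; r = [] ; ℓ = true , true ; det = λ _ _ → refl }

      pushAll : ∀ L → L ⊆ ys → Σ[ S ∈ State ] (∀ {y} → y ∈ L → Good S y)
      pushAll []      L⊆ = start , λ ()
      pushAll (y ∷ L) L⊆ =
        let S , good = pushAll L (λ x → L⊆ (there x))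
            S′ , good-y , keep = push (L⊆ (here refl)) (length (points (c S))) S (points (c S)) ℕₚ.≤-refl
                                   (λ t v∈ _ → inj₁ (Dom⊆points (c S) t v∈))
        in S′ , λ { (here refl) → good-y ; (there y′∈) → keep (L⊆ (there y′∈)) (good y′∈) }

      opaque
        pushed : Σ[ h ∈ Pair ] Σ[ D ∈ (Bool → List Carrier) ] ∃[ r ]
          (∀ b → A ⊆ D b) × AgreeP A g h ×
          (∀ {h′} → (∀ b → Agree (D b) (h b) (h′ b)) → ∀ {y} → y ∈ ys → run h′ r y ≡ run h r y) ×
          (∀ {y v} → y ∈ ys → v ∈ D true → run h r y ≼ v → Sep C (run h r y) v)
        pushed with pushAll ys (λ y∈ → y∈)
        ... | S , good = h (c S′) , D (c S′) , r S′ , A⊆D (c S′) , agree (c S′) , det S′ , high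
          where
          -- One more letter, positive, and from the other generator so that the word stays reduced.
          -- The exceptional letter in `Good` is then an inverse, so nothing in the domain of p is
          -- left in the way.
          b : Bool
          b = not (proj₁ (ℓ S))
          neq : ∀ b′ → not b′ ≢ b′
          neq true ()
          neq false ()
          t≢ : (b , true) ≢ inv (ℓ S)
          t≢ eq = neq _ (cong proj₁ eq)
          open AfterAdvance (advance S (b , true) [])
          high : ∀ {y v} → y ∈ ys → v ∈ D (c S′) true → at S′ y ≼ v → Sep C (at S′ y) v
          high y∈ v∈ le with good-next t≢ y∈ (good y∈) (true , true) v∈ le
          ... | inj₂ (inj₁ sep) = sep
          ... | inj₂ (inj₂ (_ , eq)) = contradiction (cong proj₂ (trans eq (cong inv last))) λ ()

  -- Climbing above whole orbits

  orbit : Pair → Word → Carrier → List Carrier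
  orbit h []      x = [ x ]
  orbit h (t ∷ r) x = x ∷ orbit h r (to (act h t) x)

  orbit-start : ∀ h r x → x ∈ orbit h r x
  orbit-start h []      x = here refl
  orbit-start h (t ∷ r) x = here refl

  ∈-orbit⁻ : ∀ h r {x v} → v ∈ orbit h r x → ∃[ r′ ] v ≡ run h r′ x
  ∈-orbit⁻ h []      (here refl) = [] , refl
  ∈-orbit⁻ h (t ∷ r) (here refl) = [] , refl
  ∈-orbit⁻ h (t ∷ r) (there v∈)  = let r′ , eq = ∈-orbit⁻ h r v∈ in t ∷ r′ , eq

  length-orbit : ∀ h r x → length (orbit h r x) ≡ suc (length r)
  length-orbit h []      x = refl
  length-orbit h (t ∷ r) x = cong suc (length-orbit h r _)

  run-agree : ∀ {h h′} r {x} → AgreeP (orbit h r x) h h′ → run h′ r x ≡ run h r x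
  run-agree []      ag = refl
  run-agree {h} {h′} (t ∷ r) {x} ag =
    trans (cong (run h′ r) (act-eq t (λ b → ag b x (here refl)) (λ b → ag b _ (there (orbit-start h r _)))))
          (run-agree {h} {h′} r (λ b y y∈ → ag b y (there y∈)))
    where
    act-eq : ∀ t {x} → (∀ b → to (h′ b) x ≡ to (h b) x) → (∀ b → to (h′ b) (to (act h t) x) ≡ to (h b) (to (act h t) x)) →
             to (act h′ t) x ≡ to (act h t) x
    act-eq (b , true)  eq _  = eq b
    act-eq (b , false) _  eq = trans (cong (from (h′ b)) (sym (trans (eq b) (to-from (h b) _)))) (from-to (h′ b) _)

  module _ (p q : Automorphism QU) (P zs U : List Carrier) (C : Carrier → Set) {c₀ : Carrier} (c₀∈ : c₀ ∈ P)
           (C-fix : ∀ {c} → C c → c ∈ P × to p c ≡ c)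
           (high₀ : ∀ {z v} → z ∈ zs → v ∈ P → z ≼ v → Sep C z v) where

    record Climbing (n : ℕ) : Set where
      field
        s     : Automorphism QU
        R     : List Carrier
        P⊆R   : P ⊆ R
        agree : Agree P p s
        stay  : ∀ {j z} → j ℕ.< n → z ∈ zs → s ^ j · z ∈ R
        high  : ∀ {z v} → z ∈ zs → v ∈ R → s ^ n · z ≼ v → Sep C (s ^ n · z) v
        -- Including the images of the current point under q and its inverse lets one step of the
        -- climb outrun any single letter (`rise`).
        bound : ∀ {j z u} → j ℕ.< n → z ∈ zs →
                u ∈ U ⊎ u ≡ to q (s ^ j · z) ⊎ u ≡ from q (s ^ j · z) ⊎ u ≡ s ^ j · z →
                s ^ suc j · z ≼ u → Sep C (s ^ j · z) u

    climb : ∀ n → Climbing n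
    climb zero = record
      { s = p ; R = P ; P⊆R = λ x∈ → x∈ ; agree = λ _ _ → refl ; stay = λ () ; high = high₀ ; bound = λ () }
    climb (suc n) with climb n
    ... | S with freeStep (Climbing.s S) (Climbing.R S) (map (to (pow (Climbing.s S) n)) zs)
                   (U ++ map (to q) (map (to (pow (Climbing.s S) n)) zs) ++ map (from q) (map (to (pow (Climbing.s S) n)) zs)
                      ++ map (to (pow (Climbing.s S) n)) zs ++ Climbing.R S) (Climbing.P⊆R S c₀∈)
    ...   | s′ , ag , free = record
      { s = s′ ; R = Z ++ R
      ; P⊆R = λ x∈ → ∈-++⁺ʳ Z (P⊆R x∈)
      ; agree = agree-extend p s s′ P⊆R agree ag
      ; stay = λ j< z∈ → stay′ (ℕₚ.m≤n⇒m<n∨m≡n (ℕₚ.≤-pred j<)) z∈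
      ; high = λ z∈ v∈ le → Sep-to s′ fix (subst (λ x → Sep C x _) (sym (same ℕₚ.≤-refl z∈))
                  (jump z∈ (inU (inj₂ (inj₂ (inj₂ v∈)))) le))
      ; bound = λ j< z∈ u∈ le → bound′ (ℕₚ.m≤n⇒m<n∨m≡n (ℕₚ.≤-pred j<)) z∈ u∈ le }
      where
      open Climbing S
      Z U′ : List Carrier
      Z  = map (to (pow s n)) zs
      U′ = U ++ map (to q) Z ++ map (from q) Z ++ Z ++ R
      same : ∀ {j z} → j ≤ n → z ∈ zs → s′ ^ j · z ≡ s ^ j · z
      same j≤ z∈ = pow-agree {s} {s′} ag _ (λ i<j → stay (ℕₚ.≤-trans i<j j≤) z∈)
      fix : ∀ {c} → C c → to s′ c ≡ c
      fix Cc = let c∈ , pc = C-fix Cc in trans (ag _ (P⊆R c∈)) (trans (agree _ c∈) pc)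
      stay′ : ∀ {j z} → j ℕ.< n ⊎ j ≡ n → z ∈ zs → s′ ^ j · z ∈ Z ++ R
      stay′ (inj₁ j<)  z∈ = ∈-++⁺ʳ Z (subst (_∈ R) (sym (same (ℕₚ.<⇒≤ j<) z∈)) (stay j< z∈))
      stay′ (inj₂ refl) z∈ = ∈-++⁺ˡ (subst (_∈ Z) (sym (same ℕₚ.≤-refl z∈)) (∈-map⁺ _ z∈))
      inU : ∀ {u} → u ∈ U ⊎ u ∈ map (to q) Z ⊎ u ∈ map (from q) Z ⊎ u ∈ Z ++ R → u ∈ U′
      inU (inj₁ u∈) = ∈-++⁺ˡ u∈
      inU (inj₂ (inj₁ u∈)) = ∈-++⁺ʳ U (∈-++⁺ˡ u∈)
      inU (inj₂ (inj₂ (inj₁ u∈))) = ∈-++⁺ʳ U (∈-++⁺ʳ (map (to q) Z) (∈-++⁺ˡ u∈))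
      inU (inj₂ (inj₂ (inj₂ u∈))) = ∈-++⁺ʳ U (∈-++⁺ʳ (map (to q) Z) (∈-++⁺ʳ (map (from q) Z) u∈))
      jump : ∀ {z u} → z ∈ zs → u ∈ U′ → s′ ^ suc n · z ≼ u → Sep C (s ^ n · z) u
      jump {z} {u} z∈ u∈ le with proj₂ (free (∈-map⁺ _ z∈) u∈) (subst (λ x → to s′ x ≼ u) (same ℕₚ.≤-refl z∈) le)
      ... | v , v∈ , z≼v , sv≼u with high z∈ v∈ z≼v
      ...   | c , Cc , z≼c , c≼v = c , Cc , z≼c , ≼-trans (subst (_≼ to s v) sc (to-≼ s c≼v)) sv≼u
        where
        sc : to s c ≡ c
        sc = let c∈ , pc = C-fix Cc in trans (agree _ c∈) pc
      bound′ : ∀ {j z u} → j ℕ.< n ⊎ j ≡ n → z ∈ zs →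
                u ∈ U ⊎ u ≡ to q (s′ ^ j · z) ⊎ u ≡ from q (s′ ^ j · z) ⊎ u ≡ s′ ^ j · z →
                s′ ^ suc j · z ≼ u → Sep C (s′ ^ j · z) u
      bound′ {j} {z} {u} (inj₁ j<) z∈ u∈ le rewrite same (ℕₚ.<⇒≤ j<) z∈ =
        bound j< z∈ u∈ (subst (_≼ u) (ag _ (stay j< z∈)) le)
      bound′ {j} {z} {u} (inj₂ refl) z∈ u∈ le =
        subst (λ x → Sep C x u) (sym (same ℕₚ.≤-refl z∈)) (jump z∈ (inU (memb u∈)) le)
        where
        z∈Z : s′ ^ j · z ∈ Z
        z∈Z = subst (_∈ Z) (sym (same ℕₚ.≤-refl z∈)) (∈-map⁺ _ z∈)
        memb : u ∈ U ⊎ u ≡ to q (s′ ^ j · z) ⊎ u ≡ from q (s′ ^ j · z) ⊎ u ≡ s′ ^ j · z →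
               u ∈ U ⊎ u ∈ map (to q) Z ⊎ u ∈ map (from q) Z ⊎ u ∈ Z ++ R
        memb (inj₁ u∈)                 = inj₁ u∈
        memb (inj₂ (inj₁ refl))        = inj₂ (inj₁ (∈-map⁺ (to q) z∈Z))
        memb (inj₂ (inj₂ (inj₁ refl))) = inj₂ (inj₂ (inj₁ (∈-map⁺ (from q) z∈Z)))
        memb (inj₂ (inj₂ (inj₂ refl))) = inj₂ (inj₂ (inj₂ (∈-++⁺ˡ z∈Z)))

  module Rising (g : Pair) (A : List Carrier) {c₀ : Carrier} (c₀∈ : c₀ ∈ A) (gc₀ : ∀ b → to (g b) c₀ ≡ c₀) where
    open Pushing g A c₀∈ using (C; module Tracked)

    -- The lowest point of A in its gap between common fixed points.
    Lowest : Carrier → Set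
    Lowest y = ¬ C y × (∀ {x} → x ∈ A → ¬ C x → x < y → Sep C x y)

    lows : List Carrier
    lows = filter (λ y → em {P = Lowest y}) A

    lows⊆A : lows ⊆ A
    lows⊆A y∈ = proj₁ (∈-filter⁻ (λ y → em) y∈)

    lowest : ∀ {y} → y ∈ lows → Lowest y
    lowest y∈ = proj₂ (∈-filter⁻ (λ y → em) {xs = A} y∈)

    separated : ∀ {y y′} → y ∈ lows → y′ ∈ lows → y ≡ y′ ⊎ Sep C y y′ ⊎ Sep C y′ y
    separated {y} {y′} y∈ y′∈ with y ≼⊎≻ y′
    ... | inj₁ (inj₂ eq) = inj₁ eq
    ... | inj₁ (inj₁ lt) = inj₂ (inj₁ (proj₂ (lowest y′∈) (lows⊆A y∈) (proj₁ (lowest y∈)) lt))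
    ... | inj₂ lt        = inj₂ (inj₂ (proj₂ (lowest y∈) (lows⊆A y′∈) (proj₁ (lowest y′∈)) lt))

    cover : ∀ {x} → x ∈ A → ¬ C x → ∃[ y ] y ∈ lows × y ≼ x × ¬ Sep C y x
    cover {x} x∈ ¬Cx with least (λ y → ¬ C y × y ≼ x × ¬ Sep C y x) A
    ... | inj₂ none = contradiction
          (¬Cx , ≼-refl , λ { (c , Cc , x≼c , c≼x) → ¬Cx (subst C (≼-antisym c≼x x≼c) Cc) }) (none x∈)
    ... | inj₁ (y , y∈ , (¬Cy , y≼x , ¬sep) , min) =
          y , ∈-filter⁺ (λ y → em) y∈ (¬Cy , λ {x′} x′∈ ¬Cx′ x′<y → byContra λ ¬sep′ →
                <⇒⋡ x′<y (min x′∈ (¬Cx′ , inj₁ (<-≼-trans x′<y y≼x) , λ { (c , Cc , x′≼c , c≼x) →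
                  split c Cc x′≼c c≼x ¬sep′ }))) , y≼x , ¬sep
      where
      split : ∀ {x′} c → C c → x′ ≼ c → c ≼ x → ¬ ¬ Sep C x′ y
      split c Cc x′≼c c≼x ¬sep′ with c ≼⊎≻ y
      ... | inj₁ c≼y = ¬sep′ (c , Cc , x′≼c , c≼y)
      ... | inj₂ y<c = ¬sep (c , Cc , inj₁ y<c , c≼x)

    module Raised (h : Pair) (D : Bool → List Carrier) (r : Word)
      (A⊆D : ∀ b → A ⊆ D b) (g~h : AgreeP A g h)
      (det : ∀ {h′} → (∀ b → Agree (D b) (h b) (h′ b)) → ∀ {y} → y ∈ lows → run h′ r y ≡ run h r y)
      (high : ∀ {y v} → y ∈ lows → v ∈ D true → run h r y ≼ v → Sep C (run h r y) v) where

      L n : ℕ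
      L = length r
      -- Orbits along `r` that start below the first step of the climb stay below step L + 1
      -- (`bounded`); n lies beyond it.
      n = suc (suc L)

      h-C : ∀ {c} → C c → ∀ b → to (h b) c ≡ c
      h-C (c∈ , fix) b = trans (g~h b _ c∈) (fix b)

      q : Automorphism QU
      q = h false

      zs : List Carrier
      zs = map (run h r) lows

      highZ : ∀ {z v} → z ∈ zs → v ∈ D true → z ≼ v → Sep C z v
      highZ z∈ v∈ le with y , y∈ , refl ← ∈-map⁻ (run h r) z∈ = high y∈ v∈ le

      module Climb′ (climbing : Climbing (h true) q (D true) zs A C (A⊆D true c₀∈)
                        (λ Cc → A⊆D true (proj₁ Cc) , h-C Cc true) highZ n) (k : ℕ) where
        open Climbing climbing using (bound) renaming (s to p; agree to p-agree)

        h₁ : Pair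
        h₁ = pair p q

        p-C : ∀ {c} → C c → to p c ≡ c
        p-C Cc = trans (p-agree _ (A⊆D true (proj₁ Cc))) (h-C Cc true)

        h₁-C : ∀ {c} → C c → ∀ b → to (h₁ b) c ≡ c
        h₁-C Cc true  = p-C Cc
        h₁-C Cc false = h-C Cc false

        start-eq : ∀ {y} → y ∈ lows → run h₁ r y ≡ run h r y
        start-eq y∈ = det {h₁} (λ { true → p-agree ; false _ _ → refl }) y∈

        module _ {y : Carrier} (y∈ : y ∈ lows) where
          z : ℕ → Carrier
          z j = p ^ j · run h r y

          z-C : ∀ {j c} → C c → z j ≢ c
          z-C {j} {c} Cc eq = proj₁ (lowest y∈) (subst C (sym (to-injective (word h r)
            (to-injective (pow p j) (trans eq (sym (trans (cong (p ^ j ·_) (run-fix h (h-C Cc) r)) (pow-fix p j (p-C Cc)))))))) Cc)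

          rise : ∀ {j u} → j ℕ.< n → u ≡ to q (z j) ⊎ u ≡ from q (z j) ⊎ u ≡ z j → u < z (suc j)
          rise {j} {u} j< u≡ = ⋠⇒> λ le → absurd u≡ (bound j< (∈-map⁺ _ y∈) (inj₂ u≡) le)
            where
            absurd : u ≡ to q (z j) ⊎ u ≡ from q (z j) ⊎ u ≡ z j → ¬ Sep C (z j) u
            absurd (inj₁ refl) (c , Cc , z≼c , c≼u) =
              z-C {j} Cc (≼-antisym z≼c (to-≼⁻ q (subst (_≼ to q (z j)) (sym (h-C Cc false)) c≼u)))
            absurd (inj₂ (inj₁ refl)) (c , Cc , z≼c , c≼u) =
              z-C {j} Cc (≼-antisym z≼c (subst₂ _≼_ (h-C Cc false) (to-from q _) (to-≼ q c≼u)))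
            absurd (inj₂ (inj₂ refl)) (c , Cc , z≼c , c≼u) = z-C {j} Cc (≼-antisym z≼c c≼u)

          z-mono : ∀ {i j} → i ≤ j → j ≤ n → z i ≼ z j
          z-mono {i} {zero}  z≤n _ = ≼-refl
          z-mono {i} {suc j} i≤ j< with ℕₚ.m≤n⇒m<n∨m≡n i≤
          ... | inj₂ refl      = ≼-refl
          ... | inj₁ (s≤s i≤j) = ≼-trans (z-mono i≤j (ℕₚ.<⇒≤ j<)) (inj₁ (rise {j} j< (inj₂ (inj₂ refl))))

          -- Each letter of the orbit moves by at most one step of the climb.
          bounded : ∀ i r′ {x v} → i + length r′ ≤ L → x < z (suc i) → v ∈ orbit h₁ r′ x → v < z (suc L)
          bounded i []       {x} le x< (here refl) =
            <-≼-trans x< (z-mono (s≤s (subst (_≤ L) (ℕₚ.+-identityʳ i) le)) (ℕₚ.n≤1+n _))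
          bounded i (t ∷ r′) {x} le x< (here refl) =
            <-≼-trans x< (z-mono (s≤s (ℕₚ.≤-trans (ℕₚ.m≤m+n i _) le)) (ℕₚ.n≤1+n _))
          bounded i (t ∷ r′) {x} le x< (there v∈) =
            bounded (suc i) r′ le′ (next t) v∈
            where
            le′ : suc i + length r′ ≤ L
            le′ = subst (_≤ L) (ℕₚ.+-suc i (length r′)) le
            i<L : suc i ≤ L
            i<L = ℕₚ.≤-trans (ℕₚ.m≤m+n (suc i) _) le′
            si<n : suc i ℕ.< n
            si<n = s≤s (ℕₚ.m≤n⇒m≤1+n i<L)
            next : ∀ t → to (act h₁ t) x < z (suc (suc i))
            next (true  , true)  = to-< p x<
            next (true  , false) = <-≼-trans (to-<⁻ p (subst (_< z (suc i)) (sym (to-from p x)) x<))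
                                     (z-mono (ℕₚ.m≤n⇒m≤1+n (ℕₚ.n≤1+n i)) si<n)
            next (false , true)  = O.trans (to-< q x<) (rise {suc i} si<n (inj₁ refl))
            next (false , false) = O.trans (to-< (q ⁻¹) x<) (rise {suc i} si<n (inj₂ (inj₁ refl)))

        base : Carrier → Carrier
        base = run h₁ r

        cur : Carrier → Carrier
        cur x = p ^ n · base x

        cur-C : ∀ {c} → C c → cur c ≡ c
        cur-C Cc = trans (cong (p ^ n ·_) (run-fix h₁ (h₁-C Cc) r)) (pow-fix p n (p-C Cc))

        -- q counts as prescribed only on `G`, the points met by `A` along `r`. Its values at the
        -- end of the power of p are thus still free, and one application of q clears all of `E`,
        -- the points of that power included.
        G E : List Carrier
        G = concatMap (orbit h₁ r) A
        E = G ++ orbits p (map base A) n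

        orbit⊆G : ∀ {x v} → x ∈ A → v ∈ orbit h₁ r x → v ∈ G
        orbit⊆G x∈ v∈ = ∈-concatMap⁺ (orbit h₁ r) (lose x∈ v∈)

        A⊆G : A ⊆ G
        A⊆G x∈ = orbit⊆G x∈ (orbit-start h₁ r _)

        -- `v` is reached along `r` from some `x′` in `A`. If `x′` lies below the first step of the
        -- climb, its orbit stays below the top. Otherwise that step yields a common fixed point
        -- below `x′`, hence below the whole orbit; it lies above `x`, which shares its gap with the
        -- lowest point `y`.
        high-cur : ∀ {x v} → x ∈ A → v ∈ G → cur x ≼ v → Sep C (cur x) v
        high-cur {x} {v} x∈ v∈ le with em {P = C x}
        ... | yes Cx = x , Cx , inj₂ (cur-C Cx) , subst (_≼ v) (cur-C Cx) le
        ... | no ¬Cx with cover x∈ ¬Cx | find (∈-concatMap⁻ (orbit h₁ r) v∈)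
        ...   | y , y∈ , y≼x , ¬sep | x′ , x′∈ , v∈orbit with z y∈ 1 ≼⊎≻ x′
        ...     | inj₂ x′<z₁ = contradiction le (<⇒⋡ (<-≼-trans
                    (bounded y∈ 0 r {x′} ℕₚ.≤-refl x′<z₁ v∈orbit)
                    (≼-trans (z-mono y∈ (ℕₚ.n≤1+n _) ℕₚ.≤-refl)
                      (to-≼ (pow p n) (subst (_≼ base x) (start-eq y∈) (to-≼ (word h₁ r) y≼x))))))
        ...     | inj₁ z₁≼x′ with bound (s≤s z≤n) (∈-map⁺ _ y∈) (inj₁ x′∈) z₁≼x′
        ...       | c , Cc , z₀≼c , c≼x′ = c , Cc
                    , subst (cur x ≼_) (cur-C Cc) (to-≼ (pow p n) (to-≼ (word h₁ r) x≼c))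
                    , c≼v (∈-orbit⁻ h₁ r v∈orbit)
          where
          y≼c : y ≼ c
          y≼c = to-≼⁻ (word h r) (subst (run h r y ≼_) (sym (run-fix h (h-C Cc) r)) z₀≼c)
          x≼c : x ≼ c
          x≼c with c ≼⊎≻ x
          ... | inj₁ c≼x = contradiction (c , Cc , y≼c , c≼x) ¬sep
          ... | inj₂ x<c = inj₁ x<c
          c≼v : ∃[ r′ ] v ≡ run h₁ r′ x′ → c ≼ v
          c≼v (r′ , refl) = subst (_≼ run h₁ r′ x′) (run-fix h₁ (h₁-C Cc) r′) (to-≼ (word h₁ r′) c≼x′)

        module Jump (q′ : Automorphism QU) (q~q′ : Agree G q q′)
                    (free : ∀ {y u} → y ∈ map cur A → u ∈ E → Free q G y (to q′ y) u) where

          h₀ : Pair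
          h₀ = pair p q′

          h₀-C : ∀ {c} → C c → ∀ b → to (h₀ b) c ≡ c
          h₀-C Cc true  = p-C Cc
          h₀-C Cc false = trans (q~q′ _ (A⊆G (proj₁ Cc))) (h-C Cc false)

          open Units h₀ E (map (λ x → to q′ (cur x)) A) {c₀} (∈-++⁺ˡ (A⊆G c₀∈)) (h₀-C (c₀∈ , gc₀)) using (Common; settle)

          high-jump : ∀ {y v} → y ∈ map (λ x → to q′ (cur x)) A → v ∈ E → y ≼ v → Sep Common y v
          high-jump {y} {v} y∈ v∈ le with ∈-map⁻ _ y∈
          ... | x , x∈ , refl with proj₂ (free (∈-map⁺ cur x∈) v∈) le
          ...   | w , w∈ , cur≼w , qw≼v with high-cur x∈ w∈ cur≼w
          ...     | c , Cc , cur≼c , c≼w = c , (∈-++⁺ˡ (A⊆G (proj₁ Cc)) , h₀-C Cc)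
                  , subst (to q′ (cur x) ≼_) (h₀-C Cc false) (to-≼ q′ cur≼c)
                  , ≼-trans (subst (_≼ to q w) (h-C Cc false) (to-≼ q c≼w)) qw≼v

          prefix : Word
          prefix = r ++ pos (replicate n true) ++ [ false , true ]

          run-prefix : ∀ {h′} → AgreeP E h₀ h′ → ∀ {x} → x ∈ A → run h′ prefix x ≡ to q′ (cur x)
          run-prefix {h′} ag {x} x∈ = begin
            run h′ prefix x                                                   ≡⟨ run-++ h′ r _ x ⟩
            run h′ (pos (replicate n true) ++ [ false , true ]) (run h′ r x)  ≡⟨ run-++ h′ (pos (replicate n true)) _ _ ⟩
            to (h′ false) (run h′ (pos (replicate n true)) (run h′ r x))      ≡⟨ cong (to (h′ false)) (run-power h′ true n _) ⟩
            to (h′ false) (h′ true ^ n · run h′ r x)                          ≡⟨ cong (λ w → to (h′ false) (h′ true ^ n · w))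
                (run-agree {h₁} {h′} r ag₁) ⟩
            to (h′ false) (h′ true ^ n · base x)                              ≡⟨ cong (to (h′ false)) (pow-agree
                {p} {h′ true} (ag true) n (λ i< → in-E (ℕₚ.<⇒≤ i<))) ⟩
            to (h′ false) (cur x)                                             ≡⟨ ag false _ (in-E ℕₚ.≤-refl) ⟩
            to q′ (cur x)                                                     ∎
            where
            open ≡-Reasoning
            in-E : ∀ {i} → i ≤ n → p ^ i · base x ∈ E
            in-E i≤ = ∈-++⁺ʳ G (∈-orbits⁺ p (map base A) n i≤ (∈-map⁺ base x∈))
            ag₁ : AgreeP (orbit h₁ r x) h₁ h′
            ag₁ true  v v∈ = ag true v (∈-++⁺ˡ (orbit⊆G x∈ v∈))
            ag₁ false v v∈ = trans (ag false v (∈-++⁺ˡ (orbit⊆G x∈ v∈))) (q~q′ v (orbit⊆G x∈ v∈))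

          g~h₀ : AgreeP A g h₀
          g~h₀ true  x x∈ = trans (p-agree x (A⊆D true x∈)) (g~h true x x∈)
          g~h₀ false x x∈ = trans (q~q′ x (A⊆G x∈)) (g~h false x x∈)

          raised : Σ[ h′ ∈ Pair ] ∃[ r₀ ] ∃[ v ] ∃[ m₁ ] ∃[ m₂ ] AgreeP A g h′ ×
            length r₀ + k ≤ m₁ × length r₀ + k ≤ m₂ ×
            (∀ {x} → x ∈ A → let y = run h′ (r₀ ++ pos (v ++ replicate m₁ false ++ replicate m₂ true)) x in to (h′ false) y ≡ y)
          raised with settle high-jump (length prefix + k)
          ... | h′ , v , m₁ , m₂ , ag , k≤m₁ , k≤m₂ , fixes = h′ , prefix , v , m₁ , m₂
            , (λ b → agree-extend (g b) (h₀ b) (h′ b) (λ x∈ → ∈-++⁺ˡ (A⊆G x∈)) (g~h₀ b) (ag b))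
            , k≤m₁ , k≤m₂
            , λ {x} x∈ → subst (λ y → to (h′ false) y ≡ y)
                (sym (trans (run-++ h′ prefix _ x) (cong (run h′ (pos (v ++ replicate m₁ false ++ replicate m₂ true))) (run-prefix ag x∈))))
                (fixes (∈-map⁺ _ x∈))

  -- Capturing a finite set

  opaque
    -- A positive constant that bounds the diameter of `W` is a Katetov function, and the empty
    -- upper set puts the new point on top.
    apex : ∀ W → ∃[ K ] ∃[ c ] 0ℚ <ℚ K × (∀ {w} → w ∈ W → d c w ≡ K × w < c)
    apex W =
      let K , 0<K , bound = upperBound d W W
          0≤K = ℚₚ.<⇒≤ 0<K
          c , at = onePoint W (λ _ → K) (λ _ → ⊥) (λ _ → 0<K) (λ _ _ → p≤p⊕q M.nonNegative)
                     (λ x∈ y∈ → ℚₚ.≤-trans (bound x∈ y∈) (p≤p⊕q 0≤K)) (λ ())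
      in K , c , 0<K , λ w∈ → let dist , _ , above = at w∈ in dist , above λ ()

  -- The two long last blocks prevent a path that follows the word from staying
  -- within a short list of points.
  Captures : ℕ → Pair → List Carrier → Set
  Captures k h F = ∃[ r₀ ] ∃[ v ] ∃[ m₁ ] ∃[ m₂ ] length r₀ + k ≤ m₁ × length r₀ + k ≤ m₂ ×
    (∀ {x} → x ∈ F → let y = run h (r₀ ++ pos (v ++ replicate m₁ false ++ replicate m₂ true)) x in to (h false) y ≡ y)

  opaque
    captureFixed : ∀ g A {c₀} → c₀ ∈ A → (∀ b → to (g b) c₀ ≡ c₀) → ∀ k → Σ[ h ∈ Pair ] AgreeP A g h × Captures k h A
    captureFixed g A c₀∈ gc₀ k =
      let h , D , r , A⊆D , g~h , det , high = Pushing.Tracked.pushed g A c₀∈ lows lows⊆A separated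
          module R = Raised h D r A⊆D g~h (λ {h′} → det {h′}) high
          S = climb (h true) R.q (D true) R.zs A C (A⊆D true c₀∈) (λ Cc → A⊆D true (proj₁ Cc) , R.h-C Cc true) R.highZ R.n
          module S = R.Climb′ S k
          q′ , q~q′ , free = freeStep R.q S.G (map S.cur A) S.E (S.A⊆G c₀∈)
          h′ , r₀ , v , m₁ , m₂ , ag , rest = S.Jump.raised q′ q~q′ free
      in h′ , ag , r₀ , v , m₁ , m₂ , rest
      where
      open Rising g A c₀∈ gc₀
      open Pushing g A c₀∈ using (C)

    -- An apex over `A` and its images is equally far from a point and its image and lies above
    -- both, so each generator may fix it.
    adjoinFixed : ∀ g A → Σ[ g′ ∈ Pair ] ∃[ c ] AgreeP A g g′ × (∀ b → to (g′ b) c ≡ c)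
    adjoinFixed g A = (λ b → proj₁ (ext b)) , c
      , (λ b x x∈ → proj₂ (ext b) (there (∈-map⁺ _ x∈))) , (λ b → proj₂ (ext b) (here refl))
      where
      W : List Carrier
      W = A ++ map (to (g true)) A ++ map (to (g false)) A
      top : ∃[ K ] ∃[ c ] 0ℚ <ℚ K × (∀ {w} → w ∈ W → d c w ≡ K × w < c)
      top = apex W
      c : Carrier
      c = proj₁ (proj₂ top)
      far : ∀ {w} → w ∈ W → d c w ≡ proj₁ top
      far w∈ = proj₁ (proj₂ (proj₂ (proj₂ top)) w∈)
      above : ∀ {w} → w ∈ W → w < c
      above w∈ = proj₂ (proj₂ (proj₂ (proj₂ top)) w∈)
      inW : ∀ b {x} → x ∈ A → to (g b) x ∈ W
      inW true  x∈ = ∈-++⁺ʳ A (∈-++⁺ˡ (∈-map⁺ _ x∈))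
      inW false x∈ = ∈-++⁺ʳ A (∈-++⁺ʳ (map (to (g true)) A) (∈-map⁺ _ x∈))
      ps : Bool → List (Carrier × Carrier)
      ps b = (c , c) ∷ map (λ x → x , to (g b) x) A
      iso : ∀ b {p q} → p ∈ ps b → q ∈ ps b → d (proj₂ p) (proj₂ q) ≡ d (proj₁ p) (proj₁ q)
      iso b (here refl) (here refl) = refl
      iso b (here refl) (there q∈) with x , x∈ , refl ← ∈-map⁻ _ q∈ = trans (far (inW b x∈)) (sym (far (∈-++⁺ˡ x∈)))
      iso b (there p∈) (here refl) with x , x∈ , refl ← ∈-map⁻ _ p∈ =
        trans (M.sym _ _) (trans (trans (far (inW b x∈)) (sym (far (∈-++⁺ˡ x∈)))) (M.sym _ _))
      iso b (there p∈) (there q∈) with _ , _ , refl ← ∈-map⁻ _ p∈ | _ , _ , refl ← ∈-map⁻ _ q∈ = to-isometric (g b) _ _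
      mono : ∀ b {p q} → p ∈ ps b → q ∈ ps b → proj₁ p < proj₁ q → proj₂ p < proj₂ q
      mono b (here refl) (here refl) lt = lt
      mono b (here refl) (there q∈) lt with x , x∈ , refl ← ∈-map⁻ _ q∈ = contradiction lt (O.asym (above (∈-++⁺ˡ x∈)))
      mono b (there p∈) (here refl) lt with x , x∈ , refl ← ∈-map⁻ _ p∈ = above (inW b x∈)
      mono b (there p∈) (there q∈) lt with _ , _ , refl ← ∈-map⁻ _ p∈ | _ , _ , refl ← ∈-map⁻ _ q∈ = to-< (g b) lt
      ext : ∀ b → Σ[ s ∈ Automorphism QU ] (∀ {p} → p ∈ ps b → to s (proj₁ p) ≡ proj₂ p)
      ext b = extend (ps b) (iso b) (mono b)

    capture : ∀ g A k → Σ[ h ∈ Pair ] AgreeP A g h × Captures k h A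
    capture g A k =
      let g′ , c , g~g′ , fix = adjoinFixed g A
          h , g′~h , r₀ , v , m₁ , m₂ , k≤m₁ , k≤m₂ , fixes = captureFixed g′ (c ∷ A) (here refl) fix k
      in h , (λ b → agree-extend (g b) (g′ b) (h b) there (g~g′ b) (g′~h b))
       , r₀ , v , m₁ , m₂ , k≤m₁ , k≤m₂ , λ x∈ → fixes (there x∈)

  -- Agreement of pairs and captured points

  AgreeP-trans : ∀ {F} g h k → AgreeP F g h → AgreeP F h k → AgreeP F g k
  AgreeP-trans g h k g~h h~k b = agree-extend (g b) (h b) (k b) id (g~h b) (h~k b)

  AgreeP-⊆ : ∀ {F G} g h → F ⊆ G → AgreeP G g h → AgreeP F g h
  AgreeP-⊆ g h F⊆G g~h b x x∈ = g~h b x (F⊆G x∈)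

  Fixes : Pair → Carrier → Set
  Fixes h x = ∀ b → to (h b) x ≡ x

  -- Equivalently, r⁻¹ q r fixes x.
  Captured : Pair → Word → Carrier → Set
  Captured h r x = to (h false) (run h r x) ≡ run h r x

  orbit-end : ∀ h r x → run h r x ∈ orbit h r x
  orbit-end h []      x = here refl
  orbit-end h (t ∷ r) x = there (orbit-end h r _)

  captured-agree : ∀ h h′ r {x} → AgreeP (orbit h r x) h h′ → Captured h r x → Captured h′ r x
  captured-agree h h′ r {x} ag cap rewrite run-agree {h} {h′} r ag = trans (ag false _ (orbit-end h r x)) cap

  captured-agree⁻ : ∀ h h′ r {x} → AgreeP (orbit h r x) h h′ → Captured h′ r x → Captured h r x
  captured-agree⁻ h h′ r {x} ag cap =
    trans (sym (ag false _ (orbit-end h r x))) (subst (λ y → to (h′ false) y ≡ y) (run-agree {h} {h′} r ag) cap)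

  -- A common fixed point has only itself as preimage under each letter, so the path can be traced
  -- back from its end.
  fixes-run⁻ : ∀ h r {x} → Fixes h (run h r x) → run h r x ≡ x
  fixes-run⁻ h []      fix = refl
  fixes-run⁻ h (t ∷ r) {x} fix = trans eq (back t (λ b → subst (λ y → to (h b) y ≡ y) eq (fix b)))
    where
    eq : run h r (to (act h t) x) ≡ to (act h t) x
    eq = fixes-run⁻ h r fix
    back : ∀ t → Fixes h (to (act h t) x) → to (act h t) x ≡ x
    back (b , true)  fx = to-injective (h b) (fx b)
    back (b , false) fx = trans (sym (fx b)) (to-from (h b) x)

  update : Bool → Automorphism QU → Pair → Pair
  update true  s h = pair s (h false)
  update false s h = pair (h true) s

  update-same : ∀ b s h → update b s h b ≡ s
  update-same true  s h = refl
  update-same false s h = refl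

  update-agree : ∀ h b {s D} → Agree D (h b) s → AgreeP D h (update b s h)
  update-agree h true  ag true  = ag
  update-agree h true  ag false = λ _ _ → refl
  update-agree h false ag true  = λ _ _ → refl
  update-agree h false ag false = ag

  newPoint : ∀ D → ∃[ z ] z ∉ D
  newPoint D = let _ , z , _ , at = apex D in z , λ z∈ → O.irrefl refl (proj₂ (at z∈))

  -- Escaping from a finite set

  Evades : Pair → List Carrier → List Bool → Carrier → Set
  Evades h D v y = Σ[ h′ ∈ Pair ] AgreeP D h h′ × ¬ Captured h′ (pos v) y

  -- Outside `D` the next positive letter is not yet prescribed, and its free value avoids `D` and
  -- `z`, so the situation recurs with `z` added to `D`. At the end q is not prescribed either, and
  -- a free value moves the endpoint.
  fresh : ∀ v h D {c z} → c ∈ D → z ∉ D → Evades h D v z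
  fresh [] h D {z = z} c∈ z∉ with freeStep (h false) D [ z ] [ z ] c∈
  ... | s , ag , free = update false s h , update-agree h false ag , λ eq → z∉ (free-fixed {h false} (free (here refl) (here refl)) eq)
  fresh (b ∷ v) h D {z = z} c∈ z∉ with freeStep (h b) D [ z ] (z ∷ D) c∈
  ... | s , ag , free = h′ , AgreeP-trans h h₁ h′ (update-agree h b ag) (AgreeP-⊆ h₁ h′ there h₁~h′)
                      , λ cap → evades (subst (Captured h′ (pos v)) hz cap)
    where
    h₁ : Pair
    h₁ = update b s h
    sz∉ : to s z ∉ z ∷ D
    sz∉ sz∈ with proj₁ (free (here refl) sz∈)
    ... | w , w∈ , le = z∉ (subst (_∈ D) (sym z≡w) w∈)
      where
      z≡w : z ≡ w
      z≡w = d≤0⇒≡ (ℚₚ.≤-trans (p≤p⊕q M.nonNegative) (subst (d z w ⊕ d (to (h b) w) (to s z) ≤ℚ_) dxx≡0 le))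
    rest : Evades h₁ (z ∷ D) v (to s z)
    rest = fresh v h₁ (z ∷ D) (here refl) sz∉
    h′ : Pair
    h′ = proj₁ rest
    h₁~h′ : AgreeP (z ∷ D) h₁ h′
    h₁~h′ = proj₁ (proj₂ rest)
    evades : ¬ Captured h′ (pos v) (to s z)
    evades = proj₂ (proj₂ rest)
    hz : to (h′ b) z ≡ to s z
    hz = trans (h₁~h′ b z (here refl)) (cong (λ k → to k z) (update-same b s h))

  Stays : Pair → List Carrier → List Bool → Carrier → Set
  Stays h D []      y = y ∈ D
  Stays h D (b ∷ v) y = y ∈ D × Stays h D v (to (h b) y)

  stays-++ : ∀ h D v v′ {y} → Stays h D (v ++ v′) y → Stays h D v′ (run h (pos v) y)
  stays-++ h D []      v′ st       = st
  stays-++ h D (b ∷ v) v′ (_ , st) = stays-++ h D v v′ st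

  stays-start : ∀ h D v {y} → Stays h D v y → y ∈ D
  stays-start h D []      st       = st
  stays-start h D (b ∷ v) (y∈ , _) = y∈

  stays-power : ∀ h D b m v {y} → Stays h D (replicate m b ++ v) y → ∀ {i} → i ≤ m → h b ^ i · y ∈ D
  stays-power h D b m       v st        {zero}  _         = stays-start h D (replicate m b ++ v) st
  stays-power h D b (suc m) v {y} (_ , st) {suc i} (s≤s i≤m) = subst (_∈ D) (pow-suc (h b) i y) (stays-power h D b m v st i≤m)

  stays⊎evades : ∀ v h D {c} → c ∈ D → ∀ y → Stays h D v y ⊎ Evades h D v y
  stays⊎evades v h D c∈ y with em {P = y ∈ D}
  ... | no y∉ = inj₂ (fresh v h D c∈ y∉)
  stays⊎evades []      h D c∈ y | yes y∈ = inj₁ y∈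
  stays⊎evades (b ∷ v) h D c∈ y | yes y∈ with stays⊎evades v h D c∈ (to (h b) y)
  ... | inj₁ st = inj₁ (y∈ , st)
  ... | inj₂ (h′ , ag , ev) = inj₂ (h′ , ag , λ cap → ev (subst (Captured h′ (pos v)) (ag b y y∈) cap))

  Spell : Word → List Bool → ℕ → ℕ → Word
  Spell r₀ v m₁ m₂ = r₀ ++ pos (v ++ replicate m₁ false ++ replicate m₂ true)

  -- The path along `r₀` is kept by adding it to `D`, which then has |A| + |r₀| + 1 points. If the
  -- remaining path never leaves `D`, each long block outlasts `D`: the point `y` where the q-block
  -- starts is fixed by q, hence also starts the p-block and is fixed by p. Traced back, the path
  -- shows that `y` is `x`, which is moved.
  evade : ∀ h A {x} r₀ v m₁ m₂ → x ∈ A → ¬ Fixes h x →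
    length r₀ + suc (length A) ≤ m₁ → length r₀ + suc (length A) ≤ m₂ →
    Σ[ h′ ∈ Pair ] AgreeP A h h′ × ¬ Captured h′ (Spell r₀ v m₁ m₂) x
  evade h A {x} r₀ v m₁ m₂ x∈ ¬fix le₁ le₂ = finish (stays⊎evades v′ h D (∈-++⁺ˡ x∈) (run h r₀ x))
    where
    D : List Carrier
    D = A ++ orbit h r₀ x
    v′ : List Bool
    v′ = v ++ replicate m₁ false ++ replicate m₂ true
    len : ∀ {m} → length r₀ + suc (length A) ≤ m → length D ≤ m
    len {m} le = subst (_≤ m) (sym (trans (Listₚ.length-++ A) (trans (cong (length A +_) (length-orbit h r₀ x))
               (trans (ℕₚ.+-suc (length A) (length r₀)) (trans (cong suc (ℕₚ.+-comm (length A) (length r₀)))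
                 (sym (ℕₚ.+-suc (length r₀) (length A)))))))) le
    finish : Stays h D v′ (run h r₀ x) ⊎ Evades h D v′ (run h r₀ x) →
             Σ[ h′ ∈ Pair ] AgreeP A h h′ × ¬ Captured h′ (Spell r₀ v m₁ m₂) x
    finish (inj₂ (h′ , ag , ev)) = h′ , AgreeP-⊆ h h′ ∈-++⁺ˡ ag , λ cap → ev (subst (λ y → to (h′ false) y ≡ y)
      (trans (run-++ h′ r₀ (pos v′) x) (cong (run h′ (pos v′)) (run-agree {h} {h′} r₀ (AgreeP-⊆ h h′ (∈-++⁺ʳ A) ag)))) cap)
    finish (inj₁ st) = contradiction (λ b → subst (λ z → to (h b) z ≡ z) y≡x (fixed b)) ¬fix
      where
      y : Carrier
      y = run h (pos v) (run h r₀ x)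
      st-q : Stays h D (replicate m₁ false ++ replicate m₂ true) y
      st-q = stays-++ h D v _ st
      q-fixed : to (h false) y ≡ y
      q-fixed = confined⇒fixed (h false) D m₁ (len le₁) (stays-power h D false m₁ _ st-q)
      after : run h (pos (replicate m₁ false)) y ≡ y
      after = trans (run-power h false m₁ y) (pow-fix (h false) m₁ q-fixed)
      st-p : Stays h D (replicate m₂ true ++ []) y
      st-p = subst₂ (Stays h D) (sym (Listₚ.++-identityʳ _)) after (stays-++ h D (replicate m₁ false) _ st-q)
      fixed : Fixes h y
      fixed true  = confined⇒fixed (h true) D m₂ (len le₂) (stays-power h D true m₂ [] st-p)
      fixed false = q-fixed
      y≡x : y ≡ x
      y≡x = trans (sym (run-++ h r₀ (pos v) x))
              (fixes-run⁻ h (r₀ ++ pos v) (λ b → subst (λ z → to (h b) z ≡ z) (sym (run-++ h r₀ (pos v) x)) (fixed b)))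

  enum : ℕ → List Carrier
  enum zero    = []
  enum (suc n) with em {P = ∃[ x ] Injection.to countable x ≡ n}
  ... | yes (x , _) = x ∷ enum n
  ... | no _        = enum n

  enum-complete : ∀ n {x} → Injection.to countable x ℕ.< n → x ∈ enum n
  enum-complete (suc n) {x} (s≤s le) with em {P = ∃[ x ] Injection.to countable x ≡ n} | ℕₚ.m≤n⇒m<n∨m≡n le
  ... | yes (x′ , eq) | inj₂ eq′ = here (Injection.injective countable (trans eq′ (sym eq)))
  ... | yes _         | inj₁ lt  = there (enum-complete n lt)
  ... | no _          | inj₁ lt  = enum-complete n lt
  ... | no none       | inj₂ eq′ = contradiction (x , eq′) none

  enum-exhausts : ∀ F → ∃[ N ] (∀ {n} → N ≤ n → F ⊆ enum n)
  enum-exhausts []      = 0 , λ _ ()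
  enum-exhausts (x ∷ F) = let N , sub = enum-exhausts F ; N′ = suc (Injection.to countable x) in
    N ℕ.⊔ N′ , λ le → λ { (here refl) → enum-complete _ (ℕₚ.≤-trans (ℕₚ.m≤n⊔m N N′) le)
                        ; (there y∈) → sub (ℕₚ.≤-trans (ℕₚ.m≤m⊔n N N′) le) y∈ }

  -- The topology on pairs

  K : TopologicalGroup 0ℓ
  K = Aut QU
  module K = TopologicalGroup K

  gens : Automorphism QU × Automorphism QU → Pair
  gens (g₁ , g₂) = pair g₁ g₂

  ungens : Pair → Automorphism QU × Automorphism QU
  ungens h = h true , h false

  gens-ungens : ∀ {F} h → AgreeP F h (gens (ungens h))
  gens-ungens h true  _ _ = refl
  gens-ungens h false _ _ = refl

  open-basic : ∀ {V} → Topology.Open K.topology² V → ∀ {g} → V g →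
    ∃[ F ] (∀ h → AgreeP F (gens g) (gens h) → V h)
  open-basic oV g∈V =
    let _ , _ , oA , oB , g₁∈A , g₂∈B , A×B⊆V = oV g∈V
        F , F⊆A = oA g₁∈A
        G , G⊆B = oB g₂∈B
    in F ++ G , λ (h₁ , h₂) ag → A×B⊆V (F⊆A h₁ (λ x x∈ → ag true x (∈-++⁺ˡ x∈))) (G⊆B h₂ (λ x x∈ → ag false x (∈-++⁺ʳ F x∈)))

  basic-open : ∀ D (h : Automorphism QU × Automorphism QU) → Topology.Open K.topology² (λ h′ → AgreeP D (gens h) (gens h′))
  basic-open D h {x} {y} ag = Agree D x , Agree D y
    , (λ x~k → D , λ k′ k~k′ z z∈ → trans (k~k′ z z∈) (x~k z z∈))
    , (λ y~k → D , λ k′ k~k′ z z∈ → trans (k~k′ z z∈) (y~k z z∈))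
    , (λ _ _ → refl) , (λ _ _ → refl)
    , λ x~x′ y~y′ → λ { true z z∈ → trans (x~x′ z z∈) (ag true z z∈) ; false z z∈ → trans (y~y′ z z∈) (ag false z z∈) }

  -- Inside any basic neighbourhood there is a smaller one, around `h`, that misses `N`; so `h` is
  -- not in the closure.
  nowhereDense : ∀ {ℓ} (N : Automorphism QU × Automorphism QU → Set ℓ) →
    (∀ g F → Σ[ h ∈ Pair ] AgreeP F g h × ∃[ D ] (∀ h′ → AgreeP D h (gens h′) → ¬ N h′)) →
    NowhereDense K.topology² N
  nowhereDense N nearby V oV V⊆cl g g∈V =
    let F , F⊆V = open-basic {V} oV g∈V
        h , g~h , D , avoid = nearby (gens g) F
        h∈V = F⊆V (ungens h) (AgreeP-trans (gens g) h (gens (ungens h)) g~h (gens-ungens h))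
        n , h~n , n∈N = V⊆cl h∈V (λ h′ → AgreeP D (gens (ungens h)) (gens h′)) (basic-open D (ungens h)) (λ _ _ _ → refl)
    in avoid n (AgreeP-trans h (gens (ungens h)) (gens n) (gens-ungens h) h~n) n∈N

  -- Topological similarity and words

  Similar : Automorphism QU × Automorphism QU → Automorphism QU × Automorphism QU → Set₁
  Similar = TopologicallySimilar K

  module Transport {g f : Automorphism QU × Automorphism QU} (sim : Similar g f) where
    private
      module ⟨g⟩ = Group (generated K g)
      module ⟨f⟩ = Group (generated K f)
    open TopologicallySimilar sim public
    open GroupMorphisms ⟨g⟩.rawGroup ⟨f⟩.rawGroup using (module IsGroupIsomorphism)
    open IsGroupIsomorphism isGroupIsomorphism public using (∙-homo; ε-homo; ⁻¹-homo)

  Member : Automorphism QU × Automorphism QU → Automorphism QU → Set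
  Member (g₁ , g₂) = ⟨_,_⟩ K g₁ g₂

  act-member : ∀ g t → Member g (act (gens g) t)
  act-member g (true  , true)  = gen₁
  act-member g (false , true)  = gen₂
  act-member g (true  , false) = ⁻¹-mem gen₁
  act-member g (false , false) = ⁻¹-mem gen₂

  word-member : ∀ g r → Member g (word (gens g) r)
  word-member g []      = ε-mem
  word-member g (t ∷ r) = ∙-mem (word-member g r) (act-member g t)

  conj : Pair → Word → Automorphism QU
  conj h r = word h r ⁻¹ ∙ (h false ∙ word h r)

  conj-member : ∀ g r → Member g (conj (gens g) r)
  conj-member g r = ∙-mem (⁻¹-mem (word-member g r)) (∙-mem gen₂ (word-member g r))

  module _ {g f : Automorphism QU × Automorphism QU} (sim : Similar g f) where
    open Transport sim
    private
      module ⟨f⟩ = Group (generated K f)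
      φ₁ : ∃ (Member g) → Automorphism QU
      φ₁ x = proj₁ (φ x)

    φ-act : ∀ t → φ₁ (act (gens g) t , act-member g t) K.≈ act (gens f) t
    φ-act (true  , true)  = φ-gen₁
    φ-act (false , true)  = φ-gen₂
    φ-act (true  , false) = K.trans {φ₁ (_ , ⁻¹-mem gen₁)} {φ₁ (_ , gen₁) ⁻¹} {proj₁ f ⁻¹}
      (⁻¹-homo (_ , gen₁)) (K.⁻¹-cong {φ₁ (_ , gen₁)} {proj₁ f} φ-gen₁)
    φ-act (false , false) = K.trans {φ₁ (_ , ⁻¹-mem gen₂)} {φ₁ (_ , gen₂) ⁻¹} {proj₂ f ⁻¹}
      (⁻¹-homo (_ , gen₂)) (K.⁻¹-cong {φ₁ (_ , gen₂)} {proj₂ f} φ-gen₂)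

    φ-∙ : ∀ {x y x′ y′} (x∈ : Member g x) (y∈ : Member g y) → φ₁ (x , x∈) K.≈ x′ → φ₁ (y , y∈) K.≈ y′ →
          φ₁ (x ∙ y , ∙-mem x∈ y∈) K.≈ (x′ ∙ y′)
    φ-∙ {x} {y} {x′} {y′} x∈ y∈ ex ey = K.trans {φ₁ (x ∙ y , ∙-mem x∈ y∈)} {φ₁ (x , x∈) ∙ φ₁ (y , y∈)} {x′ ∙ y′}
      (∙-homo (x , x∈) (y , y∈)) (K.∙-cong {φ₁ (x , x∈)} {x′} {φ₁ (y , y∈)} {y′} ex ey)

    φ-word : ∀ r → φ₁ (word (gens g) r , word-member g r) K.≈ word (gens f) r
    φ-word []      = ε-homo
    φ-word (t ∷ r) = φ-∙ {x′ = word (gens f) r} {act (gens f) t} (word-member g r) (act-member g t) (φ-word r) (φ-act t)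

    φ-conj : ∀ r → φ₁ (conj (gens g) r , conj-member g r) K.≈ conj (gens f) r
    φ-conj r = φ-∙ {x′ = wf ⁻¹} {proj₂ f ∙ wf} (⁻¹-mem (word-member g r)) (∙-mem gen₂ (word-member g r))
      (K.trans {φ₁ (wg ⁻¹ , ⁻¹-mem (word-member g r))} {φ₁ (wg , word-member g r) ⁻¹} {wf ⁻¹} (⁻¹-homo (wg , word-member g r))
         (K.⁻¹-cong {φ₁ (wg , word-member g r)} {wf} (φ-word r)))
      (φ-∙ {x′ = proj₂ f} {wf} gen₂ (word-member g r) φ-gen₂ (φ-word r))
      where
      wg wf : Automorphism QU
      wg = word (gens g) r
      wf = word (gens f) r

  captured⇒conj : ∀ h r {x} → Captured h r x → to (conj h r) x ≡ x
  captured⇒conj h r cap = trans (cong (from (word h r)) cap) (from-to (word h r) _)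

  conj⇒captured : ∀ h r {x} → to (conj h r) x ≡ x → Captured h r x
  conj⇒captured h r eq = trans (sym (to-from (word h r) _)) (cong (run h r) eq)

  -- Similarity preserves convergence to the identity; F witnesses it at x.
  transfer : ∀ {g₀ g f} → Similar g₀ f → Similar g f → ∀ x →
    ∃[ F ] (∀ r → (∀ {y} → y ∈ F → Captured (gens g₀) r y) → Captured (gens g) r x)
  transfer {g₀} {g} {f} sim₀ sim x =
    let F , F⊆W = oW ε∈W in
    F , λ r caps → conj⇒captured (gens g) r (trans (sym (ψ-conj r x))
          (W⊆ {conj (gens g₀) r , conj-member g₀ r} (F⊆W (conj (gens g₀) r) λ y y∈ → captured⇒conj (gens g₀) r (caps y∈))))
    where
    module S₀ = Transport sim₀
    module S  = Transport sim
    V : ∃ (Member g) → Set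
    V k = to (proj₁ k) x ≡ x
    V-open : Topology.Open (generated-topology K g) V
    V-open = (λ k → to k x ≡ x) , (λ {k} kx → [ x ] , λ h k~h → trans (k~h x (here refl)) kx) , (λ p → p) , (λ p → p)
    preimage : Topology.Open (generated-topology K g₀) (λ k → V (S.φ⁻¹ (S₀.φ k)))
    preimage = S₀.φ-continuous (λ k → V (S.φ⁻¹ k)) (S.φ⁻¹-continuous V V-open)
    W : Automorphism QU → Set
    W = proj₁ preimage
    oW : Topology.Open K.topology W
    oW = proj₁ (proj₂ preimage)
    ⊆W : ∀ {k} → V (S.φ⁻¹ (S₀.φ k)) → W (proj₁ k)
    ⊆W = proj₁ (proj₂ (proj₂ preimage))
    W⊆ : ∀ {k} → W (proj₁ k) → V (S.φ⁻¹ (S₀.φ k))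
    W⊆ = proj₂ (proj₂ (proj₂ preimage))
    -- The isomorphism between the groups of `g₀` and `g` runs through that of `f`; elements
    -- correspond if they have the same image there.
    ψ-≈ : ∀ {k₀ k a} → proj₁ (S₀.φ k₀) K.≈ a → proj₁ (S.φ k) K.≈ a → proj₁ (S.φ⁻¹ (S₀.φ k₀)) K.≈ proj₁ k
    ψ-≈ {k₀} {k} e₀ e = proj₂ S.inverse {k} {S₀.φ k₀} (λ z → trans (e₀ z) (sym (e z)))
    ψ-conj : ∀ r → proj₁ (S.φ⁻¹ (S₀.φ (conj (gens g₀) r , conj-member g₀ r))) K.≈ conj (gens g) r
    ψ-conj r = ψ-≈ {_ , conj-member g₀ r} {_ , conj-member g r} {conj (gens f) r} (φ-conj sim₀ r) (φ-conj sim r)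
    ε∈W : W ε
    ε∈W = ⊆W {ε , ε-mem} (ψ-≈ {ε , ε-mem} {ε , ε-mem} {ε} S₀.ε-homo S.ε-homo x)

  -- Generic pairs and the two cases

  module _ (f : Automorphism QU × Automorphism QU) where

    -- A dense G-delta condition: for each n it is dense by `capture`, and open because a witness
    -- involves finitely many values.
    Generic : Automorphism QU × Automorphism QU → Set
    Generic g = ∀ n → Captures n (gens g) (enum n)

    meager-if-not-generic : (∀ {g} → Similar g f → ¬ Generic g) → Meager K.topology² (SimilarityClass K f)
    meager-if-not-generic none = N , (λ n → nowhereDense (N n) (nearby n)) , (cover , λ { (_ , sim , _) → sim })
      where
      N : ℕ → Automorphism QU × Automorphism QU → Set₁
      -- `Meager` asks for equality with the union, so the pieces are intersected with the class.
      N n g = Similar g f × ¬ Captures n (gens g) (enum n)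
      cover : ∀ {g} → Similar g f → ∃[ n ] N n g
      cover {g} sim with em {P = ∃[ n ] ¬ Captures n (gens g) (enum n)}
      ... | yes (n , ¬cap) = n , sim , ¬cap
      ... | no all = contradiction (λ n → byContra λ ¬cap → all (n , ¬cap)) (none sim)
      nearby : ∀ n g F → Σ[ h ∈ Pair ] AgreeP F g h × ∃[ D ] (∀ h′ → AgreeP D h (gens h′) → ¬ N n h′)
      nearby n g F with capture g (F ++ enum n) n
      ... | h , g~h , r₀ , v , m₁ , m₂ , le₁ , le₂ , caps = h , AgreeP-⊆ g h ∈-++⁺ˡ g~h
          , concatMap (orbit h r) (enum n)
          , λ h′ h~h′ (_ , ¬cap) → ¬cap (r₀ , v , m₁ , m₂ , le₁ , le₂ , λ {x} x∈ →
              captured-agree h (gens h′) r (AgreeP-⊆ h (gens h′) (λ y∈ → ∈-concatMap⁺ (orbit h r) (lose x∈ y∈)) h~h′)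
                (caps (∈-++⁺ʳ F x∈)))
        where
        r : Word
        r = Spell r₀ v m₁ m₂

    meager-if-generic : ∀ {g₀} → Similar g₀ f → Generic g₀ → Meager K.topology² (SimilarityClass K f)
    meager-if-generic {g₀} sim₀ generic = N , (λ n → nowhereDense (N n) (nearby n)) , (cover , λ { (_ , sim , _) → sim })
      where
      r₀ : ℕ → Word
      r₀ n = proj₁ (generic n)
      v : ℕ → List Bool
      v n = proj₁ (proj₂ (generic n))
      m₁ m₂ : ℕ → ℕ
      m₁ n = proj₁ (proj₂ (proj₂ (generic n)))
      m₂ n = proj₁ (proj₂ (proj₂ (proj₂ (generic n))))
      r : ℕ → Word
      r n = Spell (r₀ n) (v n) (m₁ n) (m₂ n)
      le₁ : ∀ n → length (r₀ n) + n ≤ m₁ n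
      le₁ n = proj₁ (proj₂ (proj₂ (proj₂ (proj₂ (generic n)))))
      le₂ : ∀ n → length (r₀ n) + n ≤ m₂ n
      le₂ n = proj₁ (proj₂ (proj₂ (proj₂ (proj₂ (proj₂ (generic n))))))
      caps : ∀ n {x} → x ∈ enum n → Captured (gens g₀) (r n) x
      caps n = proj₂ (proj₂ (proj₂ (proj₂ (proj₂ (proj₂ (generic n))))))

      Settled : ℕ → Pair → Carrier → Set
      Settled n g x = ¬ Fixes g x × (∀ j → n ≤ j → Captured g (r j) x)
      N : ℕ → Automorphism QU × Automorphism QU → Set₁
      -- The identity pair moves no point, so it needs an alternative of its own.
      N n g = Similar g f × ((∀ x → Fixes (gens g) x) ⊎ ∃[ x ] x ∈ enum n × Settled n (gens g) x)

      cover : ∀ {g} → Similar g f → ∃[ n ] N n g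
      cover {g} sim with em {P = ∃[ x ] ¬ Fixes (gens g) x}
      ... | no none = 0 , sim , inj₁ (λ x → byContra λ ¬fix → none (x , ¬fix))
      ... | yes (x , ¬fix) =
        let F , captured = transfer sim₀ sim x
            M , sub = enum-exhausts (x ∷ F)
        in M , sim , inj₂ (x , sub ℕₚ.≤-refl (here refl) , ¬fix , λ j M≤j → captured (r j) (λ y∈ → caps j (sub M≤j (there y∈))))

      -- A point that `h` fixes is dealt with by prescribing agreement there. For a moved point,
      -- `evade` is applied to the word of index j, chosen to exceed both n and the number of points
      -- whose values must be kept.
      unsettle : ∀ L n g D → Σ[ h ∈ Pair ] AgreeP D g h × ∃[ D′ ] (∀ h′ → AgreeP D′ h h′ → ∀ {x} → x ∈ L → ¬ Settled n h′ x)
      unsettle []      n g D = g , (λ _ _ _ → refl) , [] , λ _ _ ()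
      unsettle (x ∷ L) n g D with unsettle L n g D
      ... | h , g~h , D₁ , avoid with em {P = Fixes h x}
      ...   | yes fix = h , g~h , x ∷ D₁ , λ h′ h~h′ →
              λ { (here refl) (¬fix , _) → ¬fix (λ b → trans (h~h′ b x (here refl)) (fix b))
                ; (there x∈) → avoid h′ (AgreeP-⊆ h h′ there h~h′) x∈ }
      ...   | no ¬fix with evade h (x ∷ D ++ D₁) (r₀ j) (v j) (m₁ j) (m₂ j) (here refl) ¬fix
                              (ℕₚ.≤-trans (ℕₚ.+-monoʳ-≤ (length (r₀ j)) big) (le₁ j))
                              (ℕₚ.≤-trans (ℕₚ.+-monoʳ-≤ (length (r₀ j)) big) (le₂ j))
        where
        j : ℕ
        j = n + suc (length (x ∷ D ++ D₁))
        big : suc (length (x ∷ D ++ D₁)) ≤ j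
        big = ℕₚ.m≤n+m _ n
      ...     | k , h~k , ¬cap = k , AgreeP-trans g h k g~h (AgreeP-⊆ h k (λ y∈ → there (∈-++⁺ˡ y∈)) h~k)
              , D₁ ++ orbit k (r j) x
              , λ h′ k~h′ → λ { (here refl) (_ , cap) → ¬cap
                    (captured-agree⁻ k h′ (r j) (AgreeP-⊆ k h′ (∈-++⁺ʳ D₁) k~h′) (cap j (ℕₚ.m≤m+n n _)))
                              ; (there x∈) → avoid h′
                    (AgreeP-trans h k h′ (AgreeP-⊆ h k (λ y∈ → there (∈-++⁺ʳ D y∈)) h~k) (AgreeP-⊆ k h′ ∈-++⁺ˡ k~h′)) x∈ }
        where
        j : ℕ
        j = n + suc (length (x ∷ D ++ D₁))

      nearby : ∀ n g F → Σ[ h ∈ Pair ] AgreeP F g h × ∃[ D ] (∀ h′ → AgreeP D h (gens h′) → ¬ N n h′)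
      nearby n g F =
        let c , _ = newPoint []
            z , z∉ = newPoint (c ∷ F)
            -- For the empty word, `fresh` merely makes q move the new point `z`, which excludes the
            -- identity pair.
            h , g~h , moved = fresh [] g (c ∷ F) (here refl) z∉
            k , h~k , D , avoid = unsettle (enum n) n h (z ∷ F)
        in k , AgreeP-trans g h k (AgreeP-⊆ g h there g~h) (AgreeP-⊆ h k there h~k) , z ∷ D
         , λ h′ k~h′ → λ { (_ , inj₁ fix) → moved (trans (sym (trans (k~h′ false z (here refl)) (h~k false z (here refl)))) (fix z false))
                         ; (_ , inj₂ (x , x∈ , settled)) → avoid (gens h′) (AgreeP-⊆ k (gens h′) there k~h′) x∈ settled }

    meager : Meager K.topology² (SimilarityClass K f)
    meager with em {P = ∃[ g₀ ] Similar g₀ f × Generic g₀}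
    ... | yes (g₀ , sim₀ , generic) = meager-if-generic sim₀ generic
    ... | no none = meager-if-not-generic λ {g} sim generic → none (g , sim , generic)

theorem5p6 : (∀ {ℓ} → ExcludedMiddle ℓ) →
    (QU : OrderedMetricSpace) → IsRandomlyOrderedRationalUrysohn QU →
    (f : Automorphism QU × Automorphism QU) →
    Meager (TopologicalGroup.topology² (Aut QU)) (SimilarityClass (Aut QU) f)
theorem5p6 em QU isU f = Urysohn.meager em QU isU f
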